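{- Let $\alpha<1$ and consider the game on $\mathbb{Z}^2$ in which Maker plays $m(t)=t^\alpha$ points on his $t$-th turn and Breaker plays $b(t)$ points on his $t$-th turn, with winning line segments of size $n$. If $b(t)=\omega(t^{1-\alpha})$ then the game is a Breaker win.
   Context: Let $m,b\colon\mathbb{N}\to\mathbb{N}$ be monotone increasing functions. Two players, Maker and Breaker, play in timesteps $t=1,2,\dots$; in timestep $t$ Maker first claims $m(t)$ previously unclaimed points of $\mathbb{Z}^2$, then Breaker claims $b(t)$ previously unclaimed points of $\mathbb{Z}^2$. A winning line segment is a set of $n$ points claimed by Maker lying on a common straight line (any direction) with no point claimed by Breaker on that line between the first and last of these $n$ points (other points of either player may lie on the line). Let $\tau_n$ be the earliest time by which Maker can guarantee (against every Breaker strategy) to have formed a winning line segment of $n$ points. The game is a Breaker win if $m(\tau_n)=(1-o(1))n$ as $n\to\infty$. The notation $f=\omega(g)$ means $f(n)/g(n)\to\infty$. -}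

module Defs where

open import Data.Nat as ℕ using (ℕ; zero; suc; _≤_; _<_; _^_)
open import Data.Integer as ℤ using (ℤ)
open import Data.Rational as ℚ using (ℚ; ↥_; ↧ₙ_; 0ℚ; 1ℚ)
open import Data.Product using (Σ; ∃; ∃-syntax; _×_; _,_)
open import Data.Sum using (_⊎_)
open import Data.List using (List; []; length; _++_)
open import Data.List.Relation.Unary.All using (All)
open import Data.List.Relation.Unary.Unique.Propositional using (Unique)
open import Data.List.Membership.Propositional using (_∈_; _∉_)
open import Relation.Binary.PropositionalEquality using (_≡_)
open import Relation.Nullary using (¬_)

-- Non-negative real numbers, given by their (rounded) upper Dedekind cut.
-- `Up q` means "q > α".  The axioms say: Up is inhabited, upward closed,
-- rounded (open), and contains only positive rationals (so α ≥ 0).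
-- Then α = inf { q | Up q }.

record NonNegReal : Set₁ where
  field
    Up          : ℚ → Set
    inhabited   : ∃[ q ] Up q
    upClosed    : ∀ {q r} → Up q → q ℚ.≤ r → Up r
    rounded     : ∀ {q} → Up q → ∃[ r ] (r ℚ.< q × Up r)
    positive    : ∀ {q} → Up q → 0ℚ ℚ.< q

open NonNegReal public

_<1 : NonNegReal → Set
α <1 = Up α 1ℚ

-- For q > 0 written as num/den:  x ≤ t^q  ⇔  x^den ≤ t^num.
num : ℚ → ℕ
num q = ℤ.∣ ↥ q ∣

-- x ≤ t ^ α   (for t ≥ 1): for every rational q > α, x ≤ t^q.
LeRPow : ℕ → ℕ → NonNegReal → Set
LeRPow x t α = ∀ q → Up α q → x ^ (↧ₙ q) ≤ t ^ (num q)

-- t ^ α < y   (for t ≥ 1): some rational q > α has t^q < y.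
RPowLt : ℕ → NonNegReal → ℕ → Set
RPowLt t α y = ∃[ q ] (Up α q × t ^ (num q) < y ^ (↧ₙ q))

IsFloorPow : NonNegReal → (ℕ → ℕ) → Set
IsFloorPow α m = ∀ t → 1 ≤ t → LeRPow (m t) t α × RPowLt t α (suc (m t))

-- K · t ≤ y · t^α   (for t ≥ 1): for every rational q > α,
-- (K t)^den ≤ y^den · t^num.
ScaledLe : ℕ → ℕ → ℕ → NonNegReal → Set
ScaledLe K t y α = ∀ q → Up α q →
  (K ℕ.* t) ^ (↧ₙ q) ≤ (y ^ (↧ₙ q)) ℕ.* (t ^ (num q))

-- b(t) = ω(t^(1-α)) :  for every K, eventually b(t) ≥ K · t^(1-α),
-- i.e. K · t ≤ b(t) · t^α.
IsOmegaPow1- : NonNegReal → (ℕ → ℕ) → Set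
IsOmegaPow1- α b = ∀ K → ∃[ T ] ∀ t → T ≤ t → 1 ≤ t → ScaledLe K t (b t) α

Monotone : (ℕ → ℕ) → Set
Monotone f = ∀ {s t} → s ≤ t → f s ≤ f t

Point : Set
Point = ℤ × ℤ

cross : Point → Point → Point → ℤ
cross (ax , ay) (bx , by) (cx , cy) =
  ((bx ℤ.- ax) ℤ.* (cy ℤ.- ay)) ℤ.- ((by ℤ.- ay) ℤ.* (cx ℤ.- ax))

dot : Point → Point → Point → ℤ
dot (ax , ay) (bx , by) (cx , cy) =
  ((bx ℤ.- ax) ℤ.* (cx ℤ.- ax)) ℤ.+ ((by ℤ.- ay) ℤ.* (cy ℤ.- ay))

OnSegment : Point → Point → Point → Set
-- (p collinear with a, c, and (a - p)·(c - p) ≤ 0; for a = c this forces p = a)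
OnSegment p a c = cross a c p ≡ ℤ.0ℤ × dot p a c ℤ.≤ ℤ.0ℤ

Collinear : List Point → Set
Collinear S = ∀ {a b c} → a ∈ S → b ∈ S → c ∈ S → cross a b c ≡ ℤ.0ℤ

Between : Point → List Point → Set
Between p S = ∃[ a ] ∃[ c ] (a ∈ S × c ∈ S × OnSegment p a c)

HasWinningSegment : ℕ → List Point → List Point → Set
HasWinningSegment n M B =
  ∃[ S ] (length S ≡ n × Unique S × All (_∈ M) S × Collinear S
          × (∀ {p} → p ∈ B → ¬ Between p S))

LegalMove : ℕ → List Point → List Point → Set
LegalMove k C L = length L ≡ k × Unique L × All (_∉ C) L

-- MakerWinsWithin n m b r t M B :
-- at the start of timestep t (Maker's points M, Breaker's points B),
-- Maker can guarantee a winning segment of n points by timestep t + r.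
MakerWinsWithin : ℕ → (ℕ → ℕ) → (ℕ → ℕ) → ℕ → ℕ → List Point → List Point → Set
MakerWinsWithin n m b zero t M B =
  ∃[ L ] (LegalMove (m t) (M ++ B) L × HasWinningSegment n (L ++ M) B)
MakerWinsWithin n m b (suc r) t M B =
  ∃[ L ] (LegalMove (m t) (M ++ B) L ×
    (HasWinningSegment n (L ++ M) B ⊎
     (∀ L' → LegalMove (b t) (L ++ M ++ B) L' →
        MakerWinsWithin n m b r (suc t) (L ++ M) (L' ++ B))))

MakerWinsBy : ℕ → (ℕ → ℕ) → (ℕ → ℕ) → ℕ → Set
MakerWinsBy n m b zero    = Data.Empty.⊥
  where import Data.Empty
MakerWinsBy n m b (suc r) = MakerWinsWithin n m b r 1 [] []

IsTau : ℕ → (ℕ → ℕ) → (ℕ → ℕ) → ℕ → Set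
IsTau n m b T = MakerWinsBy n m b T × (∀ T' → T' < T → ¬ MakerWinsBy n m b T')

-- Breaker win:  m(τ_n) = (1 - o(1)) n, i.e. m(τ_n)/n → 1:
-- for every k ≥ 1 there is N such that for all n ≥ N, |m(τ_n) - n| ≤ n / k.
BreakerWin : (ℕ → ℕ) → (ℕ → ℕ) → Set
BreakerWin m b = ∀ k → 1 ≤ k → ∃[ N ] ∀ n → N ≤ n → ∀ T → IsTau n m b T →
  (k ℕ.* m T ≤ k ℕ.* n ℕ.+ n) × (k ℕ.* n ≤ k ℕ.* m T ℕ.+ n)

{-# OPTIONS --safe #-}
module Submission where

-- Upper bound: m grows by at most one per turn, so if m τ > n then Maker could already
-- have played n points on an untouched line one turn earlier.
--
-- Lower bound: Breaker blocks a point x on a line by claiming the nearest point on either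
-- side of x that is not Maker's; afterwards no Breaker-free segment of that line through x
-- gains a further Maker point.  Cut time into blocks of B ^ l turns for every l.  When a
-- block ends, Breaker chooses a maximal family of disjoint segments carrying suc ρ points
-- of that block each, and blocks their end points during the next block of the same length;
-- afterwards a segment that can still grow has at most ρ points of the block.  Here ρ is
-- about n / 2 ^ j when the block is about B ^ j times shorter than the elapsed time, so the
-- contributions of the boundedly many blocks per level that cover the past sum to a small
-- multiple of n.  By the Szemerédi–Trotter theorem a block of s turns needs at most about
-- (s n)² / ρ³ + s n / ρ blockings, which for B = 2 ^ h with h large sums over the levels to
-- O (u / n) + u ^ ε per turn u; this is what b (u) = ω (u ^ (1 - α)) and u ^ α < n pay for.
--
-- Szemerédi–Trotter is obtained from the crossing lemma: a straight-line plane graph with v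
-- vertices has at most 3v edges, because an edge is the highest one to the right of its left
-- end, or the highest one to the left of its right end, or the first one below some vertex;
-- random sampling of the vertices then amplifies this bound.

open import Defs
open import Data.Nat as ℕ using (ℕ)
import Data.Nat.Properties as ℕₚ
import Data.Nat.Solver
open import Data.Integer as ℤ using (ℤ; 0ℤ)
import Data.Integer.Properties as ℤₚ
open ℤₚ using (i-j≡0⇒i≡j)
import Data.Integer.Solver
open import Data.Rational as ℚ using (↥_; ↧_; ↧ₙ_; 0ℚ; 1ℚ)
import Data.Rational.Properties as ℚₚ
open import Data.List using (List; []; _∷_; length; filter; _++_; cartesianProduct; map; take; drop; applyUpTo)
open import Data.List.Properties using (length-++; length-map; filter-++; length-filter; length-take; length-drop; length-applyUpTo; take++drop≡id; drop-drop; ++-assoc)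
open import Data.List.Relation.Unary.All as All using (All; []; _∷_)
import Data.List.Relation.Unary.All.Properties as Allₚ
open import Data.List.Relation.Unary.AllPairs using ([]; _∷_)
open import Data.List.Relation.Unary.Any using (here; there; any?; _─_)
open import Data.List.Relation.Unary.Unique.Propositional using (Unique)
import Data.List.Relation.Unary.Unique.Propositional.Properties as Uniqueₚ
open import Data.List.Membership.Propositional using (_∈_; _∉_; find; lose)
open import Data.List.Membership.Propositional.Properties using (∈-filter⁺; ∈-filter⁻; ∈-++⁻; ∈-++⁺ˡ; ∈-++⁺ʳ; ∈-map⁺; ∈-cartesianProduct⁺; ∈-cartesianProduct⁻; ∈-applyUpTo⁺; ∈-applyUpTo⁻)
open import Data.Product using (∃-syntax; _×_; _,_; proj₁; proj₂)
open import Data.Sum using (_⊎_; inj₁; inj₂; [_,_]′; reduce)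
open import Data.Empty using (⊥; ⊥-elim)
open import Function using (_∘_)
open import Relation.Nullary using (¬_; Dec; yes; no; contradiction)
open import Relation.Nullary.Decidable using (_×-dec_; _⊎-dec_; ¬?)
open import Relation.Unary using (Decidable)
open import Relation.Binary using (DecidableEquality; tri<; tri≈; tri>)
open import Relation.Binary.PropositionalEquality using (_≡_; _≢_; refl; sym; trans; cong; cong₂; subst; subst₂; module ≡-Reasoning)

-- Why several scales: the jobs of a block are spread over the turns of the next block, so at each
-- level up to two block lengths of recent turns stay uncontrolled. Shorter blocks with smaller
-- allowances control most of that remainder; once the allowance is about one point, single pairs
-- are separated at once. What fixes B: one level deeper the block length shrinks by B while the
-- cube of the inverse allowance grows by 8, so with B ≥ 16 the first Szemerédi-Trotter term halves
-- at least. The second term doubles, so its sum is about 2 ^ Λ for B ^ Λ near u. A rational r with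
-- α < r < 1 and denominator y makes b (u) at least of order u ^ (1 / y), and 2 ^ y ≤ B keeps 2 ^ Λ
-- within that order. Only segments through a point that Maker has just claimed need control: a
-- winning segment without one would have existed a turn earlier. Such a segment has at most m τ new
-- points, and the scale n′ = n / (16 B k) keeps its old points at about n / 2k. The hypothesis on b
-- says nothing about the turns before T₀; for large n no segment is rich by then, so Breaker owes
-- nothing there.

module Lists where
  open import Data.Nat using (suc; _+_; _*_; _≤_; z≤n; s≤s)

  private variable
    A C : Set

  ∈-─ : ∀ {x y : A} {ys : List A} (x∈ : x ∈ ys) → y ∈ ys → y ≢ x → y ∈ (ys ─ x∈)
  ∈-─ (here refl) (here refl) y≢x = contradiction refl y≢x
  ∈-─ (here refl) (there y∈)  y≢x = y∈
  ∈-─ (there x∈)  (here refl) y≢x = here refl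
  ∈-─ (there x∈)  (there y∈)  y≢x = there (∈-─ x∈ y∈ y≢x)

  length-─ : ∀ {x : A} {ys : List A} (x∈ : x ∈ ys) → length ys ≡ suc (length (ys ─ x∈))
  length-─ (here refl) = refl
  length-─ (there x∈)  = cong suc (length-─ x∈)
  -- A relation in place of a function lets the charging arguments choose a target by cases and
  -- prove injectivity from the defining property of the target alone.
  pigeonhole : ∀ {xs : List A} {ys : List C} (R : A → C → Set) → Unique xs →
    (∀ {x} → x ∈ xs → ∃[ y ] (y ∈ ys × R x y)) →
    (∀ {x x′ y} → x ∈ xs → x′ ∈ xs → R x y → R x′ y → x ≡ x′) →
    length xs ≤ length ys
  pigeonhole {xs = []} R uniq total inj = z≤n
  pigeonhole {xs = x ∷ xs} {ys} R (x∉ ∷ uniq) total inj with total (here refl)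
  ... | y , y∈ , Rxy = subst (suc (length xs) ≤_) (sym (length-─ y∈)) (s≤s
    (pigeonhole R uniq total′ λ p q → inj (there p) (there q)))
    where
    total′ : ∀ {x′} → x′ ∈ xs → ∃[ y′ ] (y′ ∈ (ys ─ y∈) × R x′ y′)
    total′ x′∈ with total (there x′∈)
    ... | y′ , y′∈ , Rx′y′ = y′ , ∈-─ y∈ y′∈ y′≢y , Rx′y′
      where
      y′≢y : y′ ≢ y
      y′≢y refl = All.lookup x∉ x′∈ (inj (here refl) (there x′∈) Rxy Rx′y′)

  unique-⊆⇒length≤ : ∀ {xs ys : List A} → Unique xs → (∀ {x} → x ∈ xs → x ∈ ys) →
    length xs ≤ length ys
  unique-⊆⇒length≤ uniq sub =
    pigeonhole (λ x y → x ≡ y) uniq (λ x∈ → _ , sub x∈ , refl) λ { _ _ refl refl → refl }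

  minBy : ∀ (g : A → ℤ) {x} {xs : List A} → x ∈ xs →
    ∃[ y ] (y ∈ xs × (∀ {z} → z ∈ xs → g y ℤ.≤ g z))
  minBy g {xs = x ∷ []} _ = x , here refl , λ { (here refl) → ℤₚ.≤-refl }
  minBy g {xs = x ∷ x′ ∷ xs} _ with minBy g {xs = x′ ∷ xs} (here refl)
  ... | y , y∈ , y-min with ℤₚ.≤-total (g x) (g y)
  ... | inj₁ x≤y = x , here refl , λ
    { (here refl) → ℤₚ.≤-refl ; (there z∈) → ℤₚ.≤-trans x≤y (y-min z∈) }
  ... | inj₂ y≤x = y , there y∈ , λ { (here refl) → y≤x ; (there z∈) → y-min z∈ }

  maxBy : ∀ (g : A → ℤ) {x} {xs : List A} → x ∈ xs →
    ∃[ y ] (y ∈ xs × (∀ {z} → z ∈ xs → g z ℤ.≤ g y))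
  maxBy g x∈ with minBy (λ y → ℤ.- g y) x∈
  ... | y , y∈ , y-min = y , y∈ , λ z∈ → ℤₚ.neg-cancel-≤ (y-min z∈)

  length-cartesianProduct : (xs : List A) (ys : List C) → length (cartesianProduct xs ys) ≡ length xs * length ys
  length-cartesianProduct [] ys = refl
  length-cartesianProduct (x ∷ xs) ys = trans (length-++ (map (x ,_) ys))
    (cong₂ _+_ (length-map (x ,_) ys) (length-cartesianProduct xs ys))

  module Greedy {A : Set} (_~_ : A → A → Set) (_~?_ : ∀ x y → Dec (x ~ y)) where

    greedy : List A → List A
    greedy [] = []
    greedy (x ∷ xs) with any? (x ~?_) (greedy xs)
    ... | yes _ = greedy xs
    ... | no  _ = x ∷ greedy xs

    greedy-⊆ : ∀ {x} xs → x ∈ greedy xs → x ∈ xs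
    greedy-⊆ (x ∷ xs) x∈ with any? (x ~?_) (greedy xs)
    ... | yes _ = there (greedy-⊆ xs x∈)
    greedy-⊆ (x ∷ xs) (here refl) | no _ = here refl
    greedy-⊆ (x ∷ xs) (there x∈)  | no _ = there (greedy-⊆ xs x∈)

    greedy-maximal : ∀ {x} xs → x ∈ xs → x ∈ greedy xs ⊎ ∃[ y ] (y ∈ greedy xs × x ~ y)
    greedy-maximal (x ∷ xs) x∈ with any? (x ~?_) (greedy xs)
    greedy-maximal (x ∷ xs) (here refl) | yes x~ = inj₂ (find x~)
    greedy-maximal (x ∷ xs) (there x∈)  | yes x~ = greedy-maximal xs x∈
    greedy-maximal (x ∷ xs) (here refl) | no _ = inj₁ (here refl)
    greedy-maximal (x ∷ xs) (there x∈)  | no _ with greedy-maximal xs x∈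
    ... | inj₁ p = inj₁ (there p)
    ... | inj₂ (y , y∈ , x~y) = inj₂ (y , there y∈ , x~y)

    greedy-unique : ∀ {xs} → Unique xs → Unique (greedy xs)
    greedy-unique [] = []
    greedy-unique {x ∷ xs} (x∉ ∷ uniq) with any? (x ~?_) (greedy xs)
    ... | yes _ = greedy-unique uniq
    ... | no  _ = All.tabulate (λ y∈ → All.lookup x∉ (greedy-⊆ xs y∈)) ∷ greedy-unique uniq

    greedy-independent : (∀ {x y} → x ~ y → y ~ x) → ∀ {x y} xs →
      x ∈ greedy xs → y ∈ greedy xs → x ~ y → x ≡ y
    greedy-independent ~-sym (x ∷ xs) x∈ y∈ x~y with any? (x ~?_) (greedy xs)
    ... | yes _ = greedy-independent ~-sym xs x∈ y∈ x~y
    greedy-independent ~-sym (x ∷ xs) (here refl) (here refl) x~y | no _ = refl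
    greedy-independent ~-sym (x ∷ xs) (here refl) (there y∈) x~y | no ¬p = contradiction (lose y∈ x~y) ¬p
    greedy-independent ~-sym (x ∷ xs) (there x∈) (here refl) x~y | no ¬p = contradiction (lose x∈ (~-sym x~y)) ¬p
    greedy-independent ~-sym (x ∷ xs) (there x∈) (there y∈) x~y | no _ = greedy-independent ~-sym xs x∈ y∈ x~y

  module Count {A : Set} (_≟_ : DecidableEquality A) where
    open import Data.List.Membership.DecPropositional _≟_ using (_∈?_) public

    count : List A → List A → ℕ
    count S Q = length (filter (_∈? Q) S)

    count-++ : ∀ {S} Q Q′ → Unique S → count S (Q ++ Q′) ≤ count S Q + count S Q′
    count-++ {S} Q Q′ uniq = ℕₚ.≤-trans
      (unique-⊆⇒length≤ (Uniqueₚ.filter⁺ (_∈? (Q ++ Q′)) uniq) sub)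
      (ℕₚ.≤-reflexive (length-++ (filter (_∈? Q) S)))
      where
      sub : ∀ {x} → x ∈ filter (_∈? (Q ++ Q′)) S → x ∈ filter (_∈? Q) S ++ filter (_∈? Q′) S
      sub x∈ with ∈-filter⁻ (_∈? (Q ++ Q′)) {xs = S} x∈
      ... | x∈S , x∈Q++ with ∈-++⁻ Q x∈Q++
      ... | inj₁ x∈Q  = ∈-++⁺ˡ (∈-filter⁺ (_∈? Q) {xs = S} x∈S x∈Q)
      ... | inj₂ x∈Q′ = ∈-++⁺ʳ (filter (_∈? Q) S) (∈-filter⁺ (_∈? Q′) x∈S x∈Q′)

    count≤length : ∀ {S} Q → Unique S → count S Q ≤ length Q
    count≤length {S} Q uniq = unique-⊆⇒length≤ (Uniqueₚ.filter⁺ (_∈? Q) uniq) λ x∈ → proj₂ (∈-filter⁻ (_∈? Q) {xs = S} x∈)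

    length≤count : ∀ {S} Q → Unique S → (∀ {x} → x ∈ S → x ∈ Q) → length S ≤ count S Q
    length≤count Q uniq sub = unique-⊆⇒length≤ uniq λ x∈ → ∈-filter⁺ (_∈? Q) x∈ (sub x∈)

open Lists

-- Random sampling, with expectations as weighted sums of naturals

module Sampling {A : Set} (_≟_ : DecidableEquality A) (c : ℕ) where
  open import Data.Nat using (zero; suc; _+_; _*_; _^_; _≤_)
  open import Data.List.Membership.DecPropositional _≟_ using (_∈?_)

  private
    p : ℕ
    p = suc c

  -- p ^ length V times the expectation of f S, where the random S ⊆ V contains
  -- each element independently with probability 1 / p.
  wsum : List A → (List A → ℕ) → ℕ
  wsum []      f = f []
  wsum (x ∷ V) f = wsum V (λ S → f (x ∷ S)) + c * wsum V f

  _⊑_ : List A → List A → Set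
  S ⊑ V = Unique S × (∀ {x} → x ∈ S → x ∈ V)

  private
    ⊑-there : ∀ {x S V} → S ⊑ V → S ⊑ (x ∷ V)
    ⊑-there (u , sub) = u , there ∘ sub

    ⊑-here : ∀ {x S V} → All (x ≢_) V → S ⊑ V → (x ∷ S) ⊑ (x ∷ V)
    ⊑-here x∉ (u , sub) = All.tabulate (All.lookup x∉ ∘ sub) ∷ u ,
      λ { (here refl) → here refl ; (there y∈) → there (sub y∈) }

  wsum-mono : ∀ {V f g} → Unique V → (∀ S → S ⊑ V → f S ≤ g S) → wsum V f ≤ wsum V g
  wsum-mono {[]} _ f≤g = f≤g [] ([] , λ ())
  wsum-mono {x ∷ V} (x∉ ∷ uniq) f≤g = ℕₚ.+-mono-≤
    (wsum-mono uniq λ S S⊑ → f≤g (x ∷ S) (⊑-here x∉ S⊑))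
    (ℕₚ.*-monoʳ-≤ c (wsum-mono uniq λ S S⊑ → f≤g S (⊑-there S⊑)))

  wsum-cong : ∀ {V f g} → Unique V → (∀ S → S ⊑ V → f S ≡ g S) → wsum V f ≡ wsum V g
  wsum-cong uniq f≡g = ℕₚ.≤-antisym
    (wsum-mono uniq λ S S⊑ → ℕₚ.≤-reflexive (f≡g S S⊑))
    (wsum-mono uniq λ S S⊑ → ℕₚ.≤-reflexive (sym (f≡g S S⊑)))

  wsum-+ : ∀ V f g → wsum V (λ S → f S + g S) ≡ wsum V f + wsum V g
  wsum-+ [] f g = refl
  wsum-+ (x ∷ V) f g rewrite wsum-+ V (λ S → f (x ∷ S)) (λ S → g (x ∷ S)) | wsum-+ V f g =
    solve 5 (λ a b c d e → a :+ b :+ e :* (c :+ d) := a :+ e :* c :+ (b :+ e :* d)) refl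
      (wsum V (λ S → f (x ∷ S))) (wsum V (λ S → g (x ∷ S))) (wsum V f) (wsum V g) c
    where open Data.Nat.Solver.+-*-Solver

  wsum-0 : ∀ V → wsum V (λ _ → 0) ≡ 0
  wsum-0 [] = refl
  wsum-0 (x ∷ V) rewrite wsum-0 V = ℕₚ.*-zeroʳ c

  _⊆?_ : (Q S : List A) → Dec (All (_∈ S) Q)
  Q ⊆? S = All.all? (_∈? S) Q

  indicator : List A → List A → ℕ
  indicator Q S with Q ⊆? S
  ... | yes _ = 1
  ... | no  _ = 0

  private
    indicator-cong : ∀ {Q Q′ S S′} → (All (_∈ S) Q → All (_∈ S′) Q′) →
      (All (_∈ S′) Q′ → All (_∈ S) Q) → indicator Q S ≡ indicator Q′ S′
    indicator-cong {Q} {Q′} {S} {S′} to from with Q ⊆? S | Q′ ⊆? S′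
    ... | yes _ | yes _ = refl
    ... | no _  | no _  = refl
    ... | yes u | no ¬v = contradiction (to u) ¬v
    ... | no ¬u | yes v = contradiction (from v) ¬u

    indicator-no : ∀ {Q S} → ¬ All (_∈ S) Q → indicator Q S ≡ 0
    indicator-no {Q} {S} ¬u with Q ⊆? S
    ... | yes u = contradiction u ¬u
    ... | no _  = refl

  private
    ∈-tail : ∀ {x y : A} {W} → y ≢ x → y ∈ (x ∷ W) → y ∈ W
    ∈-tail y≢ (here eq) = contradiction eq y≢
    ∈-tail y≢ (there y∈) = y∈

    ─-⊆ : ∀ {x y} {W : List A} (x∈ : x ∈ W) → y ∈ (W ─ x∈) → y ∈ W
    ─-⊆ (here _) y∈ = there y∈
    ─-⊆ (there x∈) (here eq) = here eq
    ─-⊆ (there x∈) (there y∈) = there (─-⊆ x∈ y∈)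

    ─-≢ : ∀ {x y} {W : List A} → Unique W → (x∈ : x ∈ W) → y ∈ (W ─ x∈) → y ≢ x
    ─-≢ (x∉ ∷ _) (here refl) y∈ refl = All.lookup x∉ y∈ refl
    ─-≢ (x∉ ∷ _) (there x∈) (here refl) refl = All.lookup x∉ x∈ refl
    ─-≢ (_ ∷ u) (there x∈) (there y∈) = ─-≢ u x∈ y∈

    ─-unique : ∀ {x} {W : List A} → Unique W → (x∈ : x ∈ W) → Unique (W ─ x∈)
    ─-unique (_ ∷ u) (here _) = u
    ─-unique (x∉ ∷ u) (there x∈) =
      All.tabulate (λ y∈ → All.lookup x∉ (─-⊆ x∈ y∈)) ∷ ─-unique u x∈

    indicator-∉ : ∀ {x Q} → x ∉ Q → ∀ S → indicator Q (x ∷ S) ≡ indicator Q S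
    indicator-∉ x∉ S = indicator-cong
      (λ all → All.tabulate λ y∈ → ∈-tail (λ { refl → x∉ y∈ }) (All.lookup all y∈)) (All.map there)

    indicator-∈ : ∀ {x Q} → Unique Q → (x∈ : x ∈ Q) → ∀ S → indicator Q (x ∷ S) ≡ indicator (Q ─ x∈) S
    indicator-∈ {x} {Q} uQ x∈ S = indicator-cong
      (λ all → All.tabulate λ y∈ → ∈-tail (─-≢ uQ x∈ y∈) (All.lookup all (─-⊆ x∈ y∈)))
      (λ all → All.tabulate (add all))
      where
      add : ∀ {y} → All (_∈ S) (Q ─ x∈) → y ∈ Q → y ∈ (x ∷ S)
      add {y} all y∈ with y ≟ x
      ... | yes eq = here eq
      ... | no y≢x = there (All.lookup all (∈-─ x∈ y∈ y≢x))

  -- Each element of V has total weight p = 1 + c. For x in Q only the branch that keeps x counts,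
  -- with weight 1, and the missing factor p is supplied by p ^ length Q.
  wsum-indicator : ∀ {V} Q → Unique V → Unique Q → (∀ {x} → x ∈ Q → x ∈ V) →
    wsum V (indicator Q) * p ^ length Q ≡ p ^ length V
  wsum-indicator {[]} [] _ _ _ = refl
  wsum-indicator {[]} (x ∷ Q) _ _ sub with sub (here refl)
  ... | ()
  wsum-indicator {x ∷ V} Q (x∉V ∷ uV) uQ sub with x ∈? Q
  ... | no x∉Q = begin
      (wsum V (λ S → indicator Q (x ∷ S)) + c * wsum V (indicator Q)) * p ^ length Q
        ≡⟨ cong (λ z → (z + c * wsum V (indicator Q)) * p ^ length Q) (wsum-cong uV λ S _ → indicator-∉ x∉Q S) ⟩
      p * wsum V (indicator Q) * p ^ length Q
        ≡⟨ ℕₚ.*-assoc p (wsum V (indicator Q)) (p ^ length Q) ⟩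
      p * (wsum V (indicator Q) * p ^ length Q)
        ≡⟨ cong (p *_) (wsum-indicator Q uV uQ λ y∈ → ∈-tail (λ { refl → x∉Q y∈ }) (sub y∈)) ⟩
      p * p ^ length V ∎
    where open ≡-Reasoning
  ... | yes x∈Q = begin
      (wsum V (λ S → indicator Q (x ∷ S)) + c * wsum V (indicator Q)) * p ^ length Q
        ≡⟨ cong₂ (λ y z → (y + c * z) * p ^ length Q)
             (wsum-cong uV λ S _ → indicator-∈ uQ x∈Q S)
             (trans (wsum-cong uV λ S S⊑ → indicator-no λ all →
               All.lookup x∉V (proj₂ S⊑ (All.lookup all x∈Q)) refl) (wsum-0 V)) ⟩
      (wsum V (indicator Q′) + c * 0) * p ^ length Q
        ≡⟨ cong (λ z → (wsum V (indicator Q′) + c * 0) * p ^ z) (length-─ x∈Q) ⟩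
      (wsum V (indicator Q′) + c * 0) * (p * p ^ length Q′)
        ≡⟨ solve 4 (λ a b d e → (a :+ e :* con 0) :* (b :* d) := b :* (a :* d)) refl
             (wsum V (indicator Q′)) p (p ^ length Q′) c ⟩
      p * (wsum V (indicator Q′) * p ^ length Q′)
        ≡⟨ cong (p *_) (wsum-indicator Q′ uV (─-unique uQ x∈Q) λ y∈ →
             ∈-tail (─-≢ uQ x∈Q y∈) (sub (─-⊆ x∈Q y∈))) ⟩
      p * p ^ length V ∎
    where
    open ≡-Reasoning
    open Data.Nat.Solver.+-*-Solver
    Q′ : List A
    Q′ = Q ─ x∈Q

  covered : {X : Set} → (X → List A) → List X → List A → ℕ
  covered ends E S = length (filter (λ e → ends e ⊆? S) E)

  private
    covered-∷ : {X : Set} (ends : X → List A) (e : X) (E : List X) (S : List A) →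
      covered ends (e ∷ E) S ≡ indicator (ends e) S + covered ends E S
    covered-∷ ends e E S with ends e ⊆? S
    ... | yes _ = refl
    ... | no _  = refl

  wsum-covered : ∀ {X : Set} {V} (ends : X → List A) (E : List X) k → Unique V →
    (∀ {e} → e ∈ E → Unique (ends e) × length (ends e) ≡ k × (∀ {x} → x ∈ ends e → x ∈ V)) →
    wsum V (covered ends E) * p ^ k ≡ length E * p ^ length V
  wsum-covered {V = V} ends [] k uV hyp rewrite wsum-0 V = refl
  wsum-covered {V = V} ends (e ∷ E) k uV hyp with hyp (here refl)
  ... | ue , refl , sub = begin
      wsum V (covered ends (e ∷ E)) * q
        ≡⟨ cong (_* q) (wsum-cong uV λ S _ → covered-∷ ends e E S) ⟩
      wsum V (λ S → indicator (ends e) S + covered ends E S) * q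
        ≡⟨ cong (_* q) (wsum-+ V (indicator (ends e)) (covered ends E)) ⟩
      (wsum V (indicator (ends e)) + wsum V (covered ends E)) * q
        ≡⟨ ℕₚ.*-distribʳ-+ q (wsum V (indicator (ends e))) _ ⟩
      wsum V (indicator (ends e)) * q + wsum V (covered ends E) * q
        ≡⟨ cong₂ _+_ (wsum-indicator (ends e) uV ue sub) (wsum-covered ends E k uV (hyp ∘ there)) ⟩
      p ^ length V + length E * p ^ length V ∎
    where
    open ≡-Reasoning
    q = p ^ length (ends e)

  -- Take expectations over S in the assumed inequality: an element of V survives with probability 1
  -- / p, an edge with 1 / p ^ 2, a crossing with 1 / p ^ 4. The claim is the result multiplied by p
  -- ^ 4.
  sampled-inequality : ∀ {X Y : Set} {V} d (E : List X) (C : List Y)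
    (ends : X → List A) (ends′ : Y → List A) → Unique V →
    (∀ {e} → e ∈ E → Unique (ends e) × length (ends e) ≡ 2 × (∀ {x} → x ∈ ends e → x ∈ V)) →
    (∀ {e} → e ∈ C → Unique (ends′ e) × length (ends′ e) ≡ 4 × (∀ {x} → x ∈ ends′ e → x ∈ V)) →
    (∀ S → S ⊑ V → covered ends E S ≤ d * length S + covered ends′ C S) →
    length E * p ^ 2 ≤ d * length V * p ^ 3 + length C
  sampled-inequality {V = V} d E C ends ends′ uV hE hC ineq =
    ℕₚ.*-cancelʳ-≤ _ _ (p ^ length V) {{ℕₚ.m^n≢0 p (length V)}} (begin
      length E * p ^ 2 * p ^ length V
        ≡⟨ solve 3 (λ a b d → a :* b :* d := a :* d :* b) refl (length E) (p ^ 2) (p ^ length V) ⟩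
      length E * p ^ length V * p ^ 2
        ≡⟨ cong (_* p ^ 2) (wsum-covered ends E 2 uV hE) ⟨
      wsum V (covered ends E) * p ^ 2 * p ^ 2
        ≤⟨ ℕₚ.*-monoˡ-≤ (p ^ 2) (ℕₚ.*-monoˡ-≤ (p ^ 2) (wsum-mono {g = λ S → d * covered (_∷ []) V S + covered ends′ C S} uV bound)) ⟩
      wsum V (λ S → d * covered (_∷ []) V S + covered ends′ C S) * p ^ 2 * p ^ 2
        ≡⟨ cong (λ z → z * p ^ 2 * p ^ 2) (trans (wsum-+ V _ _) (cong (_+ wsum V (covered ends′ C)) (wsum-* V d _))) ⟩
      (d * wsum V (covered (_∷ []) V) + wsum V (covered ends′ C)) * p ^ 2 * p ^ 2
        ≡⟨ solve 4 (λ d a b p → (d :* a :+ b) :* (p :^ 2) :* (p :^ 2) := d :* (a :* (p :^ 1)) :* (p :^ 3) :+ b :* (p :^ 4))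
             refl d (wsum V (covered (_∷ []) V)) (wsum V (covered ends′ C)) p ⟩
      d * (wsum V (covered (_∷ []) V) * p ^ 1) * p ^ 3 + wsum V (covered ends′ C) * p ^ 4
        ≡⟨ cong₂ (λ a b → d * a * p ^ 3 + b)
             (wsum-covered (_∷ []) V 1 uV λ e∈ → ([] ∷ []) , refl , λ { (here refl) → e∈ })
             (wsum-covered ends′ C 4 uV hC) ⟩
      d * (length V * p ^ length V) * p ^ 3 + length C * p ^ length V
        ≡⟨ solve 5 (λ d v w q c → d :* (v :* w) :* q :+ c :* w := (d :* v :* q :+ c) :* w) refl
             d (length V) (p ^ length V) (p ^ 3) (length C) ⟩
      (d * length V * p ^ 3 + length C) * p ^ length V ∎)
    where
    open ℕₚ.≤-Reasoning
    open Data.Nat.Solver.+-*-Solver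
    wsum-* : ∀ V d f → wsum V (λ S → d * f S) ≡ d * wsum V f
    wsum-* V zero f = wsum-0 V
    wsum-* V (suc d) f = trans (wsum-+ V f (λ S → d * f S)) (cong (wsum V f +_) (wsum-* V d f))
    -- The size of S is rewritten as a number of covered singletons, so that `wsum-covered` with k =
    -- 1 also yields its expectation.
    bound : ∀ S → S ⊑ V → covered ends E S ≤ d * covered (_∷ []) V S + covered ends′ C S
    bound S S⊑@(uS , sub) = ℕₚ.≤-trans (ineq S S⊑) (ℕₚ.+-monoˡ-≤ _ (ℕₚ.*-monoʳ-≤ d
      (unique-⊆⇒length≤ uS λ x∈ → ∈-filter⁺ (λ e → (e ∷ []) ⊆? S) (sub x∈) (x∈ ∷ []))))

-- Integer plane geometry with a generic abscissa

module Geometry where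
  open import Data.Nat using (suc)
  open import Data.Integer using (+_; ∣_∣)
  open import Data.Integer using (_+_; _*_; _-_; -_; _<_; _≤_; 0ℤ; 1ℤ; nonNegative)

  0<*  : ∀ {i j} → 0ℤ < i → 0ℤ < j → 0ℤ < i * j
  0<* {i} {j} 0<i 0<j = subst (_< i * j) (ℤₚ.*-zeroʳ i) (ℤₚ.*-monoˡ-<-pos i {{ℤ.positive 0<i}} 0<j)

  0≤* : ∀ {i j} → 0ℤ ≤ i → 0ℤ ≤ j → 0ℤ ≤ i * j
  0≤* {i} {j} 0≤i 0≤j = subst (_≤ i * j) (ℤₚ.*-zeroʳ i) (ℤₚ.*-monoˡ-≤-nonNeg i {{nonNegative 0≤i}} 0≤j)

  0<*⁻ : ∀ i {j} → 0ℤ < i → 0ℤ < i * j → 0ℤ < j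
  0<*⁻ i {j} 0<i 0<ij = ℤₚ.*-cancelˡ-<-nonNeg i {{nonNegative (ℤₚ.<⇒≤ 0<i)}} (subst (_< i * j) (sym (ℤₚ.*-zeroʳ i)) 0<ij)

  0≤*⁻ : ∀ i {j} → 0ℤ < i → 0ℤ ≤ i * j → 0ℤ ≤ j
  0≤*⁻ i {j} 0<i 0≤ij = ℤₚ.*-cancelˡ-≤-pos _ _ i {{ℤ.positive 0<i}} (subst (_≤ i * j) (sym (ℤₚ.*-zeroʳ i)) 0≤ij)

  *-cancel-0 : ∀ i {j} → 0ℤ < i → i * j ≡ 0ℤ → j ≡ 0ℤ
  *-cancel-0 i {j} 0<i eq = ℤₚ.*-cancelˡ-≡ i j 0ℤ {{ℤ.>-nonZero 0<i}} (trans eq (sym (ℤₚ.*-zeroʳ i)))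

  0<- : ∀ {i j} → i < j → 0ℤ < j - i
  0<- {i} {j} i<j = subst (_< j - i) (ℤₚ.+-inverseʳ i) (ℤₚ.+-monoˡ-< (- i) i<j)

  0≤- : ∀ {i j} → i ≤ j → 0ℤ ≤ j - i
  0≤- = ℤₚ.i≤j⇒0≤j-i

  0<+ : ∀ {i j} → 0ℤ < i → 0ℤ ≤ j → 0ℤ < i + j
  0<+ = ℤₚ.+-mono-<-≤

  0≤+ : ∀ {i j} → 0ℤ ≤ i → 0ℤ ≤ j → 0ℤ ≤ i + j
  0≤+ = ℤₚ.+-mono-≤

  0<neg : ∀ {i} → i < 0ℤ → 0ℤ < - i
  0<neg = ℤₚ.neg-mono-<

  0<neg⁻ : ∀ {i} → 0ℤ < - i → i < 0ℤ
  0<neg⁻ {i} lt = subst (_< 0ℤ) (ℤₚ.neg-involutive i) (ℤₚ.neg-mono-< lt)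

  0≤neg : ∀ {i} → i ≤ 0ℤ → 0ℤ ≤ - i
  0≤neg = ℤₚ.neg-mono-≤

  _≟ₚ_ : DecidableEquality Point
  _≟ₚ_ = ≡-dec ℤₚ._≟_ ℤₚ._≟_
    where open import Data.Product.Properties using (≡-dec)

  -- Plays the part of the abscissa. For a suitable N the points of a finite set have distinct
  -- values, so no line through two of them is vertical and no case distinction for vertical lines
  -- arises.
  lin : ℤ → Point → ℤ
  lin N (x , y) = N * x + y

  module _ where
    open Data.Integer.Solver.+-*-Solver

    crossₑ : ∀ {n} → Polynomial n × Polynomial n → Polynomial n × Polynomial n → Polynomial n × Polynomial n → Polynomial n
    crossₑ (ax , ay) (bx , by) (cx , cy) = ((bx :- ax) :* (cy :- ay)) :- ((by :- ay) :* (cx :- ax))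

    linₑ : ∀ {n} → Polynomial n → Polynomial n × Polynomial n → Polynomial n
    linₑ N (x , y) = N :* x :+ y

    cross-rot : ∀ a b c → cross a b c ≡ cross b c a
    cross-rot (ax , ay) (bx , by) (cx , cy) = solve 6 (λ ax ay bx by cx cy →
      crossₑ (ax , ay) (bx , by) (cx , cy) := crossₑ (bx , by) (cx , cy) (ax , ay)) refl ax ay bx by cx cy

    cross-swap : ∀ a b c → cross a c b ≡ - cross a b c
    cross-swap (ax , ay) (bx , by) (cx , cy) = solve 6 (λ ax ay bx by cx cy →
      crossₑ (ax , ay) (cx , cy) (bx , by) := :- crossₑ (ax , ay) (bx , by) (cx , cy)) refl ax ay bx by cx cy

    cross-aab : ∀ a b → cross a a b ≡ 0ℤ
    cross-aab (ax , ay) (bx , by) = solve 4 (λ ax ay bx by →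
      crossₑ (ax , ay) (ax , ay) (bx , by) := con 0ℤ) refl ax ay bx by

    -- `cross a c` is an affine function, evaluated along the triangle u v w.
    cross-affine : ∀ N a c u v w →
      cross a c u * (lin N v - lin N w) + cross a c v * (lin N w - lin N u) + cross a c w * (lin N u - lin N v)
        ≡ - (cross u v w * (lin N c - lin N a))
    cross-affine N (ax , ay) (cx , cy) (ux , uy) (vx , vy) (wx , wy) = solve 11
      (λ N ax ay cx cy ux uy vx vy wx wy →
        let a = (ax , ay); c = (cx , cy); u = (ux , uy); v = (vx , vy); w = (wx , wy); f = linₑ N in
        crossₑ a c u :* (f v :- f w) :+ crossₑ a c v :* (f w :- f u) :+ crossₑ a c w :* (f u :- f v)
          := :- (crossₑ u v w :* (f c :- f a)))
      refl N ax ay cx cy ux uy vx vy wx wy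

    gap-antisym : ∀ N p q g h s →
      cross p q g * (lin N h - s) + cross p q h * (s - lin N g)
        ≡ - (cross g h p * (lin N q - s) + cross g h q * (s - lin N p))
    gap-antisym N (px , py) (qx , qy) (gx , gy) (hx , hy) s = solve 10 (λ N px py qx qy gx gy hx hy s →
      let p = (px , py); q = (qx , qy); g = (gx , gy) ; h = (hx , hy); f = linₑ N in
      crossₑ p q g :* (f h :- s) :+ crossₑ p q h :* (s :- f g)
        := :- (crossₑ g h p :* (f q :- s) :+ crossₑ g h q :* (s :- f p)))
      refl N px py qx qy gx gy hx hy s

    -- Together with `lin-y`, Cramer's rule: on the line through a and c the `cross` term vanishes,
    -- so there both coordinates are affine functions of `lin N`.
    lin-x : ∀ N a c v → (lin N c - lin N a) * (proj₁ v - proj₁ a)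
      ≡ (lin N v - lin N a) * (proj₁ c - proj₁ a) - cross a c v
    lin-x N (ax , ay) (cx , cy) (vx , vy) = solve 7 (λ N ax ay cx cy vx vy →
      let a = (ax , ay); c = (cx , cy); v = (vx , vy); f = linₑ N in
      (f c :- f a) :* (vx :- ax) := (f v :- f a) :* (cx :- ax) :- crossₑ a c v) refl N ax ay cx cy vx vy

    lin-y : ∀ N a c v → (lin N c - lin N a) * (proj₂ v - proj₂ a)
      ≡ (lin N v - lin N a) * (proj₂ c - proj₂ a) + N * cross a c v
    lin-y N (ax , ay) (cx , cy) (vx , vy) = solve 7 (λ N ax ay cx cy vx vy →
      let a = (ax , ay); c = (cx , cy); v = (vx , vy); f = linₑ N in
      (f c :- f a) :* (vy :- ay) := (f v :- f a) :* (cy :- ay) :+ N :* crossₑ a c v) refl N ax ay cx cy vx vy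

  cross-aba : ∀ a b → cross a b a ≡ 0ℤ
  cross-aba a b = trans (sym (cross-rot a a b)) (cross-aab a b)

  cross-abb : ∀ a b → cross a b b ≡ 0ℤ
  cross-abb a b = trans (cross-rot a b b) (cross-aab b a)

  InjectiveOn : ℤ → List Point → Set
  InjectiveOn N P = ∀ {v w} → v ∈ P → w ∈ P → lin N v ≡ lin N w → v ≡ w

  heightBound : List Point → ℕ
  heightBound [] = 0
  heightBound ((x , y) ∷ P) = ∣ y ∣ ℕ.+ heightBound P

  slope : List Point → ℤ
  slope P = + suc (heightBound P ℕ.+ heightBound P)

  height≤ : ∀ {v} P → v ∈ P → ∣ proj₂ v ∣ ℕ.≤ heightBound P
  height≤ (_ ∷ P) (here refl) = ℕₚ.m≤m+n _ _
  height≤ (_ ∷ P) (there v∈) = ℕₚ.≤-trans (height≤ P v∈) (ℕₚ.m≤n+m _ _)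

  -- Equal values make the difference of the heights a multiple of N, while N exceeds every
  -- difference of two heights in P.
  slope-injective : ∀ P → InjectiveOn (slope P) P
  slope-injective P {vx , vy} {wx , wy} v∈ w∈ eq = cong₂ _,_ x≡ y≡
    where
    N = slope P
    dif : N * (vx - wx) ≡ wy - vy
    dif = i-j≡0⇒i≡j _ _ (trans (solve 5 (λ N vx vy wx wy →
      N :* (vx :- wx) :- (wy :- vy) := (N :* vx :+ vy) :- (N :* wx :+ wy)) refl N vx vy wx wy)
      (ℤₚ.i≡j⇒i-j≡0 eq))
      where open Data.Integer.Solver.+-*-Solver
    small : ∣ N * (vx - wx) ∣ ℕ.< ∣ N ∣ ℕ.* 1
    small = subst₂ (λ a b → ∣ a ∣ ℕ.< b) (sym dif) (sym (ℕₚ.*-identityʳ ∣ N ∣))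
      (ℕ.s≤s (ℕₚ.≤-trans (ℤₚ.∣i-j∣≤∣i∣+∣j∣ wy vy) (ℕₚ.+-mono-≤ (height≤ P w∈) (height≤ P v∈))))
    x≡ : vx ≡ wx
    x≡ = i-j≡0⇒i≡j _ _ (ℤₚ.∣i∣≡0⇒i≡0 (ℕₚ.n<1⇒n≡0 (ℕₚ.*-cancelˡ-< ∣ N ∣ _ _
      (subst (ℕ._< ∣ N ∣ ℕ.* 1) (ℤₚ.abs-* N (vx - wx)) small))))
    y≡ : vy ≡ wy
    y≡ = sym (i-j≡0⇒i≡j _ _ (trans (sym dif) (trans (cong (N *_) (ℤₚ.i≡j⇒i-j≡0 x≡)) (ℤₚ.*-zeroʳ N))))

open Geometry

-- Plane graphs: crossing criteria and visible edges

module Planar where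
  open import Data.Integer using (_+_; _*_; _-_; -_; _<_; _≤_; 0ℤ; 1ℤ; _<?_)

  -- The order axioms are asked only for members of the list, because the angular order around p to
  -- which this is applied is transitive only among points to the right of p.
  least : ∀ {A : Set} {xs : List A} (_≲_ : A → A → Set) →
    (∀ {x y} → x ∈ xs → y ∈ xs → x ≲ y ⊎ y ≲ x) →
    (∀ {x y z} → x ∈ xs → y ∈ xs → z ∈ xs → x ≲ y → y ≲ z → x ≲ z) →
    ∀ {x} → x ∈ xs → ∃[ y ] (y ∈ xs × (∀ {z} → z ∈ xs → y ≲ z))
  least {xs = x ∷ []} _≲_ total tr _ = x , here refl , λ { (here refl) → reduce (total (here refl) (here refl)) }
  least {xs = x ∷ x′ ∷ xs} _≲_ total tr _
    with least {xs = x′ ∷ xs} _≲_ (λ p q → total (there p) (there q)) (λ p q r → tr (there p) (there q) (there r)) (here refl)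
  ... | y , y∈ , y-min with total (here refl) (there y∈)
  ... | inj₁ x≲y = x , here refl , λ
    { (here refl) → reduce (total (here refl) (here refl))
    ; (there z∈) → tr (here refl) (there y∈) (there z∈) x≲y (y-min z∈) }
  ... | inj₂ y≲x = y , there y∈ , λ { (here refl) → y≲x ; (there z∈) → y-min z∈ }

  Opposite : ℤ → ℤ → Set
  Opposite i j = (i < 0ℤ × 0ℤ < j) ⊎ (0ℤ < i × j < 0ℤ)

  Crosses : Point → Point → Point → Point → Set
  Crosses p q g h = Opposite (cross p q g) (cross p q h) × Opposite (cross g h p) (cross g h q)

  opposite? : ∀ i j → Dec (Opposite i j)
  opposite? i j = ((i <? 0ℤ) ×-dec (0ℤ <? j)) ⊎-dec ((0ℤ <? i) ×-dec (j <? 0ℤ))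

  crosses? : ∀ p q g h → Dec (Crosses p q g h)
  crosses? p q g h = opposite? _ _ ×-dec opposite? _ _

  -- An affine function that is negative at s and positive at the later t stays negative to the left
  -- of s and positive to the right of t. Up to the positive factor h - g, x and y are its values at
  -- g and h.
  affine-sign : ∀ x y g h s t → g ≤ s → s < t → t ≤ h →
    x * (h - s) + y * (s - g) < 0ℤ → 0ℤ < x * (h - t) + y * (t - g) → x < 0ℤ × 0ℤ < y
  affine-sign x y g h s t g≤s s<t t≤h neg pos =
    0<neg⁻ (0<*⁻ _ scale (subst (0ℤ <_) (sym eq₁)
      (0<+ (0<* (0<neg neg) (0<- (ℤₚ.≤-<-trans g≤s s<t))) (0≤* (ℤₚ.<⇒≤ pos) (0≤- g≤s))))) ,
    0<*⁻ _ scale (subst (0ℤ <_) (sym eq₂)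
      (0<+ (0<* pos (0<- (ℤₚ.<-≤-trans s<t t≤h))) (0≤* (ℤₚ.<⇒≤ (0<neg neg)) (0≤- t≤h))))
    where
    open Data.Integer.Solver.+-*-Solver
    scale : 0ℤ < (h - g) * (t - s)
    scale = 0<* (0<- (ℤₚ.≤-<-trans g≤s (ℤₚ.<-≤-trans s<t t≤h))) (0<- s<t)
    eq₁ : (h - g) * (t - s) * (- x) ≡ - (x * (h - s) + y * (s - g)) * (t - g) + (x * (h - t) + y * (t - g)) * (s - g)
    eq₁ = solve 6 (λ x y g h s t → (h :- g) :* (t :- s) :* (:- x) :=
      (:- (x :* (h :- s) :+ y :* (s :- g))) :* (t :- g) :+ (x :* (h :- t) :+ y :* (t :- g)) :* (s :- g)) refl x y g h s t
    eq₂ : (h - g) * (t - s) * y ≡ (x * (h - t) + y * (t - g)) * (h - s) + (- (x * (h - s) + y * (s - g))) * (h - t)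
    eq₂ = solve 6 (λ x y g h s t → (h :- g) :* (t :- s) :* y :=
      (x :* (h :- t) :+ y :* (t :- g)) :* (h :- s) :+ (:- (x :* (h :- s) :+ y :* (s :- g))) :* (h :- t)) refl x y g h s t

  module Heights (N : ℤ) where

    f : Point → ℤ
    f = lin N

    -- A positive multiple of the height of the line gh over the line pq at abscissa s.
    gap : Point → Point → Point → Point → ℤ → ℤ
    gap p q g h s = cross p q g * (f h - s) + cross p q h * (s - f g)

    gap-swap : ∀ p q g h s → gap p q g h s ≡ - gap g h p q s
    gap-swap = gap-antisym N

    gap-src : ∀ p q g h → gap p q g h (f g) ≡ cross p q g * (f h - f g)
    gap-src p q g h = solve 4 (λ x y g h → x :* (h :- g) :+ y :* (g :- g) := x :* (h :- g)) refl
      (cross p q g) (cross p q h) (f g) (f h)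
      where open Data.Integer.Solver.+-*-Solver

    gap-tgt : ∀ p q g h → gap p q g h (f h) ≡ cross p q h * (f h - f g)
    gap-tgt p q g h = solve 4 (λ x y g h → x :* (h :- h) :+ y :* (h :- g) := y :* (h :- g)) refl
      (cross p q g) (cross p q h) (f g) (f h)
      where open Data.Integer.Solver.+-*-Solver

    gap-at : ∀ p q g h v → gap p q g h (f v) ≡ (f h - f g) * cross p q v - (f q - f p) * cross g h v
    gap-at p q g h v = trans
      (solve 6 (λ x y z g h v → x :* (h :- v) :+ y :* (v :- g) :=
        (x :* (h :- v) :+ y :* (v :- g) :+ z :* (g :- h)) :+ (h :- g) :* z) refl
        (cross p q g) (cross p q h) (cross p q v) (f g) (f h) (f v))
      (trans (cong (λ e → e + (f h - f g) * cross p q v) (cross-affine N p q g h v))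
      (solve 4 (λ a b c d → :- (a :* b) :+ c :* d := c :* d :- b :* a) refl
        (cross g h v) (f q - f p) (f h - f g) (cross p q v)))
      where open Data.Integer.Solver.+-*-Solver

    -- Between s and t, where both edges are defined, they exchange their vertical order.
    -- `affine-sign` extends this to the ends g and h and, because `gap` is antisymmetric in the two
    -- edges, also to p and q.
    crosses-up : ∀ {p q g h s t} → f p ≤ s → t ≤ f q → f g ≤ s → t ≤ f h → s < t →
      gap p q g h s < 0ℤ → 0ℤ < gap p q g h t → Crosses p q g h
    crosses-up {p} {q} {g} {h} {s} {t} p≤s t≤q g≤s t≤h s<t neg pos =
      inj₁ (affine-sign _ _ (f g) (f h) s t g≤s s<t t≤h neg pos) ,
      inj₂ (swap (affine-sign (- cross g h p) (- cross g h q) (f p) (f q) s t p≤s s<t t≤q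
        (subst (_< 0ℤ) (trans (gap-swap p q g h s) (negate s)) neg)
        (subst (0ℤ <_) (trans (gap-swap p q g h t) (negate t)) pos)))
      where
      negate : ∀ s → - gap g h p q s ≡ - cross g h p * (f q - s) + - cross g h q * (s - f p)
      negate s = solve 4 (λ x y a b → :- (x :* a :+ y :* b) := (:- x) :* a :+ (:- y) :* b) refl
        (cross g h p) (cross g h q) (f q - s) (s - f p)
        where open Data.Integer.Solver.+-*-Solver
      swap : ∀ {x y} → - x < 0ℤ × 0ℤ < - y → 0ℤ < x × y < 0ℤ
      swap {x} (a , b) = subst (0ℤ <_) (ℤₚ.neg-involutive x) (0<neg a) , 0<neg⁻ b

    crosses-down : ∀ {p q g h s t} → f p ≤ s → t ≤ f q → f g ≤ s → t ≤ f h → s < t →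
      0ℤ < gap p q g h s → gap p q g h t < 0ℤ → Crosses g h p q
    crosses-down {p} {q} {g} {h} {s} {t} p≤s t≤q g≤s t≤h s<t pos neg =
      crosses-up g≤s t≤h p≤s t≤q s<t
        (0<neg⁻ (subst (0ℤ <_) (gap-swap p q g h s) pos))
        (subst (0ℤ <_) (sym (gap-swap g h p q t)) (0<neg neg))
    angle-trans : ∀ {p a b c} → f p < f a → f p < f b → f p < f c →
      0ℤ ≤ cross p a b → 0ℤ ≤ cross p b c → 0ℤ ≤ cross p a c
    angle-trans {p} {a} {b} {c} p<a p<b p<c ab bc = 0≤*⁻ (f b - f p) (0<- p<b) (subst (0ℤ ≤_) (sym eq)
      (0≤+ (0≤* ab (ℤₚ.<⇒≤ (0<- p<c))) (0≤* bc (ℤₚ.<⇒≤ (0<- p<a)))))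
      where
      open Data.Integer.Solver.+-*-Solver
      eq : (f b - f p) * cross p a c ≡ cross p a b * (f c - f p) + cross p b c * (f a - f p)
      eq = begin
        (f b - f p) * cross p a c ≡⟨ cong ((f b - f p) *_) (cross-rot p a c) ⟩
        (f b - f p) * cross a c p ≡⟨ solve 2 (λ x y → x :* y := :- (:- (y :* x))) refl (f b - f p) (cross a c p) ⟩
        - (- (cross a c p * (f b - f p))) ≡⟨ cong -_ (cross-affine N p b a c p) ⟨
        - (cross p b a * (f c - f p) + cross p b c * (f p - f a) + cross p b p * (f a - f c))
          ≡⟨ cong₂ (λ y z → - (y * (f c - f p) + cross p b c * (f p - f a) + z * (f a - f c))) (cross-swap p a b) (cross-aba p b) ⟩
        - (- cross p a b * (f c - f p) + cross p b c * (f p - f a) + 0ℤ * (f a - f c))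
          ≡⟨ solve 5 (λ x y a c p → :- ((:- x) :* (c :- p) :+ y :* (p :- a) :+ con 0ℤ :* (a :- c)) := x :* (c :- p) :+ y :* (a :- p)) refl
               (cross p a b) (cross p b c) (f a) (f c) (f p) ⟩
        cross p a b * (f c - f p) + cross p b c * (f a - f p) ∎
        where open ≡-Reasoning

    -- `Crosses` sees only proper crossings. Contact of an edge with a vertex in its interior, and
    -- with it the overlap of two different collinear edges, is what `empty` rules out.
    record IsPlanar (V : List Point) (Edge : Point → Point → Set) : Set where
      field
        f-injective : InjectiveOn N V
        src∈     : ∀ {p q} → Edge p q → p ∈ V
        tgt∈     : ∀ {p q} → Edge p q → q ∈ V
        forward  : ∀ {p q} → Edge p q → f p < f q
        empty    : ∀ {p q w} → Edge p q → w ∈ V → f p < f w → f w < f q → cross p q w ≢ 0ℤ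
        noncross : ∀ {p q g h} → Edge p q → Edge g h → ¬ Crosses p q g h

    -- The quotient cross p q v / (f q - f p) is the height of v over the line pq.
    Sees : (Point → Point → Set) → Point → Point → Point → Set
    Sees Edge v p q = f p < f v × f v < f q × 0ℤ < cross p q v ×
      (∀ {g h} → Edge g h → f g < f v → f v < f h → 0ℤ < cross g h v →
        cross p q v * (f h - f g) ≤ cross g h v * (f q - f p))

    module _ {V : List Point} {Edge : Point → Point → Set} (planar : IsPlanar V Edge) where
      open IsPlanar planar

      private
        pos⇒≢0 : ∀ {i} → 0ℤ < i → i ≢ 0ℤ
        pos⇒≢0 0<i refl = ℤₚ.<-irrefl refl 0<i

      -- Among the vertices over pq and under the next edge pp₁, the leftmost one sees pq.
      visible : ∀ {p q p₁ q₁} → Edge p q →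
        Edge p p₁ → 0ℤ < cross p q p₁ →
        (∀ {h} → Edge p h → 0ℤ < cross p q h → 0ℤ ≤ cross p p₁ h) →
        Edge q₁ q → 0ℤ < cross p q q₁ →
        ∃[ v ] (v ∈ V × Sees Edge v p q)
      visible {p} {q} {p₁} {q₁} e e₁ above₁ next e₂ above₂ = v , proj₁ (∈-filter⁻ region? {xs = V} v∈) , p<v , v<q , above-v , lowest
        where
        Region : Point → Set
        Region v = (f p < f v × f v < f q) × (0ℤ < cross p q v × cross p p₁ v ≤ 0ℤ)
        region? : ∀ v → Dec (Region v)
        region? v = ((_ <? _) ×-dec (_ <? _)) ×-dec ((_ <? _) ×-dec (_ ℤₚ.≤? _))
        q-below : cross p p₁ q < 0ℤ
        q-below = subst (_< 0ℤ) (sym (cross-swap p q p₁)) (ℤₚ.neg-mono-< above₁)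
        gap-q : gap p p₁ q₁ q (f q) < 0ℤ
        gap-q = 0<neg⁻ (subst (0ℤ <_) (sym (trans (cong -_ (gap-tgt p p₁ q₁ q)) (ℤₚ.neg-distribˡ-* (cross p p₁ q) (f q - f q₁))))
          (0<* (0<neg q-below) (0<- (forward e₂))))
        -- If p₁ lies left of q it is in the region itself. Otherwise pp₁ passes over q; then q₁
        -- lies right of p and not above pp₁, since else q₁q would have to cross pp₁ before reaching
        -- q.
        nonempty : (f p₁ < f q × Region p₁) ⊎ (f q < f p₁ × Region q₁)
        nonempty with ℤₚ.<-cmp (f p₁) (f q)
        ... | tri< p₁<q _ _ = inj₁ (p₁<q , (forward e₁ , p₁<q) , above₁ , ℤₚ.≤-reflexive (cross-abb p p₁))
        ... | tri≈ _ p₁≡q _ = ⊥-elim (pos⇒≢0 above₁ (trans (cong (cross p q) (f-injective (tgt∈ e₁) (tgt∈ e) p₁≡q)) (cross-abb p q)))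
        ... | tri> _ _ q<p₁ with ℤₚ.<-cmp (f p) (f q₁)
        ...   | tri< p<q₁ _ _ = inj₂ (q<p₁ , (p<q₁ , forward e₂) , above₂ , ℤₚ.≮⇒≥ λ 0<c →
                  noncross e₂ e₁ (crosses-down {p} {p₁} {q₁} {q} (ℤₚ.<⇒≤ p<q₁) (ℤₚ.<⇒≤ q<p₁) ℤₚ.≤-refl ℤₚ.≤-refl (forward e₂)
                    (subst (0ℤ <_) (sym (gap-src p p₁ q₁ q)) (0<* 0<c (0<- (forward e₂)))) gap-q))
        ...   | tri≈ _ p≡q₁ _ = ⊥-elim (pos⇒≢0 above₂ (trans (cong (cross p q) (sym (f-injective (src∈ e) (src∈ e₂) p≡q₁))) (cross-aba p q)))
        ...   | tri> _ _ q₁<p = ⊥-elim (noncross e₂ e₁ (crosses-down {p} {p₁} {q₁} {q} ℤₚ.≤-refl (ℤₚ.<⇒≤ q<p₁) (ℤₚ.<⇒≤ q₁<p) ℤₚ.≤-refl (forward e)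
                    (subst (0ℤ <_) (sym eq) (0<* above₂ (0<- (forward e₁)))) gap-q))
          where
          eq : gap p p₁ q₁ q (f p) ≡ cross p q q₁ * (f p₁ - f p)
          eq = begin
            gap p p₁ q₁ q (f p)                  ≡⟨ gap-swap p p₁ q₁ q (f p) ⟩
            - gap q₁ q p p₁ (f p)                ≡⟨ cong -_ (gap-src q₁ q p p₁) ⟩
            - (cross q₁ q p * (f p₁ - f p))      ≡⟨ ℤₚ.neg-distribˡ-* (cross q₁ q p) _ ⟩
            - cross q₁ q p * (f p₁ - f p)        ≡⟨ cong (λ z → - z * (f p₁ - f p)) (trans (sym (cross-rot p q₁ q)) (cross-swap p q q₁)) ⟩
            - - cross p q q₁ * (f p₁ - f p)      ≡⟨ cong (_* (f p₁ - f p)) (ℤₚ.neg-involutive (cross p q q₁)) ⟩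
            cross p q q₁ * (f p₁ - f p)          ∎
            where open ≡-Reasoning
        witness : ∃[ w ] (w ∈ filter region? V)
        witness with nonempty
        ... | inj₁ (_ , r) = p₁ , ∈-filter⁺ region? (tgt∈ e₁) r
        ... | inj₂ (_ , r) = q₁ , ∈-filter⁺ region? (src∈ e₂) r
        leftmost : ∃[ v ] (v ∈ filter region? V × (∀ {w} → w ∈ filter region? V → f v ≤ f w))
        leftmost = minBy f (proj₂ witness)
        v : Point
        v = proj₁ leftmost
        v∈ : v ∈ filter region? V
        v∈ = proj₁ (proj₂ leftmost)
        v-region : Region v
        v-region = proj₂ (∈-filter⁻ region? {xs = V} v∈)
        p<v = proj₁ (proj₁ v-region)
        v<q = proj₂ (proj₁ v-region)
        above-v = proj₁ (proj₂ v-region)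
        v≤p₁ : f v ≤ f p₁
        v≤p₁ = [ (λ r → proj₂ (proj₂ leftmost) (∈-filter⁺ region? (tgt∈ e₁) (proj₂ r)))
               , (λ r → ℤₚ.<⇒≤ (ℤₚ.<-trans v<q (proj₁ r))) ]′ nonempty
        -- An edge gh that contradicts this passes strictly between pq and v, hence also under pp₁
        -- there. If g is right of p, then g lies in the region and left of v, or gh meets pq or
        -- pp₁. If g is p, the choice of pp₁ as the next edge is violated. If g is left of p, then
        -- gh crosses pq or pp₁ or runs through p.
        lowest : ∀ {g h} → Edge g h → f g < f v → f v < f h → 0ℤ < cross g h v →
          cross p q v * (f h - f g) ≤ cross g h v * (f q - f p)
        lowest {g} {h} d g<v v<h 0<c = ℤₚ.≮⇒≥ λ lower →
          let gap>0 : 0ℤ < gap p q g h (f v)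
              gap>0 = subst (0ℤ <_) (sym (trans (gap-at p q g h v) (cong₂ _-_ (ℤₚ.*-comm _ (cross p q v)) (ℤₚ.*-comm _ (cross g h v))))) (0<- lower)
          in case-g gap>0 (ℤₚ.<-cmp (f g) (f p))
          where
          gap₁<0 : gap p p₁ g h (f v) < 0ℤ
          gap₁<0 = 0<neg⁻ (subst (0ℤ <_) (sym (trans (cong -_ (gap-at p p₁ g h v))
            (solve 4 (λ a b c d → :- (a :* b :- c :* d) := c :* d :+ a :* (:- b)) refl (f h - f g) (cross p p₁ v) (f p₁ - f p) (cross g h v))))
            (0<+ (0<* (0<- (forward e₁)) 0<c) (0≤* (ℤₚ.<⇒≤ (0<- (forward d))) (0≤neg (proj₂ (proj₂ v-region))))))
            where open Data.Integer.Solver.+-*-Solver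
          case-g : 0ℤ < gap p q g h (f v) → _ → ⊥
          case-g gap>0 (tri> _ _ p<g) with ℤₚ.<-cmp (cross p q g) 0ℤ
          ... | tri< neg _ _ = noncross e d (crosses-up {p} {q} {g} {h} (ℤₚ.<⇒≤ p<g) (ℤₚ.<⇒≤ v<q) ℤₚ.≤-refl (ℤₚ.<⇒≤ v<h) g<v
                (0<neg⁻ (subst (0ℤ <_) (sym (trans (cong -_ (gap-src p q g h)) (ℤₚ.neg-distribˡ-* (cross p q g) (f h - f g))))
                  (0<* (0<neg neg) (0<- (forward d))))) gap>0)
          ... | tri≈ _ eq₀ _ = empty e (src∈ d) p<g (ℤₚ.<-trans g<v v<q) eq₀
          ... | tri> _ _ pos = ℤₚ.<⇒≱ g<v (proj₂ (proj₂ leftmost) (∈-filter⁺ region? (src∈ d)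
                ((p<g , ℤₚ.<-trans g<v v<q) , pos , ℤₚ.≮⇒≥ λ 0<c′ →
                  noncross d e₁ (crosses-down {p} {p₁} {g} {h} (ℤₚ.<⇒≤ p<g) v≤p₁ ℤₚ.≤-refl (ℤₚ.<⇒≤ v<h) g<v
                    (subst (0ℤ <_) (sym (gap-src p p₁ g h)) (0<* 0<c′ (0<- (forward d)))) gap₁<0))))
          case-g gap>0 (tri≈ _ g≡p _) = ℤₚ.<⇒≱ gap₁<0 (subst (0ℤ ≤_) (sym (through-p p₁)) (0≤* (next d′ above-h) (ℤₚ.<⇒≤ (0<- p<v))))
            where
            g≡ : g ≡ p
            g≡ = f-injective (src∈ d) (src∈ e) g≡p
            d′ : Edge p h
            d′ = subst (λ z → Edge z h) g≡ d
            through-p : ∀ r → gap p r g h (f v) ≡ cross p r h * (f v - f p)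
            through-p r = trans (cong (λ z → gap p r z h (f v)) g≡) (trans
              (cong (λ z → z * (f h - f v) + cross p r h * (f v - f p)) (cross-aba p r)) (ℤₚ.+-identityˡ _))
            above-h : 0ℤ < cross p q h
            above-h = 0<*⁻ (f v - f p) (0<- p<v) (subst (0ℤ <_) (trans (through-p q) (ℤₚ.*-comm (cross p q h) _)) gap>0)
          case-g gap>0 (tri< g<p _ _) with ℤₚ.<-cmp (cross g h p) 0ℤ
          ... | tri> _ _ pos = noncross e d (crosses-up {p} {q} {g} {h} ℤₚ.≤-refl (ℤₚ.<⇒≤ v<q) (ℤₚ.<⇒≤ g<p) (ℤₚ.<⇒≤ v<h) p<v
                (0<neg⁻ (subst (0ℤ <_) (sym (trans (cong -_ (gap-swap p q g h (f p))) (trans (ℤₚ.neg-involutive _) (gap-src g h p q))))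
                  (0<* pos (0<- (forward e))))) gap>0)
          ... | tri≈ _ eq₀ _ = empty d (src∈ e) g<p (ℤₚ.<-trans p<v v<h) eq₀
          ... | tri< neg _ _ = noncross d e₁ (crosses-down {p} {p₁} {g} {h} ℤₚ.≤-refl v≤p₁ (ℤₚ.<⇒≤ g<p) (ℤₚ.<⇒≤ v<h) p<v
                (subst (0ℤ <_) (sym (trans (gap-swap p p₁ g h (f p)) (trans (cong -_ (gap-src g h p p₁)) (ℤₚ.neg-distribˡ-* (cross g h p) (f p₁ - f p)))))
                  (0<* (0<neg neg) (0<- (forward e₁)))) gap₁<0)

open Planar

-- At most three edges per vertex, and the crossing inequality

module PlanarBound where
  open import Data.Integer using (_+_; _*_; _-_; -_; _<_; _≤_; 0ℤ; 1ℤ; _<?_)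

  opposite-or-zero : ∀ x y {a b} → 0ℤ < a → 0ℤ < b → x * a + y * b ≡ 0ℤ → Opposite x y ⊎ (x ≡ 0ℤ × y ≡ 0ℤ)
  opposite-or-zero x y {a} {b} 0<a 0<b eq with ℤₚ.<-cmp x 0ℤ
  ... | tri< x<0 _ _ = inj₁ (inj₁ (x<0 , 0<*⁻ b 0<b (subst (0ℤ <_) yb (0<* (0<neg x<0) 0<a))))
    where
    yb : - x * a ≡ b * y
    yb = i-j≡0⇒i≡j _ _ (trans (solve 4 (λ x y a b → (:- x) :* a :- b :* y := :- (x :* a :+ y :* b)) refl x y a b) (cong -_ eq))
      where open Data.Integer.Solver.+-*-Solver
  ... | tri≈ _ refl _ = inj₂ (refl , *-cancel-0 b 0<b (trans (ℤₚ.*-comm b y) (trans (sym (ℤₚ.+-identityˡ _)) eq)))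
  ... | tri> _ _ 0<x = inj₁ (inj₂ (0<x , 0<neg⁻ (0<*⁻ b 0<b (subst (0ℤ <_) yb (0<* 0<x 0<a)))))
    where
    yb : x * a ≡ b * - y
    yb = i-j≡0⇒i≡j _ _ (trans (solve 4 (λ x y a b → x :* a :- b :* (:- y) := x :* a :+ y :* b) refl x y a b) eq)
      where open Data.Integer.Solver.+-*-Solver

  private
    opposite⇒≢0 : ∀ {x y} → Opposite x y → x ≢ 0ℤ
    opposite⇒≢0 (inj₁ (lt , _)) refl = ℤₚ.<-irrefl refl lt
    opposite⇒≢0 (inj₂ (lt , _)) refl = ℤₚ.<-irrefl refl lt

  data Kind : Set where
    topRight topLeft underneath : Kind

  module _ (N : ℤ) where
    open Heights N

    module _ {V : List Point} {Edge : Point → Point → Set} (planar : IsPlanar V Edge) where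
      open IsPlanar planar

      -- Where two edges meet inside both, the ends of each lie strictly on opposite sides of the
      -- other or all on one line. The first is a proper crossing; in the second, an end that is not
      -- shared would lie inside the other edge.
      meeting-edges-equal : ∀ {p q g h s} → Edge p q → Edge g h →
        f p < s → s < f q → f g < s → s < f h → gap p q g h s ≡ 0ℤ → p ≡ g × q ≡ h
      meeting-edges-equal {p} {q} {g} {h} {s} e d p<s s<q g<s s<h gap≡0
        with opposite-or-zero _ _ (0<- s<h) (0<- g<s) gap≡0
          | opposite-or-zero _ _ (0<- s<q) (0<- p<s)
              (trans (sym (ℤₚ.neg-involutive _)) (cong -_ (trans (sym (gap-swap p q g h s)) gap≡0)))
      ... | inj₁ opp | inj₁ opp′ = contradiction (opp , opp′) (noncross e d)
      ... | inj₁ opp | inj₂ (x′≡0 , y′≡0) = contradiction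
            (*-cancel-0 (f h - f g) (0<- (forward d)) (trans (ℤₚ.*-comm (f h - f g) (cross p q g)) (trans (sym (gap-src p q g h)) (trans (gap-swap p q g h (f g))
              (cong -_ (cong₂ (λ x y → x * (f q - f g) + y * (f g - f p)) x′≡0 y′≡0))))))
            (opposite⇒≢0 opp)
      ... | inj₂ (x≡0 , y≡0) | inj₁ opp′ = contradiction
            (*-cancel-0 (f q - f p) (0<- (forward e)) (trans (ℤₚ.*-comm (f q - f p) (cross g h p)) (trans (sym (gap-src g h p q)) (trans (gap-swap g h p q (f p))
              (cong -_ (cong₂ (λ x y → x * (f h - f p) + y * (f p - f g)) x≡0 y≡0))))))
            (opposite⇒≢0 opp′)
      ... | inj₂ (x≡0 , y≡0) | inj₂ (x′≡0 , y′≡0) = p≡g , q≡h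
        where
        p≡g : p ≡ g
        p≡g with ℤₚ.<-cmp (f p) (f g)
        ... | tri< p<g _ _ = contradiction x≡0 (empty e (src∈ d) p<g (ℤₚ.<-trans g<s s<q))
        ... | tri≈ _ eq _  = f-injective (src∈ e) (src∈ d) eq
        ... | tri> _ _ g<p = contradiction x′≡0 (empty d (src∈ e) g<p (ℤₚ.<-trans p<s s<h))
        q≡h : q ≡ h
        q≡h with ℤₚ.<-cmp (f q) (f h)
        ... | tri< q<h _ _ = contradiction y′≡0 (empty d (tgt∈ e) (ℤₚ.<-trans g<s s<q) q<h)
        ... | tri≈ _ eq _  = f-injective (tgt∈ e) (tgt∈ d) eq
        ... | tri> _ _ h<q = contradiction y≡0 (empty e (tgt∈ d) (ℤₚ.<-trans p<s s<h) h<q)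

    EdgeOf : {X : Set} → (X → Point) → (X → Point) → List X → Point → Point → Set
    EdgeOf s t E p q = ∃[ e ] (e ∈ E × s e ≡ p × t e ≡ q)

    module _ {X : Set} {s t : X → Point} {E : List X} {V : List Point} (planar : IsPlanar V (EdgeOf s t E))
      (distinct : ∀ {e d} → e ∈ E → d ∈ E → s e ≡ s d → t e ≡ t d → e ≡ d) where
      open IsPlanar planar

      private
        Edge : Point → Point → Set
        Edge = EdgeOf s t E

        edge : ∀ {e} → e ∈ E → Edge (s e) (t e)
        edge e∈ = _ , e∈ , refl , refl

        Charge : X → Kind × Point → Set
        Charge e (topRight , v) = v ≡ s e × (∀ {h} → Edge (s e) h → cross (s e) (t e) h ≤ 0ℤ)
        Charge e (topLeft , v) = v ≡ t e × (∀ {g} → Edge g (t e) → cross (s e) (t e) g ≤ 0ℤ)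
        Charge e (underneath , v) = Sees Edge v (s e) (t e)

        kinds : List Kind
        kinds = topRight ∷ topLeft ∷ underneath ∷ []

        charge : ∀ {e} → e ∈ E → ∃[ c ] (c ∈ cartesianProduct kinds V × Charge e c)
        charge {e} e∈ with any? (λ d → (s d ≟ₚ s e) ×-dec (0ℤ <? cross (s e) (t e) (t d))) E
        ... | no none = (topRight , s e) , ∈-cartesianProduct⁺ {xs = kinds} (here refl) (src∈ (edge e∈)) , refl ,
              λ { (d , d∈ , sd , refl) → ℤₚ.≮⇒≥ λ lt → none (lose d∈ (sd , lt)) }
        ... | yes some with any? (λ d → (t d ≟ₚ t e) ×-dec (0ℤ <? cross (s e) (t e) (s d))) E
        ... | no none = (topLeft , t e) , ∈-cartesianProduct⁺ {xs = kinds} (there (here refl)) (tgt∈ (edge e∈)) , refl ,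
              λ { (d , d∈ , refl , td) → ℤₚ.≮⇒≥ λ lt → none (lose d∈ (td , lt)) }
        ... | yes some′ with find some | find some′
        ... | d , d∈ , sd , above | d′ , d′∈ , td′ , above′ =
              let v , v∈ , sees = visible planar (edge e∈)
                    (e₁ , proj₁ e₁-spec , proj₁ (proj₂ e₁-spec) , refl) (proj₂ (proj₂ e₁-spec)) next
                    (d′ , d′∈ , refl , td′) above′
              in (underneath , v) , ∈-cartesianProduct⁺ {xs = kinds} (there (there (here refl))) v∈ , sees
          where
          p q : Point
          p = s e
          q = t e
          right? : ∀ d → Dec (s d ≡ p × 0ℤ < cross p q (t d))
          right? d = (s d ≟ₚ p) ×-dec (0ℤ <? cross p q (t d))
          spec : ∀ {d} → d ∈ filter right? E → d ∈ E × (s d ≡ p × 0ℤ < cross p q (t d))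
          spec = ∈-filter⁻ right? {xs = E}
          right : ∀ {d} → d ∈ filter right? E → f p < f (t d)
          right d∈ = forward (_ , proj₁ (spec d∈) , proj₁ (proj₂ (spec d∈)) , refl)
          -- The edge d found by the search is just some edge at p above pq; `visible` needs the one
          -- next to pq in angular order.
          nearest : ∃[ e₁ ] (e₁ ∈ filter right? E × (∀ {d} → d ∈ filter right? E → 0ℤ ≤ cross p (t e₁) (t d)))
          nearest = least (λ x y → 0ℤ ≤ cross p (t x) (t y))
            (λ {x} {y} _ _ → [ inj₁ , (λ le → inj₂ (subst (0ℤ ≤_) (sym (cross-swap p (t x) (t y))) (0≤neg le))) ]′
              (ℤₚ.≤-total 0ℤ (cross p (t x) (t y))))
            (λ {x} {y} {z} x∈ y∈ z∈ → angle-trans {p} {t x} {t y} {t z} (right x∈) (right y∈) (right z∈))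
            (∈-filter⁺ right? d∈ (sd , above))
          e₁ : X
          e₁ = proj₁ nearest
          e₁-spec : e₁ ∈ E × (s e₁ ≡ p × 0ℤ < cross p q (t e₁))
          e₁-spec = spec (proj₁ (proj₂ nearest))
          next : ∀ {h} → Edge p h → 0ℤ < cross p q h → 0ℤ ≤ cross p (t e₁) h
          next (c , c∈ , sc , refl) lt = proj₂ (proj₂ nearest) (∈-filter⁺ right? c∈ (sc , lt))

        -- Two highest edges at a common end are collinear, and if they differed, the shorter would
        -- end inside the longer. Two first edges below v have the same height at the abscissa of v,
        -- so they meet there and coincide.
        charge-injective : ∀ {e d c} → e ∈ E → d ∈ E → Charge e c → Charge d c → e ≡ d
        charge-injective {e} {d} {topRight , v} e∈ d∈ (refl , top) (se≡sd , top′) = distinct e∈ d∈ se≡sd tgt≡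
          where
          p q h : Point
          p = s e
          q = t e
          h = t d
          c≡0 : cross p q h ≡ 0ℤ
          c≡0 = ℤₚ.≤-antisym (top (d , d∈ , sym se≡sd , refl))
            (ℤₚ.neg-cancel-≤ (subst (_≤ 0ℤ) (trans (cong (λ z → cross z h q) (sym se≡sd)) (cross-swap p q h))
              (top′ (e , e∈ , se≡sd , refl))))
          tgt≡ : q ≡ h
          tgt≡ with ℤₚ.<-cmp (f q) (f h)
          ... | tri< q<h _ _ = contradiction (trans (cross-swap p q h) (cong -_ c≡0))
                (empty (d , d∈ , sym se≡sd , refl) (tgt∈ (edge e∈)) (forward (edge e∈)) q<h)
          ... | tri≈ _ eq _ = f-injective (tgt∈ (edge e∈)) (tgt∈ (edge d∈)) eq
          ... | tri> _ _ h<q = contradiction c≡0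
                (empty (edge e∈) (tgt∈ (edge d∈)) (forward (d , d∈ , sym se≡sd , refl)) h<q)
        charge-injective {e} {d} {topLeft , v} e∈ d∈ (refl , top) (te≡td , top′) = distinct e∈ d∈ src≡ te≡td
          where
          p q g : Point
          p = s e
          q = t e
          g = s d
          swap : cross g q p ≡ - cross p q g
          swap = trans (sym (cross-rot p g q)) (cross-swap p q g)
          c≡0 : cross p q g ≡ 0ℤ
          c≡0 = ℤₚ.≤-antisym (top (d , d∈ , refl , sym te≡td))
            (ℤₚ.neg-cancel-≤ (subst (_≤ 0ℤ) (trans (cong (λ z → cross g z p) (sym te≡td)) swap)
              (top′ (e , e∈ , refl , te≡td))))
          src≡ : p ≡ g
          src≡ with ℤₚ.<-cmp (f p) (f g)
          ... | tri< p<g _ _ = contradiction c≡0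
                (empty (edge e∈) (src∈ (edge d∈)) p<g (forward (d , d∈ , refl , sym te≡td)))
          ... | tri≈ _ eq _ = f-injective (src∈ (edge e∈)) (src∈ (edge d∈)) eq
          ... | tri> _ _ g<p = contradiction (trans swap (cong -_ c≡0))
                (empty (d , d∈ , refl , sym te≡td) (src∈ (edge e∈)) g<p (forward (edge e∈)))
        charge-injective {e} {d} {underneath , v} e∈ d∈ (p<v , v<q , above , low) (g<v , v<h , above′ , low′) =
          let p≡g , q≡h = meeting-edges-equal planar (edge e∈) (edge d∈) p<v v<q g<v v<h gap≡0
          in distinct e∈ d∈ p≡g q≡h
          where
          gap≡0 : gap (s e) (t e) (s d) (t d) (f v) ≡ 0ℤ
          gap≡0 = trans (gap-at (s e) (t e) (s d) (t d) v) (ℤₚ.i≡j⇒i-j≡0 (ℤₚ.≤-antisym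
            (subst₂ _≤_ (ℤₚ.*-comm _ (f (t d) - f (s d))) (ℤₚ.*-comm _ (f (t e) - f (s e))) (low (edge d∈) g<v v<h above′))
            (subst₂ _≤_ (ℤₚ.*-comm _ (f (t e) - f (s e))) (ℤₚ.*-comm _ (f (t d) - f (s d))) (low′ (edge e∈) p<v v<q above))))

      planar-bound : Unique E → length E ℕ.≤ 3 ℕ.* length V
      planar-bound uniq = ℕₚ.≤-trans (pigeonhole Charge uniq charge charge-injective) (ℕₚ.≤-reflexive (length-cartesianProduct kinds V))

    module _ {X : Set} {s t : X → Point} {E : List X} {V : List Point} (f-injective : InjectiveOn N V)
      (src∈ : ∀ {e} → e ∈ E → s e ∈ V) (tgt∈ : ∀ {e} → e ∈ E → t e ∈ V)
      (forward : ∀ {e} → e ∈ E → f (s e) < f (t e))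
      (empty : ∀ {e w} → e ∈ E → w ∈ V → f (s e) < f w → f w < f (t e) → cross (s e) (t e) w ≢ 0ℤ)
      (distinct : ∀ {e d} → e ∈ E → d ∈ E → s e ≡ s d → t e ≡ t d → e ≡ d) where

      private
        _~_ : X → X → Set
        e ~ d = Crosses (s e) (t e) (s d) (t d)

        _~?_ : ∀ e d → Dec (e ~ d)
        e ~? d = crosses? (s e) (t e) (s d) (t d)

        open Greedy _~_ _~?_

      crossingPairs : List (X × X)
      crossingPairs = filter (λ (e , d) → e ~? d) (cartesianProduct E E)

      -- Delete one edge of each crossing pair.
      crossing-bound : Unique E → length E ℕ.≤ 3 ℕ.* length V ℕ.+ length crossingPairs
      crossing-bound uniq = ℕₚ.≤-trans split (ℕₚ.+-monoˡ-≤ (length crossingPairs)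
        (planar-bound planar (λ e∈ d∈ → distinct (greedy-⊆ E e∈) (greedy-⊆ E d∈)) (greedy-unique uniq)))
        where
        planar : IsPlanar V (EdgeOf s t (greedy E))
        planar = record
          { f-injective = f-injective
          ; src∈ = λ { (e , e∈ , refl , refl) → src∈ (greedy-⊆ E e∈) }
          ; tgt∈ = λ { (e , e∈ , refl , refl) → tgt∈ (greedy-⊆ E e∈) }
          ; forward = λ { (e , e∈ , refl , refl) → forward (greedy-⊆ E e∈) }
          ; empty = λ { (e , e∈ , refl , refl) → empty (greedy-⊆ E e∈) }
          ; noncross = λ { (e , e∈ , refl , refl) (d , d∈ , refl , refl) e~d →
              irreflexive (subst (e ~_) (sym (greedy-independent ~-sym E e∈ d∈ e~d)) e~d) }
          }
          where
          ~-sym : ∀ {e d} → e ~ d → d ~ e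
          ~-sym (x , y) = y , x
          irreflexive : ∀ {e} → ¬ (e ~ e)
          irreflexive {e} (opp , _) = opposite⇒≢0 opp (cross-aba (s e) (t e))
        Goes : X → X ⊎ (X × X) → Set
        Goes e (inj₁ d) = e ≡ d
        Goes e (inj₂ (d , _)) = e ≡ d
        goes : ∀ {e} → e ∈ E → ∃[ c ] (c ∈ map inj₁ (greedy E) ++ map inj₂ crossingPairs × Goes e c)
        goes {e} e∈ with greedy-maximal E e∈
        ... | inj₁ kept = inj₁ e , ∈-++⁺ˡ (∈-map⁺ inj₁ kept) , refl
        ... | inj₂ (d , d∈ , e~d) = inj₂ (e , d) , ∈-++⁺ʳ (map inj₁ (greedy E)) (∈-map⁺ inj₂
              (∈-filter⁺ (λ (e , d) → e ~? d) (∈-cartesianProduct⁺ e∈ (greedy-⊆ E d∈)) e~d)) , refl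
        goes-injective : ∀ {e d} c → Goes e c → Goes d c → e ≡ d
        goes-injective (inj₁ _) refl refl = refl
        goes-injective (inj₂ _) refl refl = refl
        split : length E ℕ.≤ length (greedy E) ℕ.+ length crossingPairs
        split = ℕₚ.≤-trans (pigeonhole Goes uniq goes λ {_} {_} {c} _ _ → goes-injective c)
          (ℕₚ.≤-reflexive (trans (length-++ (map inj₁ (greedy E)))
            (cong₂ ℕ._+_ (length-map inj₁ (greedy E)) (length-map inj₂ crossingPairs))))

open PlanarBound

-- The Szemerédi-Trotter bound for disjoint rich segments

module RichSegments where
  open import Data.Nat using (zero; suc)

  module _ where
    open import Data.Nat using (_+_; _*_; _^_; _≤_; _<_; z≤n; s≤s; NonZero; >-nonZero)
    open import Data.Nat.DivMod using (_/_; m/n*n≤m; m≡m%n+[m/n]*n; m%n<n; m≥n⇒m/n>0)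

    length-filter-map : ∀ {A B : Set} {Q : B → Set} (Q? : Decidable Q) (g : A → B) xs →
      length (filter Q? (map g xs)) ≡ length (filter (λ x → Q? (g x)) xs)
    length-filter-map Q? g [] = refl
    length-filter-map Q? g (x ∷ xs) with Q? (g x)
    ... | yes _ = cong suc (length-filter-map Q? g xs)
    ... | no _  = length-filter-map Q? g xs

    length-filter-cartesianProduct : ∀ {A B : Set} {Q : A × B → Set} (Q? : Decidable Q) (xs : List A) (ys : List B) k →
      (∀ {x} → x ∈ xs → k ≤ length (filter (λ y → Q? (x , y)) ys)) →
      length xs * k ≤ length (filter Q? (cartesianProduct xs ys))
    length-filter-cartesianProduct Q? [] ys k hyp = z≤n
    length-filter-cartesianProduct Q? (x ∷ xs) ys k hyp = begin
      k + length xs * k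
        ≤⟨ ℕₚ.+-mono-≤ (hyp (here refl)) (length-filter-cartesianProduct Q? xs ys k (hyp ∘ there)) ⟩
      length (filter (λ y → Q? (x , y)) ys) + length (filter Q? (cartesianProduct xs ys))
        ≡⟨ cong (_+ length (filter Q? (cartesianProduct xs ys)))
             (length-filter-map Q? (x ,_) ys) ⟨
      length (filter Q? (map (x ,_) ys)) + length (filter Q? (cartesianProduct xs ys))
        ≡⟨ length-++ (filter Q? (map (x ,_) ys)) ⟨
      length (filter Q? (map (x ,_) ys) ++ filter Q? (cartesianProduct xs ys))
        ≡⟨ cong length (filter-++ Q? (map (x ,_) ys) _) ⟨
      length (filter Q? (map (x ,_) ys ++ cartesianProduct xs ys)) ∎
      where open ℕₚ.≤-Reasoning

    -- The optimal sampling rate is 1 / p with p about jr / 6v.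
    optimize : ∀ j r v → 1 ≤ v → (∀ c → j * r * suc c ^ 2 ≤ 3 * v * suc c ^ 3 + j * j) →
      j * r ^ 3 ≤ 288 * v ^ 2 + 6 * v * r ^ 2
    optimize zero r v 1≤v hyp = z≤n
    optimize j@(suc _) r v 1≤v hyp with j * r ℕₚ.≤? 6 * v
    ... | yes jr≤6v = begin
        j * r ^ 3                        ≡⟨ solve 2 (λ j r → j :* r :^ 3 := j :* r :* r :^ 2) refl j r ⟩
        j * r * r ^ 2                    ≤⟨ ℕₚ.*-monoˡ-≤ (r ^ 2) jr≤6v ⟩
        6 * v * r ^ 2                    ≤⟨ ℕₚ.m≤n+m _ _ ⟩
        288 * v ^ 2 + 6 * v * r ^ 2      ∎
      where
      open ℕₚ.≤-Reasoning
      open Data.Nat.Solver.+-*-Solver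
    ... | no jr≰6v = ℕₚ.≤-trans (ℕₚ.*-cancelˡ-≤ j (begin
        j * (j * r ^ 3)                  ≡⟨ solve 2 (λ j r → j :* (j :* r :^ 3) := (j :* r) :* (j :* r) :* r) refl j r ⟩
        (j * r) * (j * r) * r            ≤⟨ ℕₚ.*-monoˡ-≤ r (ℕₚ.*-mono-≤ jr≤12vp jr≤12vp) ⟩
        (12 * v * p) * (12 * v * p) * r  ≡⟨ solve 3 (λ v p r → (con 12 :* v :* p) :* (con 12 :* v :* p) :* r := con 144 :* v :^ 2 :* (r :* p :^ 2)) refl v p r ⟩
        144 * v ^ 2 * (r * p ^ 2)        ≤⟨ ℕₚ.*-monoʳ-≤ (144 * v ^ 2) rp²≤2j ⟩
        144 * v ^ 2 * (2 * j)            ≡⟨ solve 2 (λ v j → con 144 :* v :^ 2 :* (con 2 :* j) := j :* (con 288 :* v :^ 2)) refl v j ⟩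
        j * (288 * v ^ 2)                ∎)) (ℕₚ.m≤m+n _ _)
      where
      open ℕₚ.≤-Reasoning
      open Data.Nat.Solver.+-*-Solver
      instance
        6v≢0 : NonZero (6 * v)
        6v≢0 = >-nonZero (ℕₚ.<-≤-trans 1≤v (ℕₚ.m≤m+n v (5 * v)))
      p : ℕ
      p = j * r / (6 * v)
      1≤p : 1 ≤ p
      1≤p = m≥n⇒m/n>0 (ℕₚ.<⇒≤ (ℕₚ.≰⇒> jr≰6v))
      6vp≤jr : 6 * v * p ≤ j * r
      6vp≤jr = ℕₚ.≤-trans (ℕₚ.≤-reflexive (ℕₚ.*-comm (6 * v) p)) (m/n*n≤m (j * r) (6 * v))
      jr≤12vp : j * r ≤ 12 * v * p
      jr≤12vp = begin
        j * r                                     ≡⟨ m≡m%n+[m/n]*n (j * r) (6 * v) ⟩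
        (j * r) ℕ.% (6 * v) + p * (6 * v)         ≤⟨ ℕₚ.+-monoˡ-≤ _ (ℕₚ.<⇒≤ (m%n<n (j * r) (6 * v))) ⟩
        6 * v + p * (6 * v)                       ≤⟨ ℕₚ.+-monoˡ-≤ (p * (6 * v)) (ℕₚ.≤-trans (ℕₚ.≤-reflexive (sym (ℕₚ.*-identityˡ (6 * v)))) (ℕₚ.*-monoˡ-≤ (6 * v) 1≤p)) ⟩
        p * (6 * v) + p * (6 * v)                 ≡⟨ solve 2 (λ v p → p :* (con 6 :* v) :+ p :* (con 6 :* v) := con 12 :* v :* p) refl v p ⟩
        12 * v * p                                ∎
      at-p : j * r * p ^ 2 ≤ 3 * v * p ^ 3 + j * j
      at-p with p in eq
      ... | zero = contradiction (subst (1 ≤_) eq 1≤p) λ ()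
      ... | suc c = hyp c
      -- As 6vp ≤ jr, the vertex term 3vp³ is at most half of jrp², which leaves jrp² ≤ 2j². The
      -- other rounding, jr ≤ 12vp, then converts this into a bound without p.
      rp²≤2j : r * p ^ 2 ≤ 2 * j
      rp²≤2j = ℕₚ.*-cancelˡ-≤ j (ℕₚ.+-cancelˡ-≤ (j * r * p ^ 2) _ _ (begin
        j * r * p ^ 2 + j * (r * p ^ 2)           ≡⟨ solve 3 (λ j r p → j :* r :* p :^ 2 :+ j :* (r :* p :^ 2) := con 2 :* (j :* r :* p :^ 2)) refl j r p ⟩
        2 * (j * r * p ^ 2)                       ≤⟨ ℕₚ.*-monoʳ-≤ 2 at-p ⟩
        2 * (3 * v * p ^ 3 + j * j)               ≡⟨ solve 3 (λ j v p → con 2 :* (con 3 :* v :* p :^ 3 :+ j :* j) := con 6 :* v :* p :* p :^ 2 :+ j :* (con 2 :* j)) refl j v p ⟩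
        6 * v * p * p ^ 2 + j * (2 * j)           ≤⟨ ℕₚ.+-monoˡ-≤ (j * (2 * j)) (ℕₚ.*-monoˡ-≤ (p ^ 2) 6vp≤jr) ⟩
        j * r * p ^ 2 + j * (2 * j)               ∎))

  open import Data.Integer using (_+_; _*_; _-_; -_; _<_; _≤_; 0ℤ; 1ℤ; _<?_)

  collinear-trans : ∀ N a c u v w → lin N a < lin N c →
    cross a c u ≡ 0ℤ → cross a c v ≡ 0ℤ → cross a c w ≡ 0ℤ → cross u v w ≡ 0ℤ
  collinear-trans N a c u v w a<c u≡0 v≡0 w≡0 = *-cancel-0 (lin N c - lin N a) (0<- a<c) (begin
    (lin N c - lin N a) * cross u v w          ≡⟨ ℤₚ.*-comm _ (cross u v w) ⟩
    cross u v w * (lin N c - lin N a)          ≡⟨ ℤₚ.neg-involutive _ ⟨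
    - - (cross u v w * (lin N c - lin N a))    ≡⟨ cong -_ (cross-affine N a c u v w) ⟨
    - (cross a c u * (lin N v - lin N w) + cross a c v * (lin N w - lin N u) + cross a c w * (lin N u - lin N v))
      ≡⟨ cong -_ (cong₂ _+_ (cong₂ _+_ (cong (_* _) u≡0) (cong (_* _) v≡0)) (cong (_* _) w≡0)) ⟩
    0ℤ ∎)
    where open ≡-Reasoning

  private
    opposite-scale : ∀ {k l x y x′ y′} → 0ℤ < k → 0ℤ < l → k * x′ ≡ l * x → k * y′ ≡ l * y → Opposite x y → Opposite x′ y′
    opposite-scale {k} {l} 0<k 0<l eqx eqy (inj₁ (x<0 , 0<y)) = inj₁ (down eqx x<0 , 0<*⁻ k 0<k (subst (0ℤ <_) (sym eqy) (0<* 0<l 0<y)))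
      where
      down : ∀ {x x′} → k * x′ ≡ l * x → x < 0ℤ → x′ < 0ℤ
      down {x} {x′} eq x<0 = 0<neg⁻ (0<*⁻ k 0<k (subst (0ℤ <_)
        (trans (sym (ℤₚ.neg-distribʳ-* l x)) (trans (cong -_ (sym eq)) (ℤₚ.neg-distribʳ-* k x′))) (0<* 0<l (0<neg x<0))))
    opposite-scale {k} {l} 0<k 0<l eqx eqy (inj₂ (0<x , y<0)) = inj₂ (0<*⁻ k 0<k (subst (0ℤ <_) (sym eqx) (0<* 0<l 0<x)) , down eqy y<0)
      where
      down : ∀ {x x′} → k * x′ ≡ l * x → x < 0ℤ → x′ < 0ℤ
      down {x} {x′} eq x<0 = 0<neg⁻ (0<*⁻ k 0<k (subst (0ℤ <_)
        (trans (sym (ℤₚ.neg-distribʳ-* l x)) (trans (cong -_ (sym eq)) (ℤₚ.neg-distribʳ-* k x′))) (0<* 0<l (0<neg x<0))))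

    opposite-irrelevant : ∀ {x y} → Opposite x y → 0ℤ < x → 0ℤ < y → ⊥
    opposite-irrelevant (inj₁ (x<0 , _)) 0<x 0<y = ℤₚ.<-asym x<0 0<x
    opposite-irrelevant (inj₂ (_ , y<0)) 0<x 0<y = ℤₚ.<-asym y<0 0<y

    opposite-neg : ∀ {x y} → Opposite x y → Opposite (- x) (- y)
    opposite-neg (inj₁ (x<0 , 0<y)) = inj₂ (0<neg x<0 , ℤₚ.neg-mono-< 0<y)
    opposite-neg (inj₂ (0<x , y<0)) = inj₁ (ℤₚ.neg-mono-< 0<x , 0<neg y<0)
    -- Restricted to the line ab, the function `cross z x` is affine. Having changed its sign
    -- between a and b, it keeps the sign it has at b on everything further right.
    one-sign-change : ∀ N z x a b a′ b′ → lin N a < lin N b → lin N b ≤ lin N a′ → lin N a′ < lin N b′ →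
      cross a b a′ ≡ 0ℤ → cross a b b′ ≡ 0ℤ →
      Opposite (cross z x a) (cross z x b) → Opposite (cross z x a′) (cross z x b′) → ⊥
    one-sign-change N z x a b a′ b′ a<b b≤a′ a′<b′ a′≡0 b′≡0 opp opp′ = by-sign opp
      where
      f : Point → ℤ
      f = lin N
      g : Point → ℤ
      g = cross z x
      eq : ∀ w → cross a b w ≡ 0ℤ → (f b - f a) * g w ≡ g b * (f w - f a) + (- g a) * (f w - f b)
      eq w w≡0 = i-j≡0⇒i≡j _ _ (begin
        (f b - f a) * g w - (g b * (f w - f a) + (- g a) * (f w - f b))
          ≡⟨ solve 6 (λ a b w ga gb gw → (b :- a) :* gw :- (gb :* (w :- a) :+ (:- ga) :* (w :- b)) :=
               :- (ga :* (b :- w) :+ gb :* (w :- a) :+ gw :* (a :- b))) refl (f a) (f b) (f w) (g a) (g b) (g w) ⟩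
        - (g a * (f b - f w) + g b * (f w - f a) + g w * (f a - f b)) ≡⟨ cong -_ (cross-affine N z x a b w) ⟩
        - (- (cross a b w * (f x - f z))) ≡⟨ cong (λ c → - (- (c * (f x - f z)))) w≡0 ⟩
        0ℤ ∎)
        where
        open ≡-Reasoning
        open Data.Integer.Solver.+-*-Solver
      eq⁻ : ∀ w → cross a b w ≡ 0ℤ → (f b - f a) * (- g w) ≡ (- g b) * (f w - f a) + g a * (f w - f b)
      eq⁻ w w≡0 = trans (sym (ℤₚ.neg-distribʳ-* (f b - f a) (g w))) (trans (cong -_ (eq w w≡0))
        (solve 4 (λ ga gb u v → :- (gb :* u :+ (:- ga) :* v) := (:- gb) :* u :+ ga :* v) refl (g a) (g b) (f w - f a) (f w - f b)))
        where open Data.Integer.Solver.+-*-Solver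
      b≤b′ : f b ≤ f b′
      b≤b′ = ℤₚ.≤-trans b≤a′ (ℤₚ.<⇒≤ a′<b′)
      by-sign : Opposite (g a) (g b) → ⊥
      by-sign (inj₁ (ga<0 , 0<gb)) = opposite-irrelevant opp′ (g-pos a′ a′≡0 b≤a′) (g-pos b′ b′≡0 b≤b′)
        where
        g-pos : ∀ w → cross a b w ≡ 0ℤ → f b ≤ f w → 0ℤ < g w
        g-pos w w≡0 b≤w = 0<*⁻ (f b - f a) (0<- a<b) (subst (0ℤ <_) (sym (eq w w≡0))
          (0<+ (0<* 0<gb (0<- (ℤₚ.<-≤-trans a<b b≤w))) (0≤* (ℤₚ.<⇒≤ (0<neg ga<0)) (0≤- b≤w))))
      by-sign (inj₂ (0<ga , gb<0)) = opposite-irrelevant (opposite-neg opp′) (g-neg a′ a′≡0 b≤a′) (g-neg b′ b′≡0 b≤b′)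
        where
        g-neg : ∀ w → cross a b w ≡ 0ℤ → f b ≤ f w → 0ℤ < - g w
        g-neg w w≡0 b≤w = 0<*⁻ (f b - f a) (0<- a<b) (subst (0ℤ <_) (sym (eq⁻ w w≡0))
          (0<+ (0<* (0<neg gb<0) (0<- (ℤₚ.<-≤-trans a<b b≤w))) (0≤* (ℤₚ.<⇒≤ 0<ga) (0≤- b≤w))))

  module _ (P : List Point) (ρ : ℕ) where

    private
      N : ℤ
      N = slope P

      f : Point → ℤ
      f = lin N

    InSegment : Point → Point → Point → Set
    InSegment z x w = cross z x w ≡ 0ℤ × (f z ≤ f w × f w ≤ f x)

    inSegment? : ∀ z x w → Dec (InSegment z x w)
    inSegment? z x w = (_ ℤₚ.≟ _) ×-dec ((_ ℤₚ.≤? _) ×-dec (_ ℤₚ.≤? _))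

    segment : Point → Point → List Point
    segment z x = filter (inSegment? z x) P

    Rich : Point × Point → Set
    Rich (z , x) = f z < f x × length (segment z x) ≡ suc ρ

    rich? : ∀ j → Dec (Rich j)
    rich? (z , x) = (_ <? _) ×-dec (_ ℕₚ.≟ _)

    -- Collinearity is recorded from the point of view of either segment, which makes symmetry a
    -- mere exchange of components.
    Overlap : Point × Point → Point × Point → Set
    Overlap (a , c) (z , x) = ((cross z x a ≡ 0ℤ × cross z x c ≡ 0ℤ) × (cross a c z ≡ 0ℤ × cross a c x ≡ 0ℤ)) ×
      (f a ≤ f x × f z ≤ f c)

    overlap? : ∀ i j → Dec (Overlap i j)
    overlap? (a , c) (z , x) = (((_ ℤₚ.≟ _) ×-dec (_ ℤₚ.≟ _)) ×-dec ((_ ℤₚ.≟ _) ×-dec (_ ℤₚ.≟ _))) ×-dec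
      ((_ ℤₚ.≤? _) ×-dec (_ ℤₚ.≤? _))

    private
      overlap-sym : ∀ {i j} → Overlap i j → Overlap j i
      overlap-sym ((u , v) , (w , y)) = (v , u) , (y , w)

      module G = Greedy Overlap overlap?

    candidates : List (Point × Point)
    candidates = filter rich? (cartesianProduct P P)

    -- A maximal family of disjoint segments, each with suc ρ points of P.
    richSegments : List (Point × Point)
    richSegments = G.greedy candidates

    candidates⁻ : ∀ {z x} → (z , x) ∈ candidates → z ∈ P × x ∈ P × Rich (z , x)
    candidates⁻ j∈ =
      let j∈′ , rich = ∈-filter⁻ rich? {xs = cartesianProduct P P} j∈
          z∈ , x∈ = ∈-cartesianProduct⁻ P P j∈′
      in z∈ , x∈ , rich

    richSegments⁻ : ∀ {z x} → (z , x) ∈ richSegments → z ∈ P × x ∈ P × Rich (z , x)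
    richSegments⁻ j∈ = candidates⁻ (G.greedy-⊆ candidates j∈)

    richSegments-maximal : ∀ {a c} → a ∈ P → c ∈ P → Rich (a , c) → ∃[ j ] (j ∈ richSegments × Overlap (a , c) j)
    richSegments-maximal {a} {c} a∈ c∈ rich
      with G.greedy-maximal candidates (∈-filter⁺ rich? (∈-cartesianProduct⁺ a∈ c∈) rich)
    ... | inj₂ found = found
    ... | inj₁ in-family = (a , c) , in-family ,
          ((cross-aba a c , cross-abb a c) , (cross-aba a c , cross-abb a c)) , (ℤₚ.<⇒≤ (proj₁ rich) , ℤₚ.<⇒≤ (proj₁ rich))

    private
      -- An edge of the drawing: a rich segment with the left one of two consecutive points of P on
      -- it. Each rich segment is cut into ρ such edges.
      X : Set
      X = (Point × Point) × Point

      Starts : X → Set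
      Starts ((z , x) , a) = InSegment z x a × f a < f x

      starts? : ∀ e → Dec (Starts e)
      starts? ((z , x) , a) = inSegment? z x a ×-dec (_ <? _)

      E : List X
      E = filter starts? (cartesianProduct richSegments P)

      s : X → Point
      s = proj₂

      After : X → Point → Set
      After ((z , x) , a) w = cross z x w ≡ 0ℤ × f a < f w

      after? : ∀ e w → Dec (After e w)
      after? ((z , x) , a) w = (_ ℤₚ.≟ _) ×-dec (_ <? _)

      -- The next point of P on the line. The default `s e` is never met for edges in `E`, where the
      -- right end x of the segment comes after a.
      t : X → Point
      t e with any? (after? e) P
      ... | no _ = s e
      ... | yes some = let w , w∈ , aw = find some in proj₁ (minBy f (∈-filter⁺ (after? e) {xs = P} w∈ aw))

      t-spec : ∀ {e w} → w ∈ P → After e w → (t e ∈ P × After e (t e)) × (∀ {w} → w ∈ P → After e w → f (t e) ≤ f w)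
      t-spec {e} w∈ aw with any? (after? e) P
      ... | no none = contradiction (lose w∈ aw) none
      ... | yes some with find some
      ... | w , w∈ , aw with minBy f (∈-filter⁺ (after? e) {xs = P} w∈ aw)
      ... | y , y∈ , y-min = ∈-filter⁻ (after? e) {xs = P} y∈ , λ w∈ aw → y-min (∈-filter⁺ (after? e) w∈ aw)
      record EdgeSpec (z x a b : Point) : Set where
        field
          j∈   : (z , x) ∈ richSegments
          a∈   : a ∈ P
          b∈   : b ∈ P
          z<x  : f z < f x
          a-on : cross z x a ≡ 0ℤ
          b-on : cross z x b ≡ 0ℤ
          z≤a  : f z ≤ f a
          a<b  : f a < f b
          b≤x  : f b ≤ f x
          gap  : ∀ {w} → w ∈ P → cross z x w ≡ 0ℤ → f a < f w → f b ≤ f w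

      spec : ∀ {z x a} → ((z , x) , a) ∈ E → EdgeSpec z x a (t ((z , x) , a))
      spec {z} {x} {a} e∈ with ∈-filter⁻ starts? {xs = cartesianProduct richSegments P} e∈
      ... | e∈′ , ((a-on , z≤a , _) , a<x) with ∈-cartesianProduct⁻ richSegments P e∈′
      ... | j∈ , a∈ with richSegments⁻ j∈
      ... | z∈ , x∈ , z<x , _ with t-spec {(z , x) , a} x∈ (cross-abb z x , a<x)
      ... | (b∈ , b-on , a<b) , b-min = record
        { j∈ = j∈ ; a∈ = a∈ ; b∈ = b∈ ; z<x = z<x ; a-on = a-on ; b-on = b-on ; z≤a = z≤a ; a<b = a<b
        ; b≤x = b-min x∈ (cross-abb z x , a<x) ; gap = λ w∈ w-on a<w → b-min w∈ (w-on , a<w) }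

      module _ {z x a b} (e : EdgeSpec z x a b) where
        open EdgeSpec e

        on-edge : ∀ w → cross z x w ≡ 0ℤ → cross a b w ≡ 0ℤ
        on-edge w = collinear-trans N z x a b w z<x a-on b-on

        on-line : ∀ w → cross a b w ≡ 0ℤ → cross z x w ≡ 0ℤ
        on-line w = collinear-trans N a b z x w a<b (on-edge z (cross-aba z x)) (on-edge x (cross-abb z x))

        line-scale : ∀ w → (f x - f z) * cross a b w ≡ (f b - f a) * cross z x w
        line-scale w = i-j≡0⇒i≡j _ _ (begin
          (f x - f z) * cross a b w - (f b - f a) * cross z x w
            ≡⟨ solve 5 (λ a b u c d → u :* c :- (b :- a) :* d := u :* c :+ d :* (a :- b)) refl (f a) (f b) (f x - f z) (cross a b w) (cross z x w) ⟩
          (f x - f z) * cross a b w + cross z x w * (f a - f b)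
            ≡⟨ solve 5 (λ u c q b v → u :* c :+ q := :- (:- (c :* u)) :+ (con 0ℤ :* b :+ con 0ℤ :* v :+ q)) refl
                 (f x - f z) (cross a b w) (cross z x w * (f a - f b)) (f b - f w) (f w - f a) ⟩
          - (- (cross a b w * (f x - f z))) + (0ℤ * (f b - f w) + 0ℤ * (f w - f a) + cross z x w * (f a - f b))
            ≡⟨ cong₂ (λ u v → - (- (cross a b w * (f x - f z))) + (u * (f b - f w) + v * (f w - f a) + cross z x w * (f a - f b))) a-on b-on ⟨
          - (- (cross a b w * (f x - f z))) + (cross z x a * (f b - f w) + cross z x b * (f w - f a) + cross z x w * (f a - f b))
            ≡⟨ cong (λ u → - (- (cross a b w * (f x - f z))) + u) (cross-affine N z x a b w) ⟩
          - (- (cross a b w * (f x - f z))) + (- (cross a b w * (f x - f z)))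
            ≡⟨ ℤₚ.+-inverseˡ (- (cross a b w * (f x - f z))) ⟩
          0ℤ ∎)
          where
          open ≡-Reasoning
          open Data.Integer.Solver.+-*-Solver

      src∈ : ∀ {e} → e ∈ E → s e ∈ P
      src∈ e∈ = EdgeSpec.a∈ (spec e∈)

      tgt∈ : ∀ {e} → e ∈ E → t e ∈ P
      tgt∈ e∈ = EdgeSpec.b∈ (spec e∈)

      forward : ∀ {e} → e ∈ E → f (s e) < f (t e)
      forward e∈ = EdgeSpec.a<b (spec e∈)

      empty : ∀ {e w} → e ∈ E → w ∈ P → f (s e) < f w → f w < f (t e) → cross (s e) (t e) w ≢ 0ℤ
      empty {w = w} e∈ w∈ a<w w<b w≡0 = ℤₚ.<⇒≱ w<b (EdgeSpec.gap (spec e∈) w∈ (on-line (spec e∈) w w≡0) a<w)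

      distinct : ∀ {e d} → e ∈ E → d ∈ E → s e ≡ s d → t e ≡ t d → e ≡ d
      distinct {(z , x) , a} {(z′ , x′) , .a} e∈ d∈ refl te≡td = cong (_, a)
        (G.greedy-independent (λ {i} {j} → overlap-sym {i} {j}) candidates e.j∈ d.j∈
          (((on-line d∈′ z (on-edge e∈′ z (cross-aba z x)) , on-line d∈′ x (on-edge e∈′ x (cross-abb z x))) ,
            (on-line e∈′ z′ (on-edge d∈′ z′ (cross-aba z′ x′)) , on-line e∈′ x′ (on-edge d∈′ x′ (cross-abb z′ x′)))) ,
           (ℤₚ.≤-trans e.z≤a (ℤₚ.≤-trans (ℤₚ.<⇒≤ d.a<b) d.b≤x) , ℤₚ.≤-trans d.z≤a (ℤₚ.≤-trans (ℤₚ.<⇒≤ e.a<b) e.b≤x))))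
        where
        e∈′ = spec e∈
        d∈′ : EdgeSpec z′ x′ a (t ((z , x) , a))
        d∈′ = subst (EdgeSpec z′ x′ a) (sym te≡td) (spec d∈)
        module e = EdgeSpec e∈′
        module d = EdgeSpec d∈′

      Crossing : X × X → Set
      Crossing (e , d) = Crosses (s e) (t e) (s d) (t d)

      crossing? : ∀ c → Dec (Crossing c)
      crossing? (e , d) = crosses? (s e) (t e) (s d) (t d)

      crossings : List (X × X)
      crossings = filter crossing? (cartesianProduct E E)

      same-edge : ∀ {z x a a′} u v → ((z , x) , a) ∈ E → ((z , x) , a′) ∈ E →
        Opposite (cross u v a) (cross u v (t ((z , x) , a))) → Opposite (cross u v a′) (cross u v (t ((z , x) , a′))) → a ≡ a′
      same-edge {z} {x} {a} {a′} u v e∈ e′∈ opp opp′ with ℤₚ.<-cmp (f a) (f a′)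
      ... | tri< a<a′ _ _ = ⊥-elim (one-sign-change N u v a (t ((z , x) , a)) a′ (t ((z , x) , a′)) e.a<b (e.gap e′.a∈ e′.a-on a<a′) e′.a<b
              (on-edge (spec e∈) a′ e′.a-on) (on-edge (spec e∈) (t ((z , x) , a′)) e′.b-on) opp opp′)
        where
        module e = EdgeSpec (spec e∈)
        module e′ = EdgeSpec (spec e′∈)
      ... | tri≈ _ eq _ = slope-injective P (src∈ e∈) (src∈ e′∈) eq
      ... | tri> _ _ a′<a = ⊥-elim (one-sign-change N u v a′ (t ((z , x) , a′)) a (t ((z , x) , a)) e′.a<b (e′.gap e.a∈ e.a-on a′<a) e.a<b
              (on-edge (spec e′∈) a e.a-on) (on-edge (spec e′∈) (t ((z , x) , a)) e.b-on) opp′ opp)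
        where
        module e = EdgeSpec (spec e∈)
        module e′ = EdgeSpec (spec e′∈)

      crossings⁻ : ∀ {e d} → (e , d) ∈ crossings → e ∈ E × d ∈ E × Crosses (s e) (t e) (s d) (t d)
      crossings⁻ c∈ =
        let c∈′ , cr = ∈-filter⁻ crossing? {xs = cartesianProduct E E} c∈
            e∈ , d∈ = ∈-cartesianProduct⁻ E E c∈′
        in e∈ , d∈ , cr

      splits : ∀ {z x a} u v → ((z , x) , a) ∈ E → Opposite (cross a (t ((z , x) , a)) u) (cross a (t ((z , x) , a)) v) →
        Opposite (cross z x u) (cross z x v)
      splits u v e∈ = opposite-scale (0<- e.a<b) (0<- e.z<x) (sym (line-scale (spec e∈) u)) (sym (line-scale (spec e∈) v))
        where module e = EdgeSpec (spec e∈)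

    module _ (uniqueP : Unique P) where

      private
        unique-family : Unique richSegments
        unique-family = G.greedy-unique (Uniqueₚ.filter⁺ rich? (Uniqueₚ.cartesianProduct⁺ uniqueP uniqueP))

        uniqueE : Unique E
        uniqueE = Uniqueₚ.filter⁺ starts? (Uniqueₚ.cartesianProduct⁺ unique-family uniqueP)

        -- Of the edges along one segment at most one has its ends on opposite sides of a given line
        -- (`same-edge`), so a crossing is determined by its ordered pair of segments.
        crossings≤ : length crossings ℕ.≤ length richSegments ℕ.* length richSegments
        crossings≤ = ℕₚ.≤-trans
          (pigeonhole (λ (e , d) (i , j) → proj₁ e ≡ i × proj₁ d ≡ j)
            (Uniqueₚ.filter⁺ crossing? (Uniqueₚ.cartesianProduct⁺ uniqueE uniqueE))
            (λ c∈ → let e∈ , d∈ , _ = crossings⁻ c∈ in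
              _ , ∈-cartesianProduct⁺ (EdgeSpec.j∈ (spec e∈)) (EdgeSpec.j∈ (spec d∈)) , refl , refl)
            injective)
          (ℕₚ.≤-reflexive (length-cartesianProduct richSegments richSegments))
          where
          injective : ∀ {c c′ : X × X} {ij} → c ∈ crossings → c′ ∈ crossings →
            proj₁ (proj₁ c) ≡ proj₁ ij × proj₁ (proj₂ c) ≡ proj₂ ij →
            proj₁ (proj₁ c′) ≡ proj₁ ij × proj₁ (proj₂ c′) ≡ proj₂ ij → c ≡ c′
          injective {(i , a) , (j , g)} {(.i , a′) , (.j , g′)} c∈ c′∈ (refl , refl) (refl , refl) =
            let e∈ , d∈ , opp-d , opp-e = crossings⁻ c∈
                e′∈ , d′∈ , opp-d′ , opp-e′ = crossings⁻ c′∈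
            in cong₂ (λ u v → (i , u) , (j , v))
              (same-edge (proj₁ j) (proj₂ j) e∈ e′∈ (splits a (t (i , a)) d∈ opp-e) (splits a′ (t (i , a′)) d′∈ opp-e′))
              (same-edge (proj₁ i) (proj₂ i) d∈ d′∈ (splits g (t (j , g)) e∈ opp-d) (splits g′ (t (j , g′)) e′∈ opp-d′))

        edges≥ : length richSegments ℕ.* ρ ℕ.≤ length E
        edges≥ = length-filter-cartesianProduct starts? richSegments P ρ per-segment
          where
          per-segment : ∀ {j} → j ∈ richSegments → ρ ℕ.≤ length (filter (λ a → starts? (j , a)) P)
          per-segment {z , x} j∈ with richSegments⁻ j∈
          ... | z∈ , x∈ , z<x , len = ℕ.s≤s⁻¹ (ℕₚ.≤-trans (ℕₚ.≤-reflexive (sym len))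
            (unique-⊆⇒length≤ (Uniqueₚ.filter⁺ (inSegment? z x) uniqueP) sub))
            where
            sub : ∀ {w} → w ∈ segment z x → w ∈ x ∷ filter (λ a → starts? ((z , x) , a)) P
            sub {w} w∈ with ∈-filter⁻ (inSegment? z x) {xs = P} w∈
            ... | w∈P , ins@(_ , _ , w≤x) with ℤₚ.<-cmp (f w) (f x)
            ... | tri< w<x _ _ = there (∈-filter⁺ (λ a → starts? ((z , x) , a)) w∈P (ins , w<x))
            ... | tri≈ _ eq _ = here (slope-injective P w∈P x∈ eq)
            ... | tri> _ _ x<w = contradiction w≤x (ℤₚ.<⇒≱ x<w)

        -- `crossing-bound` holds in each induced subgraph: edges join consecutive points of P, so
        -- no sampled point lies inside one. A proper crossing has four distinct ends, which gives
        -- the exponent 4 of its survival probability.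
        sampled : ∀ c → length E ℕ.* suc c ℕ.^ 2 ℕ.≤ 3 ℕ.* length P ℕ.* suc c ℕ.^ 3 ℕ.+ length crossings
        sampled c = sampled-inequality 3 E crossings ends ends′ uniqueP
          (λ e∈ → ((≢-f (forward e∈) ∷ []) ∷ [] ∷ []) , refl , λ { (here refl) → src∈ e∈ ; (there (here refl)) → tgt∈ e∈ })
          (λ {c} c∈ → let e∈ , d∈ , cr = crossings⁻ c∈ in four-distinct e∈ d∈ cr)
          per-sample
          where
          open Sampling _≟ₚ_ c
          ends : X → List Point
          ends e = s e ∷ t e ∷ []
          ends′ : X × X → List Point
          ends′ (e , d) = s e ∷ t e ∷ s d ∷ t d ∷ []
          ≢-f : ∀ {u v} → f u < f v → u ≢ v
          ≢-f lt refl = ℤₚ.<-irrefl refl lt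
          opposite⇒≢0 : ∀ {x y} → Opposite x y → x ≢ 0ℤ × y ≢ 0ℤ
          opposite⇒≢0 (inj₁ (u , v)) = (λ { refl → ℤₚ.<-irrefl refl u }) , (λ { refl → ℤₚ.<-irrefl refl v })
          opposite⇒≢0 (inj₂ (u , v)) = (λ { refl → ℤₚ.<-irrefl refl u }) , (λ { refl → ℤₚ.<-irrefl refl v })
          four-distinct : ∀ {e d} → e ∈ E → d ∈ E → Crosses (s e) (t e) (s d) (t d) →
            Unique (ends′ (e , d)) × length (ends′ (e , d)) ≡ 4 × (∀ {x} → x ∈ ends′ (e , d) → x ∈ P)
          four-distinct {e} {d} e∈ d∈ (opp , _) =
            ((≢-f (forward e∈) ∷ src≢ (proj₁ off) ∷ src≢ (proj₂ off) ∷ []) ∷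
             (tgt≢ (proj₁ off) ∷ tgt≢ (proj₂ off) ∷ []) ∷ (≢-f (forward d∈) ∷ []) ∷ [] ∷ []) , refl ,
            λ { (here refl) → src∈ e∈ ; (there (here refl)) → tgt∈ e∈
              ; (there (there (here refl))) → src∈ d∈ ; (there (there (there (here refl)))) → tgt∈ d∈ }
            where
            off = opposite⇒≢0 opp
            src≢ : ∀ {w} → cross (s e) (t e) w ≢ 0ℤ → s e ≢ w
            src≢ off refl = off (cross-aba (s e) (t e))
            tgt≢ : ∀ {w} → cross (s e) (t e) w ≢ 0ℤ → t e ≢ w
            tgt≢ off refl = off (cross-abb (s e) (t e))
          per-sample : ∀ S → S ⊑ P → covered ends E S ℕ.≤ 3 ℕ.* length S ℕ.+ covered ends′ crossings S
          per-sample S (uniqueS , S⊆P) = ℕₚ.≤-trans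
            (crossing-bound N {E = E′}
              (λ v∈ w∈ → slope-injective P (S⊆P v∈) (S⊆P w∈))
              (λ e∈ → All.lookup (proj₂ (restrict e∈)) (here refl))
              (λ e∈ → All.lookup (proj₂ (restrict e∈)) (there (here refl)))
              (λ e∈ → forward (proj₁ (restrict e∈)))
              (λ e∈ w∈ → empty (proj₁ (restrict e∈)) (S⊆P w∈))
              (λ e∈ d∈ → distinct (proj₁ (restrict e∈)) (proj₁ (restrict d∈)))
              uniqueE′)
            (ℕₚ.+-monoʳ-≤ (3 ℕ.* length S) (unique-⊆⇒length≤
              (Uniqueₚ.filter⁺ crossing? (Uniqueₚ.cartesianProduct⁺ uniqueE′ uniqueE′)) sub))
            where
            E′ : List X
            E′ = filter (λ e → ends e ⊆? S) E
            uniqueE′ : Unique E′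
            uniqueE′ = Uniqueₚ.filter⁺ (λ e → ends e ⊆? S) uniqueE
            restrict : ∀ {e} → e ∈ E′ → e ∈ E × All (_∈ S) (ends e)
            restrict = ∈-filter⁻ (λ e → ends e ⊆? S) {xs = E}
            sub : ∀ {c} → c ∈ filter crossing? (cartesianProduct E′ E′) → c ∈ filter (λ c → ends′ c ⊆? S) crossings
            sub {e , d} c∈ =
              let c∈′ , cr = ∈-filter⁻ crossing? {xs = cartesianProduct E′ E′} c∈
                  e∈ , d∈ = ∈-cartesianProduct⁻ E′ E′ c∈′
                  e∈E , ends-e = restrict e∈
                  d∈E , ends-d = restrict d∈
              in ∈-filter⁺ (λ c → ends′ c ⊆? S) (∈-filter⁺ crossing? (∈-cartesianProduct⁺ e∈E d∈E) cr) (Allₚ.++⁺ ends-e ends-d)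

      szemerédi-trotter : 1 ℕ.≤ length P →
        length richSegments ℕ.* ρ ℕ.^ 3 ℕ.≤ 288 ℕ.* length P ℕ.^ 2 ℕ.+ 6 ℕ.* length P ℕ.* ρ ℕ.^ 2
      szemerédi-trotter 1≤ = optimize (length richSegments) ρ (length P) 1≤ λ c →
        ℕₚ.≤-trans (ℕₚ.*-monoˡ-≤ (suc c ℕ.^ 2) edges≥)
          (ℕₚ.≤-trans (sampled c) (ℕₚ.+-monoʳ-≤ (3 ℕ.* length P ℕ.* suc c ℕ.^ 3) crossings≤))

open RichSegments

-- Blocking a line at a point, and its effect on open segments

module Blocking where
  open import Data.Nat using (zero; suc)
  open import Data.Integer using (+_; -[1+_]; ∣_∣)
  open import Data.Integer.Divisibility.Signed using (divides; _∣?_)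
  open import Data.Integer using (_+_; _*_; _-_; -_; _<_; _≤_; 0ℤ; 1ℤ; _<?_)
  open Count _≟ₚ_

  order : ∀ i j → i < j ⊎ i ≡ j ⊎ j < i
  order i j with ℤₚ.<-cmp i j
  ... | tri< i<j _ _ = inj₁ i<j
  ... | tri≈ _ i≡j _ = inj₂ (inj₁ i≡j)
  ... | tri> _ _ j<i = inj₂ (inj₂ j<i)

  nonempty : ∀ {A : Set} {xs : List A} → 1 ℕ.≤ length xs → ∃[ x ] (x ∈ xs)
  nonempty {xs = x ∷ _} _ = x , here refl

  0≤i*i : ∀ i → 0ℤ ≤ i * i
  0≤i*i i with ℤₚ.≤-total 0ℤ i
  ... | inj₁ 0≤i = 0≤* 0≤i 0≤i
  ... | inj₂ i≤0 = subst (0ℤ ≤_) (neg*neg i) (0≤* (0≤neg i≤0) (0≤neg i≤0))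
    where
    neg*neg : ∀ i → - i * - i ≡ i * i
    neg*neg = solve 1 (λ i → :- i :* :- i := i :* i) refl
      where open Data.Integer.Solver.+-*-Solver

  -- β = x + (k / l) (u - x) with 0 ≤ k / l ≤ 1.
  record Obstructs (β x u : Point) : Set where
    field
      k l : ℤ
      0≤k : 0ℤ ≤ k
      k≤l : k ≤ l
      0<l : 0ℤ < l
      x-coord : l * (proj₁ β - proj₁ x) ≡ k * (proj₁ u - proj₁ x)
      y-coord : l * (proj₂ β - proj₂ x) ≡ k * (proj₂ u - proj₂ x)

  -- No segment on the line zx through x can gain a further Maker point.
  Dead : List Point → List Point → Point → Point → Set
  Dead M B z x = ∀ u → cross z x u ≡ 0ℤ → u ∉ M → ∃[ β ] (β ∈ B × Obstructs β x u)

  Dead-mono : ∀ {M M′ B B′ z x} → (∀ {p} → p ∈ M → p ∈ M′) → (∀ {p} → p ∈ B → p ∈ B′) → Dead M B z x → Dead M′ B′ z x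
  Dead-mono M⊆ B⊆ dead u on u∉ = let β , β∈ , obs = dead u on (u∉ ∘ M⊆) in β , B⊆ β∈ , obs

  fresh-along : ∀ (h : ℕ → Point) → (∀ i j → h i ≡ h j → i ≡ j) → ∀ C → ∃[ i ] (h i ∉ C)
  fresh-along h injective C with All.all? (_∈? C) (applyUpTo h (suc (length C)))
  ... | yes all = contradiction (subst (ℕ._≤ length C) (length-applyUpTo h (suc (length C)))
          (unique-⊆⇒length≤ (Uniqueₚ.applyUpTo⁺₁ h (suc (length C)) λ {i} {j} i<j _ eq → ℕₚ.<-irrefl (injective i j eq) i<j) (All.lookup all)))
          ℕₚ.1+n≰n
  ... | no ¬all with find (Allₚ.¬All⇒Any¬ (_∈? C) _ ¬all)
  ... | p , p∈ , p∉C with ∈-applyUpTo⁻ h p∈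
  ... | i , _ , refl = i , p∉C

  fresh-points : ∀ k C → ∃[ L ] LegalMove k C L
  fresh-points zero C = [] , refl , [] , []
  fresh-points (suc k) C with fresh-points k C
  ... | L , len , uniq , L∉C with fresh-along (λ i → (+ i , 0ℤ)) (λ { i .i refl → refl }) (L ++ C)
  ... | i , p∉ = (+ i , 0ℤ) ∷ L , cong suc len , All.tabulate (λ { q∈ refl → p∉ (∈-++⁺ˡ q∈) }) ∷ uniq , p∉ ∘ ∈-++⁺ʳ L ∷ L∉C

  least-ℕ : ∀ {Q : ℕ → Set} → (∀ k → Dec (Q k)) → ∀ n → Q n → ∃[ m ] (Q m × (∀ {k} → Q k → m ℕ.≤ k))
  least-ℕ {Q} Q? n Qn = [ (λ none → contradiction Qn (none ℕₚ.≤-refl)) , (λ found → found) ]′ (search (suc n))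
    where
    search : ∀ n → (∀ {k} → k ℕ.< n → ¬ Q k) ⊎ ∃[ m ] (Q m × (∀ {k} → Q k → m ℕ.≤ k))
    search zero = inj₁ λ ()
    search (suc n) with search n
    ... | inj₂ found = inj₂ found
    ... | inj₁ none with Q? n
    ...   | yes Qn = inj₂ (n , Qn , λ Qk → ℕₚ.≮⇒≥ λ k<n → none k<n Qk)
    ...   | no ¬Qn = inj₁ λ k<1+n → [ none , (λ { refl → ¬Qn }) ]′ (ℕₚ.m≤n⇒m<n∨m≡n (ℕ.s≤s⁻¹ k<1+n))

  module _ (M : List Point) (x : Point) (dx dy g : ℤ) (0<g : 0ℤ < g) where

    -- The point at parameter k / g on the line through x with direction (dx , dy).
    At : ℕ → Point → Set
    At k w = g * (proj₁ w - proj₁ x) ≡ + k * dx × g * (proj₂ w - proj₂ x) ≡ + k * dy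

    private
      at-unique : ∀ k w w′ → At k w → At k w′ → w ≡ w′
      at-unique k w w′ (ex , ey) (ex′ , ey′) = cong₂ _,_ (cancel (proj₁ w) (proj₁ w′) (proj₁ x) (trans ex (sym ex′))) (cancel (proj₂ w) (proj₂ w′) (proj₂ x) (trans ey (sym ey′)))
        where
        cancel : ∀ i j c → g * (i - c) ≡ g * (j - c) → i ≡ j
        cancel i j c eq = i-j≡0⇒i≡j i j (*-cancel-0 g 0<g (trans
          (solve 4 (λ g i j c → g :* (i :- j) := g :* (i :- c) :- g :* (j :- c)) refl g i j c) (ℤₚ.i≡j⇒i-j≡0 eq)))
          where open Data.Integer.Solver.+-*-Solver

      Free : ℕ → Set
      Free k = 0 ℕ.< k × ∃[ w ] (At k w × w ∉ M)

      free? : ∀ k → Dec (Free k)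
      free? k = (0 ℕₚ.<? k) ×-dec at?
        where
        shift : ∀ c q z → z ≡ q * g → g * (c + q - c) ≡ z
        shift c q z eq = trans (solve 3 (λ g c q → g :* (c :+ q :- c) := q :* g) refl g c q) (sym eq)
          where open Data.Integer.Solver.+-*-Solver
        at? : Dec (∃[ w ] (At k w × w ∉ M))
        at? with g ∣? (+ k * dx) | g ∣? (+ k * dy)
        ... | no ¬div | _ = no λ { (w , (ex , _) , _) → ¬div (divides (proj₁ w - proj₁ x) (trans (sym ex) (ℤₚ.*-comm g (proj₁ w - proj₁ x)))) }
        ... | yes _ | no ¬div = no λ { (w , (_ , ey) , _) → ¬div (divides (proj₂ w - proj₂ x) (trans (sym ey) (ℤₚ.*-comm g (proj₂ w - proj₂ x)))) }
        ... | yes (divides q eq) | yes (divides q′ eq′) with (proj₁ x + q , proj₂ x + q′) ∈? M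
        ...   | no w∉M = yes ((proj₁ x + q , proj₂ x + q′) , (shift (proj₁ x) q (+ k * dx) eq , shift (proj₂ x) q′ (+ k * dy) eq′) , w∉M)
        ...   | yes w∈M = no λ { (w , at , w∉M) → w∉M (subst (_∈ M)
                  (at-unique k (proj₁ x + q , proj₂ x + q′) w (shift (proj₁ x) q (+ k * dx) eq , shift (proj₂ x) q′ (+ k * dy) eq′) at) w∈M) }

    -- β is the free point of least parameter m / g. A free u at parameter k / g has m ≤ k, so β
    -- divides the way from x to u in the ratio m / k ≤ 1.
    nearest-free : ∀ n w → 0 ℕ.< n → At n w → w ∉ M →
      ∃[ β ] (β ∉ M × (∀ k u → 0 ℕ.< k → At k u → u ∉ M → Obstructs β x u))
    nearest-free n w 0<n at w∉M with least-ℕ free? n (0<n , w , at , w∉M)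
    ... | m , (0<m , β , (βx , βy) , β∉M) , m-least = β , β∉M , λ k u 0<k (ux , uy) u∉M → record
      { k = + m ; l = + k ; 0≤k = ℤ.+≤+ ℕ.z≤n
      ; k≤l = ℤ.+≤+ (m-least (0<k , u , (ux , uy) , u∉M)) ; 0<l = ℤ.+<+ 0<k
      ; x-coord = proportional (+ k) (+ m) (proj₁ β - proj₁ x) (proj₁ u - proj₁ x) dx βx ux ; y-coord = proportional (+ k) (+ m) (proj₂ β - proj₂ x) (proj₂ u - proj₂ x) dy βy uy }
      where
      proportional : ∀ k m p q d → g * p ≡ m * d → g * q ≡ k * d → k * p ≡ m * q
      proportional k m p q d ep eq = i-j≡0⇒i≡j _ _ (*-cancel-0 g 0<g (begin
        g * (k * p - m * q)          ≡⟨ solve 5 (λ g k m p q → g :* (k :* p :- m :* q) := k :* (g :* p) :- m :* (g :* q)) refl g k m p q ⟩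
        k * (g * p) - m * (g * q)    ≡⟨ cong₂ (λ y z → k * y - m * z) ep eq ⟩
        k * (m * d) - m * (k * d)    ≡⟨ solve 3 (λ k m d → k :* (m :* d) :- m :* (k :* d) := con 0ℤ) refl k m d ⟩
        0ℤ                           ∎))
        where
        open ≡-Reasoning
        open Data.Integer.Solver.+-*-Solver

  ray : ∀ M x ex ey g (0<g : 0ℤ < g) → ex * ex + ey * ey ≡ g →
    ∃[ β ] (β ∉ M × (∀ k u → 0 ℕ.< k → At M x ex ey g 0<g k u → u ∉ M → Obstructs β x u))
  ray M x@(xx , xy) ex ey g 0<g eq = nearest-free M x ex ey g 0<g (suc i ℕ.* ∣ g ∣) (h i)
    (ℕₚ.*-mono-≤ {1} {suc i} (ℕ.s≤s ℕ.z≤n) (ℕₚ.n≢0⇒n>0 λ ∣g∣≡0 → ℤₚ.<-irrefl (sym (ℤₚ.∣i∣≡0⇒i≡0 ∣g∣≡0)) 0<g))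
    (at xx ex , at xy ey) (proj₂ (fresh-along h h-injective M))
    where
    open Data.Integer.Solver.+-*-Solver
    h : ℕ → Point
    h i = xx + + suc i * ex , xy + + suc i * ey
    h-injective : ∀ i j → h i ≡ h j → i ≡ j
    h-injective i j eq′ = ℕₚ.suc-injective (ℤₚ.+-injective (i-j≡0⇒i≡j (+ suc i) (+ suc j) (*-cancel-0 g 0<g (begin
      g * (+ suc i - + suc j)          ≡⟨ cong (_* (+ suc i - + suc j)) (sym eq) ⟩
      (ex * ex + ey * ey) * (+ suc i - + suc j)
        ≡⟨ expand (+ suc i) (+ suc j) ⟩
      ex * (proj₁ (h i) - proj₁ (h j)) + ey * (proj₂ (h i) - proj₂ (h j))
        ≡⟨ cong₂ (λ u v → ex * u + ey * v) (ℤₚ.i≡j⇒i-j≡0 (cong proj₁ eq′)) (ℤₚ.i≡j⇒i-j≡0 (cong proj₂ eq′)) ⟩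
      ex * 0ℤ + ey * 0ℤ                ≡⟨ cong₂ _+_ (ℤₚ.*-zeroʳ ex) (ℤₚ.*-zeroʳ ey) ⟩
      0ℤ                               ∎))))
      where
      open ≡-Reasoning
      expand : ∀ a b → (ex * ex + ey * ey) * (a - b) ≡ ex * ((xx + a * ex) - (xx + b * ex)) + ey * ((xy + a * ey) - (xy + b * ey))
      expand a b = solve 6 (λ ex ey a b c d → (ex :* ex :+ ey :* ey) :* (a :- b) :=
        ex :* ((c :+ a :* ex) :- (c :+ b :* ex)) :+ ey :* ((d :+ a :* ey) :- (d :+ b :* ey))) refl ex ey a b xx xy
    i : ℕ
    i = proj₁ (fresh-along h h-injective M)
    at : ∀ c e → g * (c + + suc i * e - c) ≡ + (suc i ℕ.* ∣ g ∣) * e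
    at c e = begin
      g * (c + + suc i * e - c)        ≡⟨ expand (+ suc i) ⟩
      + suc i * g * e                  ≡⟨ cong (λ z → + suc i * z * e) (sym (ℤₚ.0≤i⇒+∣i∣≡i (ℤₚ.<⇒≤ 0<g))) ⟩
      + suc i * + ∣ g ∣ * e            ≡⟨ cong (_* e) (sym (ℤₚ.pos-* (suc i) ∣ g ∣)) ⟩
      + (suc i ℕ.* ∣ g ∣) * e          ∎
      where
      open ≡-Reasoning
      expand : ∀ k → g * (c + k * e - c) ≡ k * g * e
      expand k = solve 4 (λ g c k e → g :* (c :+ k :* e :- c) := k :* g :* e) refl g c k e
  -- With g the squared length of the direction, every lattice point u of the line has the integral
  -- parameter κ, the scalar product of the direction with u - x; the direction need not be
  -- primitive. The sign of κ selects the ray, and κ = 0 would give u = x, which is in M.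
  close-line : ∀ M x dx dy g → x ∈ M → 0ℤ < g → dx * dx + dy * dy ≡ g →
    ∃[ β₁ ] ∃[ β₂ ] (β₁ ∉ M × β₂ ∉ M × (∀ u → u ∉ M →
      dx * (proj₂ u - proj₂ x) - dy * (proj₁ u - proj₁ x) ≡ 0ℤ → Obstructs β₁ x u ⊎ Obstructs β₂ x u))
  close-line M x@(xx , xy) dx dy g x∈M 0<g g≡ =
    proj₁ ray₁ , proj₁ ray₂ , proj₁ (proj₂ ray₁) , proj₁ (proj₂ ray₂) , obstacle
    where
    open Data.Integer.Solver.+-*-Solver
    g≡′ : - dx * - dx + - dy * - dy ≡ g
    g≡′ = trans (solve 2 (λ a b → (:- a) :* (:- a) :+ (:- b) :* (:- b) := a :* a :+ b :* b) refl dx dy) g≡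
    ray₁ = ray M x dx dy g 0<g g≡
    ray₂ = ray M x (- dx) (- dy) g 0<g g≡′
    obstacle : ∀ u → u ∉ M → dx * (proj₂ u - xy) - dy * (proj₁ u - xx) ≡ 0ℤ → Obstructs (proj₁ ray₁) x u ⊎ Obstructs (proj₁ ray₂) x u
    obstacle u@(ux , uy) u∉M on = by-sign (dx * (ux - xx) + dy * (uy - xy)) refl
      where
      decompose : ∀ κ → dx * (ux - xx) + dy * (uy - xy) ≡ κ → g * (ux - xx) ≡ κ * dx × g * (uy - xy) ≡ κ * dy
      decompose κ refl =
        trans (cong (_* (ux - xx)) (sym g≡)) (trans (solve 4 (λ dx dy v w →
          (dx :* dx :+ dy :* dy) :* v := (dx :* v :+ dy :* w) :* dx :- dy :* (dx :* w :- dy :* v)) refl dx dy (ux - xx) (uy - xy))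
          (trans (cong (λ c → κ * dx - dy * c) on) (solve 2 (λ a b → a :- b :* con 0ℤ := a) refl (κ * dx) dy))) ,
        trans (cong (_* (uy - xy)) (sym g≡)) (trans (solve 4 (λ dx dy v w →
          (dx :* dx :+ dy :* dy) :* w := (dx :* v :+ dy :* w) :* dy :+ dx :* (dx :* w :- dy :* v)) refl dx dy (ux - xx) (uy - xy))
          (trans (cong (λ c → κ * dy + dx * c) on) (solve 2 (λ a b → a :+ b :* con 0ℤ := a) refl (κ * dy) dx)))
      by-sign : ∀ κ → dx * (ux - xx) + dy * (uy - xy) ≡ κ → Obstructs (proj₁ ray₁) x u ⊎ Obstructs (proj₁ ray₂) x u
      by-sign (+ zero) eq = contradiction (subst (_∈ M) (cong₂ _,_ (same ux xx dx (proj₁ (decompose _ eq))) (same uy xy dy (proj₂ (decompose _ eq)))) x∈M) u∉M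
        where
        same : ∀ a b d → g * (a - b) ≡ 0ℤ * d → b ≡ a
        same a b d eq = sym (i-j≡0⇒i≡j a b (*-cancel-0 g 0<g eq))
      by-sign (+ suc k) eq = inj₁ (proj₂ (proj₂ ray₁) (suc k) u (ℕ.s≤s ℕ.z≤n) (decompose _ eq) u∉M)
      by-sign -[1+ k ] eq = inj₂ (proj₂ (proj₂ ray₂) (suc k) u (ℕ.s≤s ℕ.z≤n)
        (trans (proj₁ (decompose _ eq)) (flip (+ suc k) dx) , trans (proj₂ (decompose _ eq)) (flip (+ suc k) dy)) u∉M)
        where
        flip : ∀ k d → (- k) * d ≡ k * (- d)
        flip = solve 2 (λ k d → (:- k) :* d := k :* (:- d)) refl

  sum-of-squares>0 : ∀ a b → (a ≡ 0ℤ → b ≡ 0ℤ → ⊥) → 0ℤ < a * a + b * b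
  sum-of-squares>0 a b nonzero = ℤₚ.≤∧≢⇒< (0≤+ (0≤i*i a) (0≤i*i b)) λ eq → nonzero
      (square≡0 a (a²≡0 (sym eq))) (square≡0 b (trans (sym (ℤₚ.+-identityˡ (b * b))) (trans (cong (_+ b * b) (sym (a²≡0 (sym eq)))) (sym eq))))
    where
    square≡0 : ∀ i → i * i ≡ 0ℤ → i ≡ 0ℤ
    square≡0 i eq = reduce (ℤₚ.i*j≡0⇒i≡0∨j≡0 i eq)
    a²≡0 : a * a + b * b ≡ 0ℤ → a * a ≡ 0ℤ
    a²≡0 eq = ℤₚ.≤-antisym (subst (a * a ≤_) eq (subst (_≤ a * a + b * b) (ℤₚ.+-identityʳ (a * a)) (ℤₚ.+-monoʳ-≤ (a * a) (0≤i*i b)))) (0≤i*i a)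

  cross-from : ∀ z x u → cross z x u ≡ (proj₁ x - proj₁ z) * (proj₂ u - proj₂ x) - (proj₂ x - proj₂ z) * (proj₁ u - proj₁ x)
  cross-from (zx , zy) (xx , xy) (ux , uy) = solve 6 (λ zx zy xx xy ux uy →
    crossₑ (zx , zy) (xx , xy) (ux , uy) := (xx :- zx) :* (uy :- xy) :- (xy :- zy) :* (ux :- xx)) refl zx zy xx xy ux uy
    where open Data.Integer.Solver.+-*-Solver

  kill : ∀ M z x → x ∈ M → z ≢ x → ∃[ K ] (length K ≡ 2 × All (_∉ M) K × (∀ {B} → All (_∈ B) K → Dead M B z x))
  kill M z x x∈M z≢x = along (proj₁ x - proj₁ z) (proj₂ x - proj₂ z) refl refl
    where
    along : ∀ dx dy → proj₁ x - proj₁ z ≡ dx → proj₂ x - proj₂ z ≡ dy →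
      ∃[ K ] (length K ≡ 2 × All (_∉ M) K × (∀ {B} → All (_∈ B) K → Dead M B z x))
    along dx dy dx≡ dy≡ = finish (close-line M x dx dy (dx * dx + dy * dy) x∈M (sum-of-squares>0 dx dy nonzero) refl)
      where
      nonzero : dx ≡ 0ℤ → dy ≡ 0ℤ → ⊥
      nonzero dx≡0 dy≡0 = z≢x (sym (cong₂ _,_ (i-j≡0⇒i≡j (proj₁ x) (proj₁ z) (trans dx≡ dx≡0)) (i-j≡0⇒i≡j (proj₂ x) (proj₂ z) (trans dy≡ dy≡0))))
      on-line : ∀ u → cross z x u ≡ 0ℤ → dx * (proj₂ u - proj₂ x) - dy * (proj₁ u - proj₁ x) ≡ 0ℤ
      on-line u on = trans (sym (trans (cross-from z x u) (cong₂ (λ a b → a * (proj₂ u - proj₂ x) - b * (proj₁ u - proj₁ x)) dx≡ dy≡))) on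
      finish : (∃[ β₁ ] ∃[ β₂ ] (β₁ ∉ M × β₂ ∉ M × (∀ u → u ∉ M →
        dx * (proj₂ u - proj₂ x) - dy * (proj₁ u - proj₁ x) ≡ 0ℤ → Obstructs β₁ x u ⊎ Obstructs β₂ x u))) →
        ∃[ K ] (length K ≡ 2 × All (_∉ M) K × (∀ {B} → All (_∈ B) K → Dead M B z x))
      finish (β₁ , β₂ , β₁∉ , β₂∉ , closed) = β₁ ∷ β₂ ∷ [] , refl , β₁∉ ∷ β₂∉ ∷ [] , dead
        where
        dead : ∀ {B} → All (_∈ B) (β₁ ∷ β₂ ∷ []) → Dead M B z x
        dead (β₁∈ ∷ β₂∈ ∷ []) u on u∉M = [ (λ obs → β₁ , β₁∈ , obs) , (λ obs → β₂ , β₂∈ , obs) ]′ (closed u u∉M (on-line u on))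

  on-segment : ∀ N a c {s₁ s₂ β} → lin N a < lin N c → cross a c s₁ ≡ 0ℤ → cross a c s₂ ≡ 0ℤ → cross a c β ≡ 0ℤ →
    lin N s₁ ≤ lin N β → lin N β ≤ lin N s₂ → OnSegment β s₁ s₂
  on-segment N a c {s₁} {s₂} {β} a<c on₁ on₂ onβ le₁ le₂ = collinear-trans N a c s₁ s₂ β a<c on₁ on₂ onβ ,
    ℤₚ.neg-cancel-≤ (0≤*⁻ (F * F) (0<* 0<F 0<F) (subst (0ℤ ≤_) (sym eq)
      (0≤* (0≤* (0≤- le₁) (0≤- le₂)) (0≤+ (0≤i*i Dx) (0≤i*i Dy)))))
    where
    open Data.Integer.Solver.+-*-Solver
    f : Point → ℤ
    f = lin N
    F Dx Dy : ℤ
    F = f c - f a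
    Dx = proj₁ c - proj₁ a
    Dy = proj₂ c - proj₂ a
    0<F : 0ℤ < F
    0<F = 0<- a<c
    x-dif : ∀ {s} → cross a c s ≡ 0ℤ → F * (proj₁ s - proj₁ β) ≡ (f s - f β) * Dx
    x-dif {s} on = begin
      F * (proj₁ s - proj₁ β)
        ≡⟨ solve 4 (λ F s b a → F :* (s :- b) := F :* (s :- a) :- F :* (b :- a)) refl F (proj₁ s) (proj₁ β) (proj₁ a) ⟩
      F * (proj₁ s - proj₁ a) - F * (proj₁ β - proj₁ a)
        ≡⟨ cong₂ _-_ (trans (lin-x N a c s) (cong (λ z → (f s - f a) * Dx - z) on)) (trans (lin-x N a c β) (cong (λ z → (f β - f a) * Dx - z) onβ)) ⟩
      ((f s - f a) * Dx - 0ℤ) - ((f β - f a) * Dx - 0ℤ)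
        ≡⟨ solve 4 (λ s b a d → ((s :- a) :* d :- con 0ℤ) :- ((b :- a) :* d :- con 0ℤ) := (s :- b) :* d) refl (f s) (f β) (f a) Dx ⟩
      (f s - f β) * Dx ∎
      where open ≡-Reasoning
    y-dif : ∀ {s} → cross a c s ≡ 0ℤ → F * (proj₂ s - proj₂ β) ≡ (f s - f β) * Dy
    y-dif {s} on = begin
      F * (proj₂ s - proj₂ β)
        ≡⟨ solve 4 (λ F s b a → F :* (s :- b) := F :* (s :- a) :- F :* (b :- a)) refl F (proj₂ s) (proj₂ β) (proj₂ a) ⟩
      F * (proj₂ s - proj₂ a) - F * (proj₂ β - proj₂ a)
        ≡⟨ cong₂ _-_ (trans (lin-y N a c s) (cong (λ z → (f s - f a) * Dy + N * z) on)) (trans (lin-y N a c β) (cong (λ z → (f β - f a) * Dy + N * z) onβ)) ⟩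
      ((f s - f a) * Dy + N * 0ℤ) - ((f β - f a) * Dy + N * 0ℤ)
        ≡⟨ solve 5 (λ s b a d N → ((s :- a) :* d :+ N :* con 0ℤ) :- ((b :- a) :* d :+ N :* con 0ℤ) := (s :- b) :* d) refl (f s) (f β) (f a) Dy N ⟩
      (f s - f β) * Dy ∎
      where open ≡-Reasoning
    X₁ X₂ Y₁ Y₂ : ℤ
    X₁ = proj₁ s₁ - proj₁ β
    X₂ = proj₁ s₂ - proj₁ β
    Y₁ = proj₂ s₁ - proj₂ β
    Y₂ = proj₂ s₂ - proj₂ β
    eq : F * F * (- dot β s₁ s₂) ≡ (f β - f s₁) * (f s₂ - f β) * (Dx * Dx + Dy * Dy)
    eq = begin
      F * F * (- (X₁ * X₂ + Y₁ * Y₂))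
        ≡⟨ solve 5 (λ F a b c d → F :* F :* (:- (a :* b :+ c :* d)) := :- ((F :* a) :* (F :* b) :+ (F :* c) :* (F :* d))) refl F X₁ X₂ Y₁ Y₂ ⟩
      - ((F * X₁) * (F * X₂) + (F * Y₁) * (F * Y₂))
        ≡⟨ cong -_ (cong₂ _+_ (cong₂ _*_ (x-dif on₁) (x-dif on₂)) (cong₂ _*_ (y-dif on₁) (y-dif on₂))) ⟩
      - (((f s₁ - f β) * Dx) * ((f s₂ - f β) * Dx) + ((f s₁ - f β) * Dy) * ((f s₂ - f β) * Dy))
        ≡⟨ solve 5 (λ s t b d e → :- (((s :- b) :* d) :* ((t :- b) :* d) :+ ((s :- b) :* e) :* ((t :- b) :* e)) :=
             (b :- s) :* (t :- b) :* (d :* d :+ e :* e)) refl (f s₁) (f s₂) (f β) Dx Dy ⟩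
      (f β - f s₁) * (f s₂ - f β) * (Dx * Dx + Dy * Dy) ∎
      where open ≡-Reasoning

  module _ {β y u} (obs : Obstructs β y u) where
    open Obstructs obs
    open Data.Integer.Solver.+-*-Solver

    obstructs-lin : ∀ N → l * (lin N β - lin N y) ≡ k * (lin N u - lin N y)
    obstructs-lin N = begin
      l * (lin N β - lin N y)
        ≡⟨ expand l (proj₁ β) (proj₂ β) ⟩
      N * (l * (proj₁ β - proj₁ y)) + l * (proj₂ β - proj₂ y)
        ≡⟨ cong₂ (λ v w → N * v + w) x-coord y-coord ⟩
      N * (k * (proj₁ u - proj₁ y)) + k * (proj₂ u - proj₂ y)
        ≡⟨ expand k (proj₁ u) (proj₂ u) ⟨
      k * (lin N u - lin N y) ∎
      where
      open ≡-Reasoning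
      expand : ∀ m v w → m * ((N * v + w) - (N * proj₁ y + proj₂ y)) ≡ N * (m * (v - proj₁ y)) + m * (w - proj₂ y)
      expand m v w = solve 6 (λ N m v w a b → m :* ((N :* v :+ w) :- (N :* a :+ b)) := N :* (m :* (v :- a)) :+ m :* (w :- b)) refl
        N m v w (proj₁ y) (proj₂ y)

    obstructs-lin′ : ∀ N → l * (lin N u - lin N β) ≡ (l - k) * (lin N u - lin N y)
    obstructs-lin′ N = begin
      l * (lin N u - lin N β)
        ≡⟨ solve 4 (λ l u b y → l :* (u :- b) := l :* (u :- y) :- l :* (b :- y)) refl l (lin N u) (lin N β) (lin N y) ⟩
      l * (lin N u - lin N y) - l * (lin N β - lin N y)
        ≡⟨ cong (λ v → l * (lin N u - lin N y) - v) (obstructs-lin N) ⟩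
      l * (lin N u - lin N y) - k * (lin N u - lin N y)
        ≡⟨ solve 3 (λ l k d → l :* d :- k :* d := (l :- k) :* d) refl l k (lin N u - lin N y) ⟩
      (l - k) * (lin N u - lin N y) ∎
      where open ≡-Reasoning

    obstructs-on : ∀ a c → cross a c y ≡ 0ℤ → cross a c u ≡ 0ℤ → cross a c β ≡ 0ℤ
    obstructs-on a@(ax , ay) c@(cx , cy) on-y on-u = *-cancel-0 l 0<l (begin
      l * cross a c β
        ≡⟨ expand l (proj₁ β) (proj₂ β) ⟩
      l * cross a c y + ((cx - ax) * (l * (proj₂ β - proj₂ y)) - (cy - ay) * (l * (proj₁ β - proj₁ y)))
        ≡⟨ cong₂ _+_ (trans (cong (l *_) on-y) (ℤₚ.*-zeroʳ l)) (cong₂ (λ v w → (cx - ax) * w - (cy - ay) * v) x-coord y-coord) ⟩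
      0ℤ + ((cx - ax) * (k * (proj₂ u - proj₂ y)) - (cy - ay) * (k * (proj₁ u - proj₁ y)))
        ≡⟨ cong (_+ ((cx - ax) * (k * (proj₂ u - proj₂ y)) - (cy - ay) * (k * (proj₁ u - proj₁ y))))
             (trans (cong (k *_) on-y) (ℤₚ.*-zeroʳ k)) ⟨
      k * cross a c y + ((cx - ax) * (k * (proj₂ u - proj₂ y)) - (cy - ay) * (k * (proj₁ u - proj₁ y)))
        ≡⟨ expand k (proj₁ u) (proj₂ u) ⟨
      k * cross a c u ≡⟨ trans (cong (k *_) on-u) (ℤₚ.*-zeroʳ k) ⟩
      0ℤ ∎)
      where
      open ≡-Reasoning
      expand : ∀ m v w → m * cross a c (v , w) ≡
        m * cross a c y + ((cx - ax) * (m * (w - proj₂ y)) - (cy - ay) * (m * (v - proj₁ y)))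
      expand m v w = solve 9 (λ m v w yx yy ax ay cx cy → m :* crossₑ (ax , ay) (cx , cy) (v , w) :=
        m :* crossₑ (ax , ay) (cx , cy) (yx , yy) :+ ((cx :- ax) :* (m :* (w :- yy)) :- (cy :- ay) :* (m :* (v :- yx)))) refl
        m v w (proj₁ y) (proj₂ y) ax ay cx cy

  -- A segment with a point outside M cannot extend across a dead point.
  barrier : ∀ {M B S} N a c u y y′ → Collinear S → (∀ {p} → p ∈ B → ¬ Between p S) →
    a ∈ S → c ∈ S → u ∈ S → u ∉ M → lin N a < lin N c → lin N a ≤ lin N y → lin N y ≤ lin N c →
    cross a c y ≡ 0ℤ → cross y′ y u ≡ 0ℤ → Dead M B y′ y → ⊥
  barrier {M} {B} {S} N a c u y y′ col open-S a∈ c∈ u∈ u∉M a<c a≤y y≤c on-y on-u dead with dead u on-u u∉M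
  ... | β , β∈ , obs = [ rightwards , leftwards ]′ (ℤₚ.≤-total (f y) (f u))
    where
    open Obstructs obs
    f : Point → ℤ
    f = lin N
    on-β : cross a c β ≡ 0ℤ
    on-β = obstructs-on obs a c on-y (col a∈ c∈ u∈)
    flip : ∀ m v w → m * (v - w) ≡ - (m * (w - v))
    flip = solve 3 (λ m v w → m :* (v :- w) := :- (m :* (w :- v))) refl
      where open Data.Integer.Solver.+-*-Solver
    rightwards : f y ≤ f u → ⊥
    rightwards y≤u = open-S β∈ (a , u , a∈ , u∈ , on-segment N a c {a} {u} {β} a<c (col a∈ c∈ a∈) (col a∈ c∈ u∈) on-β
      (ℤₚ.≤-trans a≤y (ℤₚ.0≤i-j⇒j≤i (0≤*⁻ l 0<l (subst (0ℤ ≤_) (sym (obstructs-lin obs N)) (0≤* 0≤k (0≤- y≤u))))))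
      (ℤₚ.0≤i-j⇒j≤i (0≤*⁻ l 0<l (subst (0ℤ ≤_) (sym (obstructs-lin′ obs N)) (0≤* (0≤- k≤l) (0≤- y≤u))))))
    leftwards : f u ≤ f y → ⊥
    leftwards u≤y = open-S β∈ (u , c , u∈ , c∈ , on-segment N a c {u} {c} {β} a<c (col a∈ c∈ u∈) (col a∈ c∈ c∈) on-β
      (ℤₚ.0≤i-j⇒j≤i (0≤*⁻ l 0<l (subst (0ℤ ≤_) (sym (trans (flip l (f β) (f u)) (trans (cong -_ (obstructs-lin′ obs N)) (sym (flip (l - k) (f y) (f u))))))
        (0≤* (0≤- k≤l) (0≤- u≤y)))))
      (ℤₚ.≤-trans (ℤₚ.0≤i-j⇒j≤i (0≤*⁻ l 0<l (subst (0ℤ ≤_) (sym (trans (flip l (f y) (f β)) (trans (cong -_ (obstructs-lin obs N)) (sym (flip k (f y) (f u))))))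
        (0≤* 0≤k (0≤- u≤y))))) y≤c))

  -- Serves the most recent turns, where two old points on a segment that gains u must already be
  -- impossible. The line is spanned by x and y, so a slope that separates these two suffices.
  barrier-pair : ∀ {M B S} u x y → Collinear S → (∀ {p} → p ∈ B → ¬ Between p S) →
    x ∈ S → y ∈ S → u ∈ S → u ∉ M → x ≢ y → Dead M B y x → ⊥
  barrier-pair u x y col open-S x∈ y∈ u∈ u∉M x≢y dead with ℤₚ.<-cmp (f x) (f y)
    where
    f : Point → ℤ
    f = lin (slope (x ∷ y ∷ []))
  ... | tri< x<y _ _ = barrier (slope (x ∷ y ∷ [])) x y u x y col open-S x∈ y∈ u∈ u∉M x<y ℤₚ.≤-refl (ℤₚ.<⇒≤ x<y) (col x∈ y∈ x∈) (col y∈ x∈ u∈) dead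
  ... | tri≈ _ eq _ = x≢y (slope-injective (x ∷ y ∷ []) (here refl) (there (here refl)) eq)
  ... | tri> _ _ y<x = barrier (slope (x ∷ y ∷ [])) y x u x y col open-S y∈ x∈ u∈ u∉M y<x (ℤₚ.<⇒≤ y<x) ℤₚ.≤-refl (col y∈ x∈ x∈) (col y∈ x∈ u∈) dead

  module _ {M B S P : List Point} {ρ : ℕ} (1≤ρ : 1 ℕ.≤ ρ) (uniqueP : Unique P) (uniqueS : Unique S) (col : Collinear S)
    (open-S : ∀ {p} → p ∈ B → ¬ Between p S) {u : Point} (u∈ : u ∈ S) (u∉M : u ∉ M)
    (dead : ∀ {z x} → (z , x) ∈ richSegments P ρ → Dead M B z x × Dead M B x z) where

    private
      f : Point → ℤ
      f = lin (slope P)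

      Q : List Point
      Q = filter (_∈? P) S

      f-injective : ∀ {v w} → v ∈ P → w ∈ P → f v ≡ f w → v ≡ w
      f-injective = slope-injective P

      Q⁻ : ∀ {v} → v ∈ Q → v ∈ S × v ∈ P
      Q⁻ = ∈-filter⁻ (_∈? P) {xs = S}

      segment⁻ : ∀ a c {w} → w ∈ segment P ρ a c → w ∈ P × InSegment P ρ a c w
      segment⁻ a c = ∈-filter⁻ (inSegment? P ρ a c) {xs = P}

      unique-segment : ∀ a c → Unique (segment P ρ a c)
      unique-segment a c = Uniqueₚ.filter⁺ (inSegment? P ρ a c) uniqueP

      module TooMany (many : suc ρ ℕ.≤ length Q) (a c₀ : Point) (a∈Q : a ∈ Q) (c₀∈Q : c₀ ∈ Q)
        (a-min : ∀ {v} → v ∈ Q → f a ≤ f v) (c₀-max : ∀ {v} → v ∈ Q → f v ≤ f c₀) where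

        a∈ : a ∈ P
        a∈ = proj₂ (Q⁻ a∈Q)

        on : ∀ {w} → w ∈ S → cross a c₀ w ≡ 0ℤ
        on = col (proj₁ (Q⁻ a∈Q)) (proj₁ (Q⁻ c₀∈Q))

        a<c₀ : f a < f c₀
        a<c₀ = [ (λ lt → lt) , [ (λ eq → contradiction (all-equal eq) λ { (ℕ.s≤s ()) })
                               , (λ gt → contradiction (c₀-max a∈Q) (ℤₚ.<⇒≱ gt)) ]′ ]′ (order (f a) (f c₀))
          where
          all-equal : f a ≡ f c₀ → 2 ℕ.≤ 1
          all-equal eq = ℕₚ.≤-trans (ℕ.s≤s 1≤ρ) (ℕₚ.≤-trans many
            (unique-⊆⇒length≤ {ys = a ∷ []} (Uniqueₚ.filter⁺ (_∈? P) uniqueS) λ {w} w∈ → here (f-injective (proj₂ (Q⁻ w∈)) a∈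
              (ℤₚ.≤-antisym (ℤₚ.≤-trans (c₀-max w∈) (ℤₚ.≤-reflexive (sym eq))) (a-min w∈)))))

        Long : Point → Set
        Long c = cross a c₀ c ≡ 0ℤ × (f a < f c × suc ρ ℕ.≤ length (segment P ρ a c))

        long? : ∀ c → Dec (Long c)
        long? c = (_ ℤₚ.≟ _) ×-dec ((_ <? _) ×-dec (_ ℕₚ.≤? _))

        c₀-long : c₀ ∈ filter long? P
        c₀-long = ∈-filter⁺ long? (proj₂ (Q⁻ c₀∈Q)) (cross-abb a c₀ , a<c₀ , ℕₚ.≤-trans many
          (unique-⊆⇒length≤ (Uniqueₚ.filter⁺ (_∈? P) uniqueS) λ w∈ → ∈-filter⁺ (inSegment? P ρ a c₀) (proj₂ (Q⁻ w∈))
            (on (proj₁ (Q⁻ w∈)) , a-min w∈ , c₀-max w∈)))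

        module Shortest (c : Point) (c-long : c ∈ filter long? P) (c-min : ∀ {w} → w ∈ filter long? P → f c ≤ f w) where

          c∈ : c ∈ P
          c∈ = proj₁ (∈-filter⁻ long? {xs = P} c-long)
          c-on : cross a c₀ c ≡ 0ℤ
          c-on = proj₁ (proj₂ (∈-filter⁻ long? {xs = P} c-long))
          a<c : f a < f c
          a<c = proj₁ (proj₂ (proj₂ (∈-filter⁻ long? {xs = P} c-long)))
          long : suc ρ ℕ.≤ length (segment P ρ a c)
          long = proj₂ (proj₂ (proj₂ (∈-filter⁻ long? {xs = P} c-long)))

          to-line : ∀ w → cross a c w ≡ 0ℤ → cross a c₀ w ≡ 0ℤ
          to-line w = collinear-trans (slope P) a c a c₀ w a<c (cross-aba a c) (trans (cross-swap a c₀ c) (cong -_ c-on))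

          from-line : ∀ w → cross a c₀ w ≡ 0ℤ → cross a c w ≡ 0ℤ
          from-line w = collinear-trans (slope P) a c₀ a c w a<c₀ (cross-aba a c₀) c-on

          Inner : Point → Set
          Inner w = cross a c w ≡ 0ℤ × (f a < f w × f w < f c)

          inner? : ∀ w → Dec (Inner w)
          inner? w = (_ ℤₚ.≟ _) ×-dec ((_ <? _) ×-dec (_ <? _))

          place : ∀ {w} → w ∈ P → InSegment P ρ a c w → w ≡ a ⊎ w ≡ c ⊎ Inner w
          place {w} w∈P (w-on , a≤w , w≤c) = by (order (f a) (f w)) (order (f w) (f c))
            where
            by : f a < f w ⊎ f a ≡ f w ⊎ f w < f a → f w < f c ⊎ f w ≡ f c ⊎ f c < f w → w ≡ a ⊎ w ≡ c ⊎ Inner w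
            by (inj₂ (inj₁ eq)) _                = inj₁ (f-injective w∈P a∈ (sym eq))
            by (inj₂ (inj₂ gt)) _                = contradiction a≤w (ℤₚ.<⇒≱ gt)
            by (inj₁ _)   (inj₂ (inj₁ eq))       = inj₂ (inj₁ (f-injective w∈P c∈ eq))
            by (inj₁ _)   (inj₂ (inj₂ gt))       = contradiction w≤c (ℤₚ.<⇒≱ gt)
            by (inj₁ a<w) (inj₁ w<c)             = inj₂ (inj₂ (w-on , a<w , w<c))

          ends-or-inner : ∀ {w} → w ∈ segment P ρ a c → w ∈ a ∷ c ∷ filter inner? P
          ends-or-inner {w} w∈ = [ here , [ there ∘ here , there ∘ there ∘ ∈-filter⁺ inner? (proj₁ (segment⁻ a c w∈)) ]′ ]′
            (place (proj₁ (segment⁻ a c w∈)) (proj₂ (segment⁻ a c w∈)))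

          -- Otherwise dropping c would leave a shorter segment that is still long enough.
          exact : length (segment P ρ a c) ≡ suc ρ
          exact = ℕₚ.≤-antisym (ℕₚ.≮⇒≥ too-long) long
            where
            too-long : suc ρ ℕ.< length (segment P ρ a c) → ⊥
            too-long lt = shorten (maxBy f (proj₂ (nonempty 1≤inner)))
              where
              1≤inner : 1 ℕ.≤ length (filter inner? P)
              1≤inner = ℕₚ.≤-trans 1≤ρ (ℕ.s≤s⁻¹ (ℕ.s≤s⁻¹ (ℕₚ.≤-trans lt (unique-⊆⇒length≤ (unique-segment a c) ends-or-inner))))
              shorten : ∃[ c′ ] (c′ ∈ filter inner? P × (∀ {w} → w ∈ filter inner? P → f w ≤ f c′)) → ⊥
              shorten (c′ , c′∈I , c′-max) = ℤₚ.<⇒≱ c′<c (c-min (∈-filter⁺ long? c′∈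
                (to-line c′ c′-on , a<c′ , ℕ.s≤s⁻¹ (ℕₚ.≤-trans lt (unique-⊆⇒length≤ (unique-segment a c) sub)))))
                where
                c′-spec : c′ ∈ P × Inner c′
                c′-spec = ∈-filter⁻ inner? {xs = P} c′∈I
                c′∈ = proj₁ c′-spec
                c′-on = proj₁ (proj₂ c′-spec)
                a<c′ = proj₁ (proj₂ (proj₂ c′-spec))
                c′<c = proj₂ (proj₂ (proj₂ c′-spec))
                in-shorter : ∀ {w} → w ∈ P → cross a c w ≡ 0ℤ → f a ≤ f w → f w ≤ f c′ → w ∈ c ∷ segment P ρ a c′
                in-shorter {w} w∈P w-on a≤w w≤c′ = there (∈-filter⁺ (inSegment? P ρ a c′) w∈P
                  (collinear-trans (slope P) a c a c′ w a<c (cross-aba a c) c′-on w-on , a≤w , w≤c′))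
                sub : ∀ {w} → w ∈ segment P ρ a c → w ∈ c ∷ segment P ρ a c′
                sub {w} w∈ = by (segment⁻ a c w∈)
                  where
                  by : w ∈ P × InSegment P ρ a c w → w ∈ c ∷ segment P ρ a c′
                  by (w∈P , ins@(w-on , a≤w , _)) =
                    [ (λ w≡a → in-shorter w∈P w-on a≤w (ℤₚ.≤-trans (ℤₚ.≤-reflexive (cong f w≡a)) (ℤₚ.<⇒≤ a<c′)))
                    , [ here , (λ inner → in-shorter w∈P w-on a≤w (c′-max (∈-filter⁺ inner? w∈P inner))) ]′ ]′ (place w∈P ins)

          blocked-at : ∀ y y′ → cross a c y ≡ 0ℤ → cross a c y′ ≡ 0ℤ → f a ≤ f y → f y ≤ f c → Dead M B y′ y → ⊥
          blocked-at y y′ y-on y′-on a≤y y≤c = barrier (slope P) a c₀ u y y′ col open-S (proj₁ (Q⁻ a∈Q)) (proj₁ (Q⁻ c₀∈Q)) u∈ u∉M a<c₀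
            a≤y (ℤₚ.≤-trans y≤c (c-min c₀-long)) (to-line y y-on)
            (collinear-trans (slope P) a c y′ y u a<c y′-on y-on (from-line u (on u∈)))

          impossible : ⊥
          impossible = by (richSegments-maximal P ρ a∈ c∈ (a<c , exact))
            where
            by : ∃[ j ] (j ∈ richSegments P ρ × Overlap P ρ (a , c) j) → ⊥
            by ((z , x) , j∈ , (_ , (z-on , x-on)) , (a≤x , z≤c)) =
              [ (λ x≤c → blocked-at x z x-on z-on a≤x x≤c (proj₁ (dead j∈)))
              , (λ c<x → [ (λ a≤z → blocked-at z x z-on x-on a≤z z≤c (proj₂ (dead j∈)))
                         , (λ z<a → nested c<x z<a (richSegments⁻ P ρ j∈)) ]′ (split (f a) (f z))) ]′ (split (f x) (f c))
              where
              split : ∀ i j → i ≤ j ⊎ j < i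
              split i j = [ inj₁ ∘ ℤₚ.<⇒≤ , [ inj₁ ∘ ℤₚ.≤-reflexive , inj₂ ]′ ]′ (order i j)
              -- Here zx contains all suc ρ points of ac and x besides, more than a rich segment
              -- has.
              nested : f c < f x → f z < f a → z ∈ P × x ∈ P × Rich P ρ (z , x) → ⊥
              nested c<x z<a (z∈ , x∈ , z<x , len) = ℕₚ.<-irrefl refl (ℕₚ.≤-trans (ℕ.s≤s (ℕₚ.≤-reflexive (sym exact)))
                (ℕₚ.≤-trans (unique-⊆⇒length≤ (All.tabulate x∉ ∷ unique-segment a c) sub) (ℕₚ.≤-reflexive len)))
                where
                x∉ : ∀ {w} → w ∈ segment P ρ a c → x ≢ w
                x∉ w∈ refl = ℤₚ.<⇒≱ c<x (proj₂ (proj₂ (proj₂ (segment⁻ a c w∈))))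
                sub : ∀ {w} → w ∈ x ∷ segment P ρ a c → w ∈ segment P ρ z x
                sub (here refl) = ∈-filter⁺ (inSegment? P ρ z x) x∈ (cross-abb z x , ℤₚ.<⇒≤ z<x , ℤₚ.≤-refl)
                sub {w} (there w∈) = inside (segment⁻ a c w∈)
                  where
                  inside : w ∈ P × InSegment P ρ a c w → w ∈ segment P ρ z x
                  inside (w∈P , w-on , a≤w , w≤c) = ∈-filter⁺ (inSegment? P ρ z x) w∈P
                    (collinear-trans (slope P) a c z x w a<c z-on x-on w-on ,
                     ℤₚ.≤-trans (ℤₚ.<⇒≤ z<a) a≤w , ℤₚ.≤-trans w≤c (ℤₚ.<⇒≤ c<x))

    -- Otherwise let a be the leftmost point of S in P and c the first point of P on the line such
    -- that ac carries suc ρ points of P; by minimality it carries exactly that many. By maximality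
    -- of the family ac overlaps some chosen zx on the same line. As both carry equally many points,
    -- zx cannot reach beyond ac on both sides, so z or x lies within ac and thus within the span of
    -- S. This end point is dead, and S cannot have gained u across it.
    dead⇒count≤ : count S P ℕ.≤ ρ
    dead⇒count≤ = ℕₚ.≮⇒≥ λ many → by many (nonempty (ℕₚ.≤-trans (ℕ.s≤s ℕ.z≤n) many))
      where
      by : suc ρ ℕ.≤ length Q → ∃[ q ] (q ∈ Q) → ⊥
      by many (q , q∈) =
        let a , a∈Q , a-min = minBy f q∈
            c₀ , c₀∈Q , c₀-max = maxBy f q∈
            c , c-long , c-min = minBy f (TooMany.c₀-long many a c₀ a∈Q c₀∈Q a-min c₀-max)
        in TooMany.Shortest.impossible many a c₀ a∈Q c₀∈Q a-min c₀-max c c-long c-min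

open Blocking

open import Data.Nat using (zero; suc; _+_; _*_; _^_; _∸_; _⊓_; _≤_; _<_; z≤n; s≤s; s≤s⁻¹; NonZero; >-nonZero; _≤?_)
open import Data.Nat.DivMod using (_/_; _%_; m/n*n≤m; m≡m%n+[m/n]*n; m%n<n; m≥n⇒m/n>0; m<n⇒m/n≡0; m/n/o≡m/[n*o]; [m+kn]%n≡m%n; m<n⇒m%n≡m; m*n/n≡m; n/1≡n; +-distrib-/-∣ʳ; /-monoˡ-≤; /-monoʳ-≤; m<n*o⇒m/o<n; /-congʳ)
open import Data.Nat.Divisibility using (divides)

-- Maker's moves turn by turn, and counts over blocks of turns

module History where
  open Count _≟ₚ_

  -- Total in the turn. Breaker's requests after turn u depend only on the values up to u
  -- (`requests-cong`), so a history can be extended turn by turn without disturbing what has been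
  -- achieved.
  History : Set
  History = ℕ → List Point

  -- Maker's points from the turns a, …, a + s - 1.
  played : History → ℕ → ℕ → List Point
  played H a zero    = []
  played H a (suc s) = H a ++ played H (suc a) s

  played-cong : ∀ {H H′} a s → (∀ v → a ≤ v → v < a + s → H v ≡ H′ v) → played H a s ≡ played H′ a s
  played-cong a zero eq = refl
  played-cong a (suc s) eq = cong₂ _++_ (eq a ℕₚ.≤-refl (ℕₚ.m<m+n a (s≤s z≤n)))
    (played-cong (suc a) s λ v a<v v< → eq v (ℕₚ.<⇒≤ a<v) (ℕₚ.<-≤-trans v< (ℕₚ.≤-reflexive (sym (ℕₚ.+-suc a s)))))

  ∈-played⁺ : ∀ H a s {v p} → a ≤ v → v < a + s → p ∈ H v → p ∈ played H a s
  ∈-played⁺ H a zero a≤v v< p∈ = contradiction (subst (_ <_) (ℕₚ.+-identityʳ a) v<) (ℕₚ.≤⇒≯ a≤v)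
  ∈-played⁺ H a (suc s) {v} a≤v v< p∈ with ℕₚ.m≤n⇒m<n∨m≡n a≤v
  ... | inj₁ a<v  = ∈-++⁺ʳ (H a) (∈-played⁺ H (suc a) s a<v (subst (v <_) (ℕₚ.+-suc a s) v<) p∈)
  ... | inj₂ refl = ∈-++⁺ˡ p∈

  ∈-played⁻ : ∀ H a s {p} → p ∈ played H a s → ∃[ v ] (a ≤ v × v < a + s × p ∈ H v)
  ∈-played⁻ H a (suc s) p∈ with ∈-++⁻ (H a) p∈
  ... | inj₁ p∈a = a , ℕₚ.≤-refl , ℕₚ.m<m+n a (s≤s z≤n) , p∈a
  ... | inj₂ p∈′ with ∈-played⁻ H (suc a) s p∈′
  ... | v , a<v , v< , p∈v = v , ℕₚ.<⇒≤ a<v , subst (v <_) (sym (ℕₚ.+-suc a s)) v< , p∈v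

  played-++ : ∀ H a s s′ → played H a (s + s′) ≡ played H a s ++ played H (a + s) s′
  played-++ H a zero s′ = cong (λ z → played H z s′) (sym (ℕₚ.+-identityʳ a))
  played-++ H a (suc s) s′ = trans (cong (H a ++_) (trans (played-++ H (suc a) s s′)
    (cong (λ z → played H (suc a) s ++ played H z s′) (sym (ℕₚ.+-suc a s))))) (sym (++-assoc (H a) _ _))

  length-played : ∀ H a s k → (∀ v → a ≤ v → v < a + s → length (H v) ≤ k) → length (played H a s) ≤ s * k
  length-played H a zero k bound = z≤n
  length-played H a (suc s) k bound = ℕₚ.≤-trans (ℕₚ.≤-reflexive (length-++ (H a)))
    (ℕₚ.+-mono-≤ (bound a ℕₚ.≤-refl (ℕₚ.m<m+n a (s≤s z≤n)))
      (length-played H (suc a) s k λ v a<v v< → bound v (ℕₚ.<⇒≤ a<v) (subst (v <_) (sym (ℕₚ.+-suc a s)) v<)))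

  record Proper (H : History) : Set where
    field
      unique   : ∀ v → Unique (H v)
      disjoint : ∀ {v w p} → p ∈ H v → p ∈ H w → v ≡ w

  unique-played : ∀ {H} → Proper H → ∀ a s → Unique (played H a s)
  unique-played proper a zero = []
  unique-played {H} proper a (suc s) = Uniqueₚ.++⁺ (Proper.unique proper a) (unique-played proper (suc a) s)
    λ (p∈a , p∈) → let v , a<v , _ , p∈v = ∈-played⁻ H (suc a) s p∈ in ℕₚ.<⇒≢ a<v (Proper.disjoint proper p∈a p∈v)

  module _ {S : List Point} (uniqueS : Unique S) where

    count-played : ∀ H a s s′ → count S (played H a (s + s′)) ≤ count S (played H a s) + count S (played H (a + s) s′)
    count-played H a s s′ = ℕₚ.≤-trans (ℕₚ.≤-reflexive (cong (count S) (played-++ H a s s′))) (count-++ _ _ uniqueS)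

    count-blocks : ∀ H i s y w k → (∀ e → e < y → count S (played H ((i + e) * s) s) * w ≤ k) →
      count S (played H (i * s) (y * s)) * w ≤ y * k
    count-blocks H i s zero w k bound =
      ℕₚ.≤-reflexive (cong (_* w) (ℕₚ.n≤0⇒n≡0 (count≤length [] uniqueS)))
    count-blocks H i s (suc y) w k bound = begin
      count S (played H (i * s) (s + y * s)) * w
        ≤⟨ ℕₚ.*-monoˡ-≤ w (count-played H (i * s) s (y * s)) ⟩
      (count S (played H (i * s) s) + count S (played H (i * s + s) (y * s))) * w
        ≡⟨ ℕₚ.*-distribʳ-+ w (count S (played H (i * s) s)) _ ⟩
      count S (played H (i * s) s) * w + count S (played H (i * s + s) (y * s)) * w
        ≡⟨ cong₂ (λ a b → count S (played H (a * s) s) * w + count S (played H b (y * s)) * w) (sym (ℕₚ.+-identityʳ i)) (ℕₚ.+-comm (i * s) s) ⟩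
      count S (played H ((i + 0) * s) s) * w + count S (played H (suc i * s) (y * s)) * w
        ≤⟨ ℕₚ.+-mono-≤ (bound 0 (s≤s z≤n)) (count-blocks H (suc i) s y w k λ e e<y →
             subst (λ z → count S (played H (z * s) s) * w ≤ k) (ℕₚ.+-suc i e) (bound (suc e) (s≤s e<y))) ⟩
      k + y * k ∎
      where open ℕₚ.≤-Reasoning

    count≤1 : ∀ Q → (∀ {x y} → x ∈ S → y ∈ S → x ∈ Q → y ∈ Q → x ≢ y → ⊥) → count S Q ≤ 1
    count≤1 Q no-two = go (filter (_∈? Q) S) (Uniqueₚ.filter⁺ (_∈? Q) uniqueS) (∈-filter⁻ (_∈? Q) {xs = S})
      where
      go : ∀ xs → Unique xs → (∀ {x} → x ∈ xs → x ∈ S × x ∈ Q) → length xs ≤ 1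
      go [] _ _ = z≤n
      go (x ∷ []) _ _ = s≤s z≤n
      go (x ∷ y ∷ xs) ((x≢y ∷ _) ∷ _) spec =
        let x∈S , x∈Q = spec (here refl) ; y∈S , y∈Q = spec (there (here refl)) in ⊥-elim (no-two x∈S y∈S x∈Q y∈Q x≢y)

  ∈-chunk : ∀ {A : Set} {x : A} c k xs → x ∈ xs → length xs ≤ k * c → ∃[ r ] (r < k × x ∈ take c (drop (r * c) xs))
  ∈-chunk c zero (x ∷ xs) x∈ ()
  ∈-chunk {x = x} c (suc k) xs x∈ len with ∈-++⁻ (take c xs) (subst (x ∈_) (sym (take++drop≡id c xs)) x∈)
  ... | inj₁ x∈take = 0 , s≤s z≤n , x∈take
  ... | inj₂ x∈drop with ∈-chunk c k (drop c xs) x∈drop (begin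
      length (drop c xs)    ≡⟨ length-drop c xs ⟩
      length xs ∸ c         ≤⟨ ℕₚ.∸-monoˡ-≤ c len ⟩
      c + k * c ∸ c         ≡⟨ ℕₚ.m+n∸m≡n c (k * c) ⟩
      k * c                 ∎)
    where open ℕₚ.≤-Reasoning
  ... | r , r<k , x∈r = suc r , s≤s r<k , subst (λ z → x ∈ take c z) (drop-drop c (r * c) xs) x∈r

open History

-- Integer logarithms

module Logarithm (B : ℕ) (2≤B : 2 ≤ B) where

  instance
    B≢0 : NonZero B
    B≢0 = >-nonZero (ℕₚ.<-≤-trans (s≤s z≤n) 2≤B)

  1≤B^ : ∀ l → 1 ≤ B ^ l
  1≤B^ l = ℕₚ.m^n>0 B l

  private
    logUpTo : ℕ → ℕ → ℕ
    logUpTo zero u = 0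
    logUpTo (suc k) u with B ^ suc k ≤? u
    ... | yes _ = suc k
    ... | no  _ = logUpTo k u

    logUpTo-lower : ∀ k {u} → 1 ≤ u → B ^ logUpTo k u ≤ u
    logUpTo-lower zero 1≤u = 1≤u
    logUpTo-lower (suc k) {u} 1≤u with B ^ suc k ≤? u
    ... | yes le = le
    ... | no  _  = logUpTo-lower k 1≤u

    logUpTo-upper : ∀ k {u} → u < B ^ suc k → u < B ^ suc (logUpTo k u)
    logUpTo-upper zero lt = lt
    logUpTo-upper (suc k) {u} lt with B ^ suc k ≤? u
    ... | yes _  = lt
    ... | no nle = logUpTo-upper k (ℕₚ.≰⇒> nle)

    u<B^u : ∀ u → u < B ^ u
    u<B^u zero = s≤s z≤n
    u<B^u (suc u) = begin-strict
      suc u             ≤⟨ u<B^u u ⟩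
      B ^ u             <⟨ ℕₚ.m<m+n (B ^ u) (1≤B^ u) ⟩
      B ^ u + B ^ u     ≡⟨ cong (B ^ u +_) (ℕₚ.+-identityʳ (B ^ u)) ⟨
      2 * B ^ u         ≤⟨ ℕₚ.*-monoˡ-≤ (B ^ u) 2≤B ⟩
      B * B ^ u         ∎
      where open ℕₚ.≤-Reasoning

  abstract
    log : ℕ → ℕ
    log u = logUpTo u u

    log-lower : ∀ {u} → 1 ≤ u → B ^ log u ≤ u
    log-lower {u} = logUpTo-lower u

    log-upper : ∀ u → u < B ^ suc (log u)
    log-upper u = logUpTo-upper u (ℕₚ.<-≤-trans (u<B^u u) (ℕₚ.^-monoʳ-≤ B (ℕₚ.n≤1+n u)))

  B^-cancel-< : ∀ {k l} → B ^ k < B ^ l → k < l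
  B^-cancel-< {k} {l} lt = ℕₚ.≰⇒> λ l≤k → ℕₚ.<⇒≱ lt (ℕₚ.^-monoʳ-≤ B l≤k)

  ≤log : ∀ {k u} → B ^ k ≤ u → k ≤ log u
  ≤log {k} {u} le = s≤s⁻¹ (B^-cancel-< (ℕₚ.≤-<-trans le (log-upper u)))

  log≤ : ∀ {k u} → 1 ≤ u → u < B ^ suc k → log u ≤ k
  log≤ 1≤u lt = s≤s⁻¹ (B^-cancel-< (ℕₚ.≤-<-trans (log-lower 1≤u) lt))

  log-mono : ∀ {u v} → 1 ≤ u → u ≤ v → log u ≤ log v
  log-mono 1≤u u≤v = ≤log (ℕₚ.≤-trans (log-lower 1≤u) u≤v)

  log≤self : ∀ u → 1 ≤ u → log u ≤ u
  log≤self u 1≤u = ℕₚ.≤-trans (ℕₚ.<⇒≤ (u<B^u (log u))) (log-lower 1≤u)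

-- Which points Breaker wants to block after each turn

module Strategy (B n′ J : ℕ) (2≤B : 2 ≤ B) where
  open Count _≟ₚ_

  open Logarithm B 2≤B public

  private
    B^l≢0 : ∀ l → NonZero (B ^ l)
    B^l≢0 l = ℕₚ.m^n≢0 B l

  infixl 7 _/ᴮ_ _%ᴮ_

  _/ᴮ_ _%ᴮ_ : ℕ → ℕ → ℕ
  m /ᴮ l = _/_ m (B ^ l) {{B^l≢0 l}}
  m %ᴮ l = _%_ m (B ^ l) {{B^l≢0 l}}

  /ᴮ*≤ : ∀ m l → m /ᴮ l * B ^ l ≤ m
  /ᴮ*≤ m l = m/n*n≤m m (B ^ l) {{B^l≢0 l}}

  %ᴮ+/ᴮ* : ∀ m l → m ≡ m %ᴮ l + m /ᴮ l * B ^ l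
  %ᴮ+/ᴮ* m l = m≡m%n+[m/n]*n m (B ^ l) {{B^l≢0 l}}

  %ᴮ< : ∀ m l → m %ᴮ l < B ^ l
  %ᴮ< m l = m%n<n m (B ^ l) {{B^l≢0 l}}

  /ᴮ>0 : ∀ {m l} → B ^ l ≤ m → 1 ≤ m /ᴮ l
  /ᴮ>0 {m} {l} = m≥n⇒m/n>0 {m} {B ^ l} {{B^l≢0 l}}

  ≤/ᴮ : ∀ {k m} l → k * B ^ l ≤ m → k ≤ m /ᴮ l
  ≤/ᴮ {k} {m} l le = subst (_≤ m /ᴮ l) (m*n/n≡m k (B ^ l) {{B^l≢0 l}}) (/-monoˡ-≤ (B ^ l) {{B^l≢0 l}} le)

  /ᴮ< : ∀ {m k} l → m < k * B ^ l → m /ᴮ l < k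
  /ᴮ< {m} {k} l = m<n*o⇒m/o<n {m} {k} {B ^ l} {{B^l≢0 l}}

  [k*+r]/ᴮ : ∀ k r l → r < B ^ l → (k * B ^ l + r) /ᴮ l ≡ k
  [k*+r]/ᴮ k r l r< = begin
    (k * B ^ l + r) /ᴮ l          ≡⟨ cong (_/ᴮ l) (ℕₚ.+-comm (k * B ^ l) r) ⟩
    (r + k * B ^ l) /ᴮ l          ≡⟨ +-distrib-/-∣ʳ r {{B^l≢0 l}} (divides k refl) ⟩
    r /ᴮ l + k * B ^ l /ᴮ l       ≡⟨ cong₂ _+_ (m<n⇒m/n≡0 {{B^l≢0 l}} r<) (m*n/n≡m k (B ^ l) {{B^l≢0 l}}) ⟩
    k                             ∎
    where open ≡-Reasoning

  [k*+r]%ᴮ : ∀ k r l → r < B ^ l → (k * B ^ l + r) %ᴮ l ≡ r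
  [k*+r]%ᴮ k r l r< = trans (cong (_%ᴮ l) (ℕₚ.+-comm (k * B ^ l) r))
    (trans ([m+kn]%n≡m%n r k (B ^ l) {{B^l≢0 l}}) (m<n⇒m%n≡m {{B^l≢0 l}} r<))

  /ᴮ-suc : ∀ m l → m /ᴮ l / B ≡ m /ᴮ suc l
  /ᴮ-suc m l = trans (m/n/o≡m/[n*o] m (B ^ l) B {{B^l≢0 l}} {{B≢0}} {{B^l*B≢0}})
    (/-congʳ {{B^l*B≢0}} {{B^l≢0 (suc l)}} (ℕₚ.*-comm (B ^ l) B))
    where
    B^l*B≢0 : NonZero (B ^ l * B)
    B^l*B≢0 = ℕₚ.m*n≢0 (B ^ l) B {{B^l≢0 l}}

  -- Number of points that a segment may have in a block at depth j.
  allowance : ℕ → ℕ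
  allowance j = _/_ n′ (2 ^ j) {{ℕₚ.m^n≢0 2 j}}

  allowance*≤ : ∀ j → allowance j * 2 ^ j ≤ n′
  allowance*≤ j = m/n*n≤m n′ (2 ^ j) {{ℕₚ.m^n≢0 2 j}}

  1≤allowance : ∀ j → 2 ^ j ≤ n′ → 1 ≤ allowance j
  1≤allowance j = m≥n⇒m/n>0 {n′} {2 ^ j} {{ℕₚ.m^n≢0 2 j}}

  ≤allowance : ∀ {k} j → k * 2 ^ j ≤ n′ → k ≤ allowance j
  ≤allowance {k} j le = subst (_≤ allowance j) (m*n/n≡m k (2 ^ j) {{ℕₚ.m^n≢0 2 j}}) (/-monoˡ-≤ (2 ^ j) {{ℕₚ.m^n≢0 2 j}} le)

  n′<allowance : ∀ j → n′ < suc (allowance j) * 2 ^ j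
  n′<allowance j = begin-strict
    n′                                              ≡⟨ m≡m%n+[m/n]*n n′ (2 ^ j) {{ℕₚ.m^n≢0 2 j}} ⟩
    _%_ n′ (2 ^ j) {{ℕₚ.m^n≢0 2 j}} + allowance j * 2 ^ j  <⟨ ℕₚ.+-monoˡ-< _ (m%n<n n′ (2 ^ j) {{ℕₚ.m^n≢0 2 j}}) ⟩
    suc (allowance j) * 2 ^ j                       ∎
    where open ℕₚ.≤-Reasoning

  -- After turn u Breaker works, at each level l, on the last complete block of B ^ l turns;
  -- a block is processed in equal chunks while the next block of the same level is played.
  block : History → ℕ → ℕ → List Point
  block H l i = played H (i * B ^ l) (B ^ l)

  jobs : History → ℕ → ℕ → ℕ → List (Point × Point)
  jobs H l i j = richSegments (block H l i) (allowance j)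

  -- Rounded up, so that B ^ l chunks exhaust the job list. In `chunk` the quotient of suc u by B ^
  -- l finds the last complete block and the remainder is the index of the chunk, so the turns of
  -- the next block run through all chunks.
  chunkSize : History → ℕ → ℕ → ℕ → ℕ
  chunkSize H l i j = suc (length (jobs H l i j) /ᴮ l)

  chunk : History → ℕ → ℕ → List (Point × Point)
  chunk H u l = take c (drop ((suc u %ᴮ l) * c) (jobs H l i j))
    where
    i j c : ℕ
    i = suc u /ᴮ l ∸ 1
    j = log (suc u) ∸ l
    c = chunkSize H l i j

  chunks : History → ℕ → ℕ → List (Point × Point)
  chunks H u zero    = []
  chunks H u (suc k) = chunk H u (log (suc u) ∸ k) ++ chunks H u k

  -- At depths beyond J the allowance would drop below one point; there every two
  -- points played within the last few turns are separated at once.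
  window : ℕ → ℕ
  window u = suc u ∸ 2 * B ^ (suc (log (suc u)) ∸ J)

  window≤ : ∀ u → window u ≤ suc u
  window≤ u = ℕₚ.m∸n≤m (suc u) (2 * B ^ (suc (log (suc u)) ∸ J))

  pairs : History → ℕ → List (Point × Point)
  pairs H u with J ≤? log (suc u)
  ... | no  _ = []
  ... | yes _ = filter (λ (y , x) → ¬? (y ≟ₚ x)) (cartesianProduct (played H (window u) (suc u ∸ window u)) (H u))

  bothEnds : List (Point × Point) → List (Point × Point)
  bothEnds []             = []
  bothEnds ((z , x) ∷ js) = (z , x) ∷ (x , z) ∷ bothEnds js

  requests : History → ℕ → List (Point × Point)
  requests H u = bothEnds (chunks H u (suc (J ⊓ log (suc u)))) ++ pairs H u

  ∈-bothEnds⁺ : ∀ {z x} js → (z , x) ∈ js → (z , x) ∈ bothEnds js × (x , z) ∈ bothEnds js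
  ∈-bothEnds⁺ (_ ∷ js) (here refl) = here refl , there (here refl)
  ∈-bothEnds⁺ (_ ∷ js) (there j∈) = let p , q = ∈-bothEnds⁺ js j∈ in there (there p) , there (there q)

  ∈-bothEnds⁻ : ∀ {z x} js → (z , x) ∈ bothEnds js → (z , x) ∈ js ⊎ (x , z) ∈ js
  ∈-bothEnds⁻ (_ ∷ js) (here refl) = inj₁ (here refl)
  ∈-bothEnds⁻ (_ ∷ js) (there (here refl)) = inj₂ (here refl)
  ∈-bothEnds⁻ (_ ∷ js) (there (there j∈)) = [ inj₁ ∘ there , inj₂ ∘ there ]′ (∈-bothEnds⁻ js j∈)

  length-bothEnds : ∀ js → length (bothEnds js) ≡ 2 * length js
  length-bothEnds [] = refl
  length-bothEnds (_ ∷ js) = trans (cong (λ z → suc (suc z)) (length-bothEnds js)) (sym (ℕₚ.*-suc 2 (length js)))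

  block-past : ∀ u l → l ≤ log (suc u) → (suc u /ᴮ l ∸ 1) * B ^ l + B ^ l ≤ suc u
  block-past u l l≤ = begin
    (suc u /ᴮ l ∸ 1) * B ^ l + B ^ l     ≡⟨ ℕₚ.+-comm _ (B ^ l) ⟩
    suc (suc u /ᴮ l ∸ 1) * B ^ l         ≡⟨ cong (_* B ^ l) (ℕₚ.m+[n∸m]≡n 1≤q) ⟩
    suc u /ᴮ l * B ^ l                   ≤⟨ /ᴮ*≤ (suc u) l ⟩
    suc u                                   ∎
    where
    open ℕₚ.≤-Reasoning
    1≤q : 1 ≤ suc u /ᴮ l
    1≤q = /ᴮ>0 {l = l} (ℕₚ.≤-trans (ℕₚ.^-monoʳ-≤ B l≤) (log-lower (s≤s z≤n)))

  module _ {H H′ : History} (u : ℕ) (agree : ∀ v → v ≤ u → H v ≡ H′ v) where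

    private
      chunk-cong : ∀ l → l ≤ log (suc u) → chunk H u l ≡ chunk H′ u l
      chunk-cong l l≤ = cong (λ P → let js = richSegments P (allowance (log (suc u) ∸ l)) ; c = suc (length js /ᴮ l) in
          take c (drop ((suc u %ᴮ l) * c) js))
        (played-cong _ (B ^ l) λ v _ v< → agree v (s≤s⁻¹ (ℕₚ.<-≤-trans v< (block-past u l l≤))))

      chunks-cong : ∀ k → chunks H u k ≡ chunks H′ u k
      chunks-cong zero = refl
      chunks-cong (suc k) = cong₂ _++_ (chunk-cong _ (ℕₚ.m∸n≤m (log (suc u)) k)) (chunks-cong k)

      pairs-cong : pairs H u ≡ pairs H′ u
      pairs-cong with J ≤? log (suc u)
      ... | no _ = refl
      ... | yes _ = cong₂ (λ P Q → filter (λ (y , x) → ¬? (y ≟ₚ x)) (cartesianProduct P Q))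
            (played-cong (window u) (suc u ∸ window u) λ v _ v< → agree v (s≤s⁻¹ (ℕₚ.<-≤-trans v< (ℕₚ.≤-reflexive (ℕₚ.m+[n∸m]≡n (window≤ u)))))) (agree u ℕₚ.≤-refl)

    requests-cong : requests H u ≡ requests H′ u
    requests-cong = cong₂ (λ js ps → bothEnds js ++ ps) (chunks-cong (suc (J ⊓ log (suc u)))) pairs-cong

  take-⊆ : ∀ {A : Set} {x : A} c d (xs : List A) → x ∈ take c (drop d xs) → x ∈ xs
  take-⊆ {x = x} c d xs x∈ = subst (x ∈_) (take++drop≡id d xs) (∈-++⁺ʳ (take d xs)
    (subst (x ∈_) (take++drop≡id c (drop d xs)) (∈-++⁺ˡ x∈)))

  chunk⊆jobs : ∀ H u l {j} → j ∈ chunk H u l → j ∈ jobs H l (suc u /ᴮ l ∸ 1) (log (suc u) ∸ l)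
  chunk⊆jobs H u l = take-⊆ c (suc u %ᴮ l * c) (jobs H l (suc u /ᴮ l ∸ 1) (log (suc u) ∸ l))
    where
    c : ℕ
    c = chunkSize H l (suc u /ᴮ l ∸ 1) (log (suc u) ∸ l)

  pairs⁻ : ∀ H u {z x} → (z , x) ∈ pairs H u → z ≢ x × x ∈ H u
  pairs⁻ H u r∈ with J ≤? log (suc u)
  ... | yes _ =
    let P = played H (window u) (suc u ∸ window u)
        c∈ , z≢x = ∈-filter⁻ (λ (y , x) → ¬? (y ≟ₚ x)) {xs = cartesianProduct P (H u)} r∈
    in z≢x , proj₂ (∈-cartesianProduct⁻ P (H u) c∈)

  chunks⁻ : ∀ H u k {z x} → (z , x) ∈ chunks H u k → ∃[ l ] (l ≤ log (suc u) × (z , x) ∈ chunk H u l)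
  chunks⁻ H u (suc k) j∈ = [ (λ j∈c → _ , ℕₚ.m∸n≤m (log (suc u)) k , j∈c) , chunks⁻ H u k ]′
    (∈-++⁻ (chunk H u (log (suc u) ∸ k)) j∈)

  requests⁻ : ∀ H u {z x} → (z , x) ∈ requests H u → z ≢ x × ∃[ v ] (v ≤ u × x ∈ H v)
  requests⁻ H u {z} {x} r∈ = [ [ (λ j∈ → let z≢x , _ , x-past = from-chunks j∈ in z≢x , x-past)
                               , (λ j∈ → let x≢z , x-past , _ = from-chunks j∈ in x≢z ∘ sym , x-past) ]′ ∘ ∈-bothEnds⁻ _
                             , (λ r∈pairs → let z≢x , x∈ = pairs⁻ H u r∈pairs in z≢x , u , ℕₚ.≤-refl , x∈) ]′
      (∈-++⁻ (bothEnds (chunks H u (suc (J ⊓ log (suc u))))) r∈)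
    where
    Past : Point → Set
    Past p = ∃[ v ] (v ≤ u × p ∈ H v)
    from-block : ∀ l → l ≤ log (suc u) → ∀ {p} → p ∈ block H l (suc u /ᴮ l ∸ 1) → Past p
    from-block l l≤ p∈ = let v , _ , v< , p∈v = ∈-played⁻ H _ (B ^ l) p∈ in v , s≤s⁻¹ (ℕₚ.<-≤-trans v< (block-past u l l≤)) , p∈v
    from-chunks : ∀ {z x} → (z , x) ∈ chunks H u (suc (J ⊓ log (suc u))) → z ≢ x × Past z × Past x
    from-chunks {z} {x} j∈ =
      let l , l≤ , j∈c = chunks⁻ H u (suc (J ⊓ log (suc u))) j∈
          z∈ , x∈ , (z<x , _) = richSegments⁻ (block H l (suc u /ᴮ l ∸ 1)) (allowance (log (suc u) ∸ l)) (chunk⊆jobs H u l j∈c)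
      in (λ { refl → ℤₚ.<-irrefl refl z<x }) , from-block l l≤ z∈ , from-block l l≤ x∈

-- How many old points a segment that still grows can have

module Cover (B n′ J : ℕ) (2≤B : 2 ≤ B) (1≤J : 1 ≤ J) (2^J≤n′ : 2 ^ J ≤ n′) where
  open Strategy B n′ J 2≤B
  open Count _≟ₚ_

  private
    length≤chunks : ∀ len l → len ≤ B ^ l * suc (len /ᴮ l)
    length≤chunks len l = begin
      len                                         ≡⟨ %ᴮ+/ᴮ* len l ⟩
      len %ᴮ l + len /ᴮ l * B ^ l           ≤⟨ ℕₚ.+-monoˡ-≤ _ (ℕₚ.<⇒≤ (%ᴮ< len l)) ⟩
      B ^ l + len /ᴮ l * B ^ l                 ≡⟨ ℕₚ.*-comm (suc (len /ᴮ l)) (B ^ l) ⟩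
      B ^ l * suc (len /ᴮ l)                   ∎
      where open ℕₚ.≤-Reasoning

  module _ {H : History} {M Br S : List Point} {u₀ : Point} (proper : Proper H) (uniqueS : Unique S) (col : Collinear S)
    (open-S : ∀ {p} → p ∈ Br → ¬ Between p S) (u₀∈ : u₀ ∈ S) (u₀∉M : u₀ ∉ M) (t : ℕ)
    (done : ∀ v → v < t → ∀ {z x} → (z , x) ∈ requests H v → Dead M Br z x) where

    private
      level : ℕ → ℕ → ℕ
      level l i = log (suc i * B ^ l) ∸ l

      1≤si*B^ : ∀ i l → 1 ≤ suc i * B ^ l
      1≤si*B^ i l = ℕₚ.≤-trans (1≤B^ l) (ℕₚ.m≤m+n (B ^ l) (i * B ^ l))
      -- The next power of B is a multiple of B ^ l, so the logarithm cannot change inside a block.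
      -- Hence all chunks of a block are cut from one job list, with one depth and one allowance.
      log-constant : ∀ l i r → r < B ^ l → log (suc i * B ^ l + r) ≡ log (suc i * B ^ l)
      log-constant l i r r< = ℕₚ.≤-antisym
        (log≤ (ℕₚ.≤-trans (1≤si*B^ i l) (ℕₚ.m≤m+n _ r)) (begin-strict
          suc i * B ^ l + r              <⟨ ℕₚ.+-monoʳ-< (suc i * B ^ l) r< ⟩
          suc i * B ^ l + B ^ l          ≡⟨ ℕₚ.+-comm (suc i * B ^ l) (B ^ l) ⟩
          suc (suc i) * B ^ l            ≤⟨ ℕₚ.*-monoˡ-≤ (B ^ l) (ℕₚ.*-cancelʳ-< (B ^ l) (suc i) (B ^ (suc Λ ∸ l))
                                              (subst (suc i * B ^ l <_) split (log-upper (suc i * B ^ l)))) ⟩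
          B ^ (suc Λ ∸ l) * B ^ l        ≡⟨ split ⟨
          B ^ suc Λ                      ∎))
        (log-mono (1≤si*B^ i l) (ℕₚ.m≤m+n _ r))
        where
        open ℕₚ.≤-Reasoning
        Λ : ℕ
        Λ = log (suc i * B ^ l)
        l≤Λ : l ≤ Λ
        l≤Λ = ≤log (ℕₚ.m≤m+n (B ^ l) (i * B ^ l))
        split : B ^ suc Λ ≡ B ^ (suc Λ ∸ l) * B ^ l
        split = trans (cong (B ^_) (sym (ℕₚ.m∸n+n≡m (ℕₚ.m≤n⇒m≤1+n l≤Λ)))) (ℕₚ.^-distribˡ-+-* B (suc Λ ∸ l) l)

      ∈-chunks⁺ : ∀ v k j {p} → j < k → p ∈ chunk H v (log (suc v) ∸ j) → p ∈ chunks H v k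
      ∈-chunks⁺ v (suc k) j {p} j<k p∈ with ℕₚ.m≤n⇒m<n∨m≡n (s≤s⁻¹ j<k)
      ... | inj₁ j<k′ = ∈-++⁺ʳ (chunk H v (log (suc v) ∸ k)) (∈-chunks⁺ v k j j<k′ p∈)
      ... | inj₂ refl = ∈-++⁺ˡ p∈

      allowance≥1 : ∀ j → j ≤ J → 1 ≤ allowance j
      allowance≥1 j j≤J = 1≤allowance j (ℕₚ.≤-trans (ℕₚ.^-monoʳ-≤ 2 j≤J) 2^J≤n′)

      block-dead : ∀ l i → suc (suc i) * B ^ l ≤ suc t → level l i ≤ J →
        ∀ {z x} → (z , x) ∈ jobs H l i (level l i) → Dead M Br z x × Dead M Br x z
      block-dead l i finished j≤J {z} {x} j∈
        with ∈-chunk (chunkSize H l i (level l i)) (B ^ l) (jobs H l i (level l i)) j∈ (length≤chunks _ l)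
      ... | r , r< , j∈chunk = let e₁ , e₂ = ∈-bothEnds⁺ _ in-chunks in
            done v v<t (∈-++⁺ˡ e₁) , done v v<t (∈-++⁺ˡ e₂)
        where
        j v : ℕ
        j = level l i
        -- The turn at which block i is the last complete block and its chunk r is due.
        v = suc i * B ^ l + r ∸ 1
        suc-v : suc v ≡ suc i * B ^ l + r
        suc-v = ℕₚ.m+[n∸m]≡n (ℕₚ.≤-trans (1≤si*B^ i l) (ℕₚ.m≤m+n _ r))
        v<t : v < t
        v<t = s≤s⁻¹ (begin-strict
          suc v                    ≡⟨ suc-v ⟩
          suc i * B ^ l + r        <⟨ ℕₚ.+-monoʳ-< (suc i * B ^ l) r< ⟩
          suc i * B ^ l + B ^ l    ≡⟨ ℕₚ.+-comm (suc i * B ^ l) (B ^ l) ⟩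
          suc (suc i) * B ^ l      ≤⟨ finished ⟩
          suc t                    ∎)
          where open ℕₚ.≤-Reasoning
        log-v : log (suc v) ≡ log (suc i * B ^ l)
        log-v = trans (cong log suc-v) (log-constant l i r r<)
        chunkAt : ℕ → ℕ → ℕ → List (Point × Point)
        chunkAt q r Λ = take (chunkSize H l (q ∸ 1) (Λ ∸ l)) (drop (r * chunkSize H l (q ∸ 1) (Λ ∸ l)) (jobs H l (q ∸ 1) (Λ ∸ l)))
        chunk-v : chunk H v l ≡ chunkAt (suc i) r (log (suc i * B ^ l))
        chunk-v = trans (cong₂ (λ q r → chunkAt q r (log (suc v)))
            (trans (cong (_/ᴮ l) suc-v) ([k*+r]/ᴮ (suc i) r l r<)) (trans (cong (_%ᴮ l) suc-v) ([k*+r]%ᴮ (suc i) r l r<)))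
          (cong (chunkAt (suc i) r) log-v)
        l≡ : log (suc v) ∸ j ≡ l
        l≡ = trans (cong (_∸ j) log-v) (ℕₚ.m∸[m∸n]≡n (≤log (ℕₚ.m≤m+n (B ^ l) (i * B ^ l))))
        in-chunks : (z , x) ∈ chunks H v (suc (J ⊓ log (suc v)))
        in-chunks = ∈-chunks⁺ v _ j (s≤s (ℕₚ.⊓-glb j≤J (subst (j ≤_) (sym log-v) (ℕₚ.m∸n≤m _ l))))
          (subst (λ k → (z , x) ∈ chunk H v k) (sym l≡) (subst ((z , x) ∈_) (sym chunk-v) j∈chunk))

      block-count : ∀ l i j → suc (suc i) * B ^ l ≤ suc t → level l i ≤ J → j ≤ level l i → count S (block H l i) * 2 ^ j ≤ n′
      block-count l i j finished ≤J j≤ = begin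
        count S (block H l i) * 2 ^ j
          ≤⟨ ℕₚ.*-mono-≤ (dead⇒count≤ (allowance≥1 _ ≤J) (unique-played proper _ (B ^ l)) uniqueS col open-S u₀∈ u₀∉M
               (block-dead l i finished ≤J)) (ℕₚ.^-monoʳ-≤ 2 j≤) ⟩
        allowance (level l i) * 2 ^ level l i    ≤⟨ allowance*≤ (level l i) ⟩
        n′                                    ∎
        where open ℕₚ.≤-Reasoning

      Λ : ℕ
      Λ = log (suc t)

      q : ℕ → ℕ
      q l = suc t /ᴮ l

      -- One block less than the complete ones: the jobs of the last complete block are still being
      -- worked off.
      done-until : ℕ → ℕ
      done-until l = (q l ∸ 1) * B ^ l

      q≥ : ∀ l j → B ^ (j + l) ≤ suc t → B ^ j ≤ q l
      q≥ l j le = ≤/ᴮ l (subst (_≤ suc t) (ℕₚ.^-distribˡ-+-* B j l) le)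

      q*≤ : ∀ l → q l * B ^ l ≤ suc t
      q*≤ l = /ᴮ*≤ (suc t) l

      <q* : ∀ l → suc t < suc (q l) * B ^ l
      <q* l = begin-strict
        suc t                                       ≡⟨ %ᴮ+/ᴮ* (suc t) l ⟩
        suc t %ᴮ l + q l * B ^ l                 <⟨ ℕₚ.+-monoˡ-< (q l * B ^ l) (%ᴮ< (suc t) l) ⟩
        suc (q l) * B ^ l                           ∎
        where open ℕₚ.≤-Reasoning

      finished : ∀ l i → i < q l ∸ 1 → suc (suc i) * B ^ l ≤ suc t
      finished l i i< = ℕₚ.≤-trans (ℕₚ.*-monoˡ-≤ (B ^ l) (ℕₚ.≤-trans (s≤s i<) (ℕₚ.≤-reflexive (ℕₚ.m+[n∸m]≡n 1≤q)))) (q*≤ l)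
        where
        1≤q : 1 ≤ q l
        1≤q = ℕₚ.n≢0⇒n>0 λ eq → ℕₚ.n≮0 (subst (λ z → i < z ∸ 1) eq i<)

      level≤ : ∀ l i → i < q l ∸ 1 → level l i ≤ Λ ∸ l
      level≤ l i i< = ℕₚ.∸-monoˡ-≤ l (log-mono (1≤si*B^ i l)
        (ℕₚ.≤-trans (ℕₚ.*-monoˡ-≤ (B ^ l) (ℕₚ.n≤1+n (suc i))) (finished l i i<)))

      X : ℕ
      X = 4 * B * n′

      cover-top : count S (played H 0 (done-until Λ)) ≤ X
      cover-top = begin
        count S (played H 0 (done-until Λ))                ≡⟨ ℕₚ.*-identityʳ _ ⟨
        count S (played H 0 ((q Λ ∸ 1) * B ^ Λ)) * 1       ≤⟨ count-blocks uniqueS H 0 (B ^ Λ) (q Λ ∸ 1) 1 n′ (λ e e< →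
             block-count Λ e 0 (finished Λ e e<) (ℕₚ.≤-trans (level≤ Λ e e<) (ℕₚ.≤-trans (ℕₚ.≤-reflexive (ℕₚ.n∸n≡0 Λ)) z≤n)) z≤n) ⟩
        (q Λ ∸ 1) * n′                                     ≤⟨ ℕₚ.*-monoˡ-≤ n′ (ℕₚ.≤-trans (ℕₚ.m∸n≤m (q Λ) 1) (ℕₚ.≤-trans qΛ≤B (ℕₚ.m≤m+n B (3 * B)))) ⟩
        X                                                  ∎
        where
        open ℕₚ.≤-Reasoning
        qΛ≤B : q Λ ≤ B
        qΛ≤B = ℕₚ.<⇒≤ (/ᴮ< Λ (log-upper (suc t)))

      module Step (l j : ℕ) (eq : suc j + l ≡ Λ) (j<J : suc j ≤ J) where
        Q i₀ y : ℕ
        Q = q (suc l)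
        i₀ = (Q ∸ 1) * B
        y = (q l ∸ 1) ∸ i₀

        B^Λ≤ : B ^ (suc j + l) ≤ suc t
        B^Λ≤ = subst (λ k → B ^ k ≤ suc t) (sym eq) (log-lower (s≤s z≤n))

        B^j≤Q : B ^ j ≤ Q
        B^j≤Q = q≥ (suc l) j (subst (λ k → B ^ k ≤ suc t) (sym (ℕₚ.+-suc j l)) B^Λ≤)

        1≤Q : 1 ≤ Q
        1≤Q = ℕₚ.≤-trans (1≤B^ j) B^j≤Q

        q/B : q l / B ≡ Q
        q/B = /ᴮ-suc (suc t) l

        QB≤q : Q * B ≤ q l
        QB≤q = subst (λ z → z * B ≤ q l) q/B (m/n*n≤m (q l) B)

        q<QB+B : q l < B + Q * B
        q<QB+B = subst (λ z → q l < B + z * B) q/B (subst (_< B + q l / B * B) (sym (m≡m%n+[m/n]*n (q l) B)) (ℕₚ.+-monoˡ-< _ (m%n<n (q l) B)))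

        i₀+B : i₀ + B ≡ Q * B
        i₀+B = trans (ℕₚ.+-comm i₀ B) (cong (_* B) (ℕₚ.m+[n∸m]≡n 1≤Q))

        i₀≤ : i₀ ≤ q l ∸ 1
        i₀≤ = ℕₚ.m+n≤o⇒m≤o∸n i₀ (ℕₚ.≤-trans (ℕₚ.+-monoʳ-≤ i₀ (ℕₚ.≤-trans (s≤s z≤n) 2≤B)) (ℕₚ.≤-trans (ℕₚ.≤-reflexive i₀+B) QB≤q))

        i₀+y : i₀ + y ≡ q l ∸ 1
        i₀+y = ℕₚ.m+[n∸m]≡n i₀≤

        y≤2B : y ≤ 2 * B
        y≤2B = ℕₚ.+-cancelˡ-≤ i₀ y (2 * B) (begin
          i₀ + y             ≡⟨ i₀+y ⟩
          q l ∸ 1            ≤⟨ ℕₚ.m∸n≤m (q l) 1 ⟩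
          q l                ≤⟨ ℕₚ.<⇒≤ q<QB+B ⟩
          B + Q * B          ≡⟨ cong (B +_) i₀+B ⟨
          B + (i₀ + B)       ≡⟨ solve 2 (λ b i → b :+ (i :+ b) := i :+ con 2 :* b) refl B i₀ ⟩
          i₀ + 2 * B         ∎)
          where
          open ℕₚ.≤-Reasoning
          open Data.Nat.Solver.+-*-Solver

        Q≤si₀ : Q ≤ suc i₀
        Q≤si₀ = begin
          Q                  ≡⟨ ℕₚ.m+[n∸m]≡n 1≤Q ⟨
          suc (Q ∸ 1)        ≤⟨ s≤s (ℕₚ.m≤m*n (Q ∸ 1) B) ⟩
          suc i₀             ∎
          where open ℕₚ.≤-Reasoning

        -- The present depth of level l is suc j, but the logarithm may have been one smaller when
        -- these blocks were processed, so only depth j is guaranteed.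
        each : ∀ e → e < y → count S (block H l (i₀ + e)) * 2 ^ j ≤ n′
        each e e<y = block-count l (i₀ + e) j (finished l (i₀ + e) i<)
          (ℕₚ.≤-trans (level≤ l (i₀ + e) i<) (ℕₚ.≤-trans (ℕₚ.≤-reflexive (trans (cong (_∸ l) (sym eq)) (ℕₚ.m+n∸n≡m (suc j) l))) j<J))
          (ℕₚ.m+n≤o⇒m≤o∸n j (≤log (begin
            B ^ (j + l)                 ≡⟨ ℕₚ.^-distribˡ-+-* B j l ⟩
            B ^ j * B ^ l               ≤⟨ ℕₚ.*-monoˡ-≤ (B ^ l) (ℕₚ.≤-trans B^j≤Q (ℕₚ.≤-trans Q≤si₀ (s≤s (ℕₚ.m≤m+n i₀ e)))) ⟩
            suc (i₀ + e) * B ^ l        ∎)))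
          where
          open ℕₚ.≤-Reasoning
          i< : i₀ + e < q l ∸ 1
          i< = subst (i₀ + e <_) i₀+y (ℕₚ.+-monoʳ-< i₀ e<y)

        start≡ : i₀ * B ^ l ≡ done-until (suc l)
        start≡ = ℕₚ.*-assoc (Q ∸ 1) B (B ^ l)

        extend : done-until l ≡ done-until (suc l) + y * B ^ l
        extend = trans (cong (_* B ^ l) (sym i₀+y)) (trans (ℕₚ.*-distribʳ-+ (B ^ l) i₀ y) (cong (_+ y * B ^ l) start≡))

        step : count S (played H 0 (done-until (suc l))) * 2 ^ j + X ≤ 2 * X * 2 ^ j →
          count S (played H 0 (done-until l)) * 2 ^ suc j + X ≤ 2 * X * 2 ^ suc j
        step ih = begin
          count S (played H 0 (done-until l)) * 2 ^ suc j + X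
            ≡⟨ cong (λ z → count S (played H 0 z) * 2 ^ suc j + X) extend ⟩
          count S (played H 0 (done-until (suc l) + y * B ^ l)) * 2 ^ suc j + X
            ≤⟨ ℕₚ.+-monoˡ-≤ X (ℕₚ.*-monoˡ-≤ (2 ^ suc j) (count-played uniqueS H 0 (done-until (suc l)) (y * B ^ l))) ⟩
          (old + count S (played H (done-until (suc l)) (y * B ^ l))) * 2 ^ suc j + X
            ≡⟨ solve 4 (λ a b w x → (a :+ b) :* (con 2 :* w) :+ x := con 2 :* (a :* w) :+ con 2 :* (b :* w) :+ x) refl
                 old (count S (played H (done-until (suc l)) (y * B ^ l))) (2 ^ j) X ⟩
          2 * (old * 2 ^ j) + 2 * (count S (played H (done-until (suc l)) (y * B ^ l)) * 2 ^ j) + X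
            ≤⟨ ℕₚ.+-monoˡ-≤ X (ℕₚ.+-monoʳ-≤ (2 * (old * 2 ^ j)) (ℕₚ.*-monoʳ-≤ 2 new)) ⟩
          2 * (old * 2 ^ j) + 2 * (2 * B * n′) + X
            ≡⟨ solve 3 (λ a b n → con 2 :* a :+ con 2 :* (con 2 :* b :* n) :+ con 4 :* b :* n := con 2 :* (a :+ con 4 :* b :* n)) refl
                 (old * 2 ^ j) B n′ ⟩
          2 * (old * 2 ^ j + X)
            ≤⟨ ℕₚ.*-monoʳ-≤ 2 ih ⟩
          2 * (2 * X * 2 ^ j)
            ≡⟨ solve 2 (λ x w → con 2 :* (con 2 :* x :* w) := con 2 :* x :* (con 2 :* w)) refl X (2 ^ j) ⟩
          2 * X * 2 ^ suc j ∎
          where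
          open ℕₚ.≤-Reasoning
          open Data.Nat.Solver.+-*-Solver
          old : ℕ
          old = count S (played H 0 (done-until (suc l)))
          new : count S (played H (done-until (suc l)) (y * B ^ l)) * 2 ^ j ≤ 2 * B * n′
          new = subst (λ z → count S (played H z (y * B ^ l)) * 2 ^ j ≤ 2 * B * n′) start≡
            (ℕₚ.≤-trans (count-blocks uniqueS H i₀ (B ^ l) y (2 ^ j) n′ each) (ℕₚ.*-monoˡ-≤ n′ y≤2B))

      -- In fractions: the count is at most (2 - 1 / 2 ^ j) X, a partial sum of a geometric series.
      -- Passing from level suc l to level l adds at most 2B blocks with n′ / 2 ^ j points each,
      -- which is X / 2 ^ (j + 1) for X = 4Bn′.
      cover : ∀ j l → j + l ≡ Λ → j ≤ J → count S (played H 0 (done-until l)) * 2 ^ j + X ≤ 2 * X * 2 ^ j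
      cover zero l refl _ = begin
        count S (played H 0 (done-until Λ)) * 1 + X        ≡⟨ cong (_+ X) (ℕₚ.*-identityʳ _) ⟩
        count S (played H 0 (done-until Λ)) + X            ≤⟨ ℕₚ.+-monoˡ-≤ X cover-top ⟩
        X + X                                              ≡⟨ solve 1 (λ x → x :+ x := con 2 :* x :* con 1) refl X ⟩
        2 * X * 1                                          ∎
        where
        open ℕₚ.≤-Reasoning
        open Data.Nat.Solver.+-*-Solver
      cover (suc j) l eq j<J = Step.step l j eq j<J (cover j (suc l) (trans (ℕₚ.+-suc j l) eq) (ℕₚ.<⇒≤ j<J))

      covered≤ : ∀ j l → j + l ≡ Λ → j ≤ J → count S (played H 0 (done-until l)) ≤ 2 * X
      covered≤ j l eq j≤J = ℕₚ.*-cancelʳ-≤ _ _ (2 ^ j) {{ℕₚ.m^n≢0 2 j}} (ℕₚ.≤-trans (ℕₚ.m≤m+n _ X) (cover j l eq j≤J))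

      module Leftover (l : ℕ) (1≤l : 1 ≤ l) (eq : J + l ≡ Λ) where
        e : ℕ
        e = done-until l

        B^k<B^J : ∀ {k} → suc k ≡ J → B ^ k < B ^ J
        B^k<B^J {k} refl = begin-strict
          B ^ k           <⟨ ℕₚ.m<m+n (B ^ k) (1≤B^ k) ⟩
          B ^ k + B ^ k   ≡⟨ cong (B ^ k +_) (ℕₚ.+-identityʳ (B ^ k)) ⟨
          2 * B ^ k       ≤⟨ ℕₚ.*-monoˡ-≤ (B ^ k) 2≤B ⟩
          B ^ suc k       ∎
          where open ℕₚ.≤-Reasoning

        -- At least B ^ J blocks are complete, so e ≥ (B ^ J - 1) B ^ l ≥ B ^ (J - 1 + l), and the
        -- logarithm has grown by at most one since turn e. The successor of the logarithm in
        -- `window` compensates for this.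
        log≥ : ∀ w → e ≤ w → Λ ≤ suc (log (suc w))
        log≥ w e≤w = ℕₚ.≤-trans (ℕₚ.≤-reflexive (trans (sym eq) (cong (_+ l) (sym J≡)))) (s≤s (≤log (begin
          B ^ (k + l)                ≡⟨ ℕₚ.^-distribˡ-+-* B k l ⟩
          B ^ k * B ^ l              ≤⟨ ℕₚ.*-monoˡ-≤ (B ^ l) (ℕₚ.m+n≤o⇒m≤o∸n (B ^ k) (ℕₚ.≤-trans (ℕₚ.≤-reflexive (ℕₚ.+-comm (B ^ k) 1))
                                          (ℕₚ.≤-trans (B^k<B^J J≡) (q≥ l J (subst (λ z → B ^ z ≤ suc t) (sym eq) (log-lower (s≤s z≤n))))))) ⟩
          e                          ≤⟨ e≤w ⟩
          w                          ≤⟨ ℕₚ.n≤1+n w ⟩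
          suc w                      ∎)))
          where
          open ℕₚ.≤-Reasoning
          k : ℕ
          k = J ∸ 1
          J≡ : suc k ≡ J
          J≡ = ℕₚ.m+[n∸m]≡n 1≤J

        t≤e+ : t ≤ e + 2 * B ^ l
        t≤e+ = ℕₚ.≤-trans (ℕₚ.n≤1+n t) (begin
          suc t                          ≤⟨ ℕₚ.<⇒≤ (<q* l) ⟩
          suc (q l) * B ^ l              ≡⟨ cong (λ z → suc z * B ^ l) (ℕₚ.m+[n∸m]≡n 1≤q) ⟨
          suc (suc (q l ∸ 1)) * B ^ l    ≡⟨ solve 2 (λ a b → b :+ (b :+ a :* b) := a :* b :+ con 2 :* b) refl (q l ∸ 1) (B ^ l) ⟩
          e + 2 * B ^ l                  ∎)
          where
          open ℕₚ.≤-Reasoning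
          open Data.Nat.Solver.+-*-Solver
          1≤q : 1 ≤ q l
          1≤q = ℕₚ.≤-trans (1≤B^ J) (q≥ l J (subst (λ z → B ^ z ≤ suc t) (sym eq) (log-lower (s≤s z≤n))))

        pair-dead : ∀ {v w x y} → e ≤ v → v ≤ w → w < t → y ∈ H v → x ∈ H w → y ≢ x → Dead M Br y x
        pair-dead {v} {w} {x} {y} e≤v v≤w w<t y∈ x∈ y≢x = done w w<t (∈-++⁺ʳ (bothEnds (chunks H w (suc (J ⊓ log (suc w))))) in-pairs)
          where
          open ℕₚ.≤-Reasoning
          Λ≤ : Λ ≤ suc (log (suc w))
          Λ≤ = log≥ w (ℕₚ.≤-trans e≤v v≤w)
          J≤ : J ≤ log (suc w)
          J≤ = s≤s⁻¹ (ℕₚ.≤-trans (ℕₚ.≤-trans (ℕₚ.≤-reflexive (ℕₚ.+-comm 1 J)) (ℕₚ.+-monoʳ-≤ J 1≤l)) (ℕₚ.≤-trans (ℕₚ.≤-reflexive eq) Λ≤))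
          l≤ : l ≤ suc (log (suc w)) ∸ J
          l≤ = ℕₚ.m+n≤o⇒m≤o∸n l (ℕₚ.≤-trans (ℕₚ.≤-reflexive (trans (ℕₚ.+-comm l J) eq)) Λ≤)
          in-window : window w ≤ v
          in-window = ℕₚ.m≤n+o⇒m∸n≤o (suc w) (2 * B ^ (suc (log (suc w)) ∸ J)) (begin
            suc w                                        ≤⟨ w<t ⟩
            t                                            ≤⟨ t≤e+ ⟩
            e + 2 * B ^ l                                ≤⟨ ℕₚ.+-mono-≤ e≤v (ℕₚ.*-monoʳ-≤ 2 (ℕₚ.^-monoʳ-≤ B l≤)) ⟩
            v + 2 * B ^ (suc (log (suc w)) ∸ J)          ≡⟨ ℕₚ.+-comm v _ ⟩
            2 * B ^ (suc (log (suc w)) ∸ J) + v          ∎)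
          in-pairs : (y , x) ∈ pairs H w
          in-pairs with J ≤? log (suc w)
          ... | no J≰ = contradiction J≤ J≰
          ... | yes _ = ∈-filter⁺ (λ (y , x) → ¬? (y ≟ₚ x)) (∈-cartesianProduct⁺
                (∈-played⁺ H (window w) (suc w ∸ window w) in-window
                  (subst (v <_) (sym (ℕₚ.m+[n∸m]≡n (window≤ w))) (s≤s v≤w)) y∈) x∈) y≢x

        -- Of two such points, the later one was made dead along the line through the earlier one
        -- right after it was played.
        leftover : count S (played H e (t ∸ e)) ≤ 1
        leftover = count≤1 uniqueS _ λ {x} {y} x∈S y∈S x∈ y∈ x≢y →
          let v , e≤v , v< , x∈v = ∈-played⁻ H e (t ∸ e) x∈
              w , e≤w , w< , y∈w = ∈-played⁻ H e (t ∸ e) y∈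
              <t : ∀ {z} → e ≤ z → z < e + (t ∸ e) → z < t
              <t {z} e≤z z< = [ (λ e≤t → ℕₚ.<-≤-trans z< (ℕₚ.≤-reflexive (ℕₚ.m+[n∸m]≡n e≤t)))
                          , (λ t≤e → contradiction (subst (z <_) (trans (cong (λ d → e + d) (ℕₚ.m≤n⇒m∸n≡0 t≤e)) (ℕₚ.+-identityʳ e)) z<) (ℕₚ.≤⇒≯ e≤z)) ]′ (ℕₚ.≤-total e t)
          in [ (λ v≤w → barrier-pair u₀ y x col open-S y∈S x∈S u₀∈ u₀∉M (x≢y ∘ sym) (pair-dead e≤v v≤w (<t e≤w w<) x∈v y∈w x≢y))
             , (λ w≤v → barrier-pair u₀ x y col open-S x∈S y∈S u₀∈ u₀∉M x≢y (pair-dead e≤w w≤v (<t e≤v v<) y∈w x∈v (x≢y ∘ sym))) ]′ (ℕₚ.≤-total v w)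

    -- For Λ ≤ J the levels go down to single turns and nothing is left over. Otherwise depth J
    -- leaves about two short blocks, which hold at most one point of S.
    count-past : count S (played H 0 t) ≤ 8 * B * n′ + 1
    count-past with ℕₚ.≤-<-connex Λ J
    ... | inj₁ Λ≤J = begin
        count S (played H 0 t)                 ≡⟨ cong (λ z → count S (played H 0 z)) until-0 ⟨
        count S (played H 0 (done-until 0))    ≤⟨ covered≤ Λ 0 (ℕₚ.+-identityʳ Λ) Λ≤J ⟩
        2 * X                                  ≡⟨ solve 2 (λ b n → con 2 :* (con 4 :* b :* n) := con 8 :* b :* n) refl B n′ ⟩
        8 * B * n′                             ≤⟨ ℕₚ.m≤m+n _ 1 ⟩
        8 * B * n′ + 1                         ∎
      where
      open ℕₚ.≤-Reasoning
      open Data.Nat.Solver.+-*-Solver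
      until-0 : done-until 0 ≡ t
      until-0 = trans (ℕₚ.*-identityʳ (q 0 ∸ 1)) (cong (_∸ 1) (n/1≡n (suc t)))
    ... | inj₂ J<Λ = begin
        count S (played H 0 t)                 ≡⟨ cong (λ z → count S (played H 0 z)) (ℕₚ.m+[n∸m]≡n e≤t) ⟨
        count S (played H 0 (e + (t ∸ e)))     ≤⟨ count-played uniqueS H 0 e (t ∸ e) ⟩
        count S (played H 0 e) + count S (played H e (t ∸ e))
                                               ≤⟨ ℕₚ.+-mono-≤ (covered≤ J l eq ℕₚ.≤-refl) (Leftover.leftover l (ℕₚ.m<n⇒0<n∸m J<Λ) eq) ⟩
        2 * X + 1                              ≡⟨ solve 2 (λ b n → con 2 :* (con 4 :* b :* n) :+ con 1 := con 8 :* b :* n :+ con 1) refl B n′ ⟩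
        8 * B * n′ + 1                         ∎
      where
      open ℕₚ.≤-Reasoning
      open Data.Nat.Solver.+-*-Solver
      l e : ℕ
      l = Λ ∸ J
      e = done-until l
      eq : J + l ≡ Λ
      eq = ℕₚ.m+[n∸m]≡n (ℕₚ.<⇒≤ J<Λ)
      e≤t : e ≤ t
      e≤t = s≤s⁻¹ (begin
        suc e                          ≤⟨ ℕₚ.+-monoˡ-≤ e (1≤B^ l) ⟩
        B ^ l + (q l ∸ 1) * B ^ l      ≡⟨ cong (_* B ^ l) (ℕₚ.m+[n∸m]≡n (ℕₚ.≤-trans (1≤B^ J) (q≥ l J (subst (λ z → B ^ z ≤ suc t) (sym eq) (log-lower (s≤s z≤n)))))) ⟩
        q l * B ^ l                    ≤⟨ q*≤ l ⟩
        suc t                          ∎)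

-- The number of requests per turn against Breaker's budget

module Cost (B n′ J : ℕ) (16≤B : 16 ≤ B) (2^J≤n′ : 2 ^ J ≤ n′) where

  2≤B : 2 ≤ B
  2≤B = ℕₚ.≤-trans (s≤s (s≤s z≤n)) 16≤B

  open Strategy B n′ J 2≤B

  private
    -- Both Szemerédi-Trotter terms for M ≤ bn points, divided among b turns and rewritten by n / r
    -- ≤ E w. The one segment added by rounding c up raises the coefficient 6 to 7.
    chunk-arithmetic : ∀ c jobs M r b n E w → 1 ≤ b → 1 ≤ r → c * b ≤ jobs + b →
      jobs * r ^ 3 ≤ 288 * M ^ 2 + 6 * M * r ^ 2 → M ≤ b * n → r ≤ n → n ≤ E * w * r →
      n * c ≤ 288 * E ^ 3 * (b * w ^ 3) + 7 * E * (w * n)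
    chunk-arithmetic c jobs M r b n E w 1≤b 1≤r cb≤ rich≤ M≤ r≤n n≤ =
      ℕₚ.*-cancelʳ-≤ _ _ (r ^ 3) {{ℕₚ.m^n≢0 r 3 {{>-nonZero 1≤r}}}} (begin
        n * c * r ^ 3
          ≤⟨ ℕₚ.*-cancelʳ-≤ _ _ b {{>-nonZero 1≤b}} scaled ⟩
        288 * b * (n * n * n) + 7 * n * r ^ 2 * n
          ≤⟨ ℕₚ.+-mono-≤ (ℕₚ.*-monoʳ-≤ (288 * b) (ℕₚ.*-mono-≤ (ℕₚ.*-mono-≤ n≤ n≤) n≤)) (ℕₚ.*-monoʳ-≤ (7 * n * r ^ 2) n≤) ⟩
        288 * b * (E * w * r * (E * w * r) * (E * w * r)) + 7 * n * r ^ 2 * (E * w * r)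
          ≡⟨ solve 5 (λ b E w r n → con 288 :* b :* (E :* w :* r :* (E :* w :* r) :* (E :* w :* r)) :+ con 7 :* n :* r :^ 2 :* (E :* w :* r)
               := (con 288 :* E :^ 3 :* (b :* w :^ 3) :+ con 7 :* E :* (w :* n)) :* r :^ 3) refl b E w r n ⟩
        (288 * E ^ 3 * (b * w ^ 3) + 7 * E * (w * n)) * r ^ 3 ∎)
      where
      open ℕₚ.≤-Reasoning
      open Data.Nat.Solver.+-*-Solver
      scaled : n * c * r ^ 3 * b ≤ (288 * b * (n * n * n) + 7 * n * r ^ 2 * n) * b
      scaled = begin
        n * c * r ^ 3 * b
          ≡⟨ solve 4 (λ n c r b → n :* c :* r :^ 3 :* b := n :* (c :* b :* r :^ 3)) refl n c r b ⟩
        n * (c * b * r ^ 3)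
          ≤⟨ ℕₚ.*-monoʳ-≤ n (ℕₚ.*-monoˡ-≤ (r ^ 3) cb≤) ⟩
        n * ((jobs + b) * r ^ 3)
          ≡⟨ cong (n *_) (ℕₚ.*-distribʳ-+ (r ^ 3) jobs b) ⟩
        n * (jobs * r ^ 3 + b * r ^ 3)
          ≤⟨ ℕₚ.*-monoʳ-≤ n (ℕₚ.+-mono-≤ rich≤ (ℕₚ.*-monoʳ-≤ b (ℕₚ.*-monoˡ-≤ (r ^ 2) r≤n))) ⟩
        n * (288 * M ^ 2 + 6 * M * r ^ 2 + b * (n * r ^ 2))
          ≤⟨ ℕₚ.*-monoʳ-≤ n (ℕₚ.+-monoˡ-≤ (b * (n * r ^ 2)) (ℕₚ.+-mono-≤ (ℕₚ.*-monoʳ-≤ 288 (ℕₚ.^-monoˡ-≤ 2 M≤))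
               (ℕₚ.*-monoˡ-≤ (r ^ 2) (ℕₚ.*-monoʳ-≤ 6 M≤)))) ⟩
        n * (288 * (b * n) ^ 2 + 6 * (b * n) * r ^ 2 + b * (n * r ^ 2))
          ≡⟨ solve 3 (λ b n r → n :* (con 288 :* (b :* n) :^ 2 :+ con 6 :* (b :* n) :* r :^ 2 :+ b :* (n :* r :^ 2))
               := (con 288 :* b :* (n :* n :* n) :+ con 7 :* n :* r :^ 2 :* n) :* b) refl b n r ⟩
        (288 * b * (n * n * n) + 7 * n * r ^ 2 * n) * b ∎

  rich-bound : ∀ P ρ → Unique P → length (richSegments P ρ) * ρ ^ 3 ≤ 288 * length P ^ 2 + 6 * length P * ρ ^ 2
  rich-bound [] ρ _ = z≤n
  rich-bound P@(_ ∷ _) ρ uniq = szemerédi-trotter P ρ uniq (s≤s z≤n)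

  module _ {H : History} (proper : Proper H) (u n E : ℕ) (len : ∀ v → v ≤ u → length (H v) ≤ n)
    (n′≤n : n′ ≤ n) (n≤ : ∀ j → j ≤ J → n ≤ E * 2 ^ j * allowance j) (n≤′ : n ≤ E * 2 ^ J) where

    private
      Λ A C : ℕ
      Λ = log (suc u)
      A = 288 * E ^ 3
      C = 7 * E

      chunk-cost : ∀ l → l ≤ Λ → Λ ∸ l ≤ J →
        n * length (chunk H u l) ≤ A * (B ^ l * (2 ^ (Λ ∸ l)) ^ 3) + C * (2 ^ (Λ ∸ l) * n)
      chunk-cost l l≤Λ j≤J = ℕₚ.≤-trans (ℕₚ.*-monoʳ-≤ n chunk≤c)
        (chunk-arithmetic c (length js) (length P) (allowance j) (B ^ l) n E (2 ^ j) (1≤B^ l)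
          (1≤allowance j (ℕₚ.≤-trans (ℕₚ.^-monoʳ-≤ 2 j≤J) 2^J≤n′))
          (ℕₚ.≤-trans (ℕₚ.≤-reflexive (ℕₚ.+-comm (B ^ l) (length js /ᴮ l * B ^ l))) (ℕₚ.+-monoˡ-≤ (B ^ l) (/ᴮ*≤ (length js) l)))
          (rich-bound P (allowance j) (unique-played proper (i * B ^ l) (B ^ l)))
          (length-played H (i * B ^ l) (B ^ l) n λ v _ v< → len v (s≤s⁻¹ (ℕₚ.<-≤-trans v< (block-past u l l≤Λ))))
          (ℕₚ.≤-trans (ℕₚ.≤-trans (ℕₚ.m≤m*n (allowance j) (2 ^ j) {{ℕₚ.m^n≢0 2 j}}) (allowance*≤ j)) n′≤n)
          (n≤ j j≤J))
        where
        i j c : ℕ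
        i = suc u /ᴮ l ∸ 1
        j = Λ ∸ l
        P : List Point
        P = block H l i
        js : List (Point × Point)
        js = jobs H l i j
        c = chunkSize H l i j
        chunk≤c : length (chunk H u l) ≤ c
        chunk≤c = ℕₚ.≤-trans (ℕₚ.≤-reflexive (length-take c (drop (suc u %ᴮ l * c) js))) (ℕₚ.m⊓n≤m c _)

      x : ℕ → ℕ
      x k = B ^ (Λ ∸ k) * (2 ^ k) ^ 3

      -- One level deeper the block length drops by the factor B and the cube grows by the factor 8;
      -- B ≥ 16 leaves the ratio 1 / 2.
      x-halves : ∀ k → suc k ≤ Λ → 2 * x (suc k) ≤ x k
      x-halves k k<Λ = begin
        2 * (B ^ (Λ ∸ suc k) * (2 * 2 ^ k) ^ 3)
          ≡⟨ solve 2 (λ b w → con 2 :* (b :* (con 2 :* w) :^ 3) := con 16 :* b :* w :^ 3) refl (B ^ (Λ ∸ suc k)) (2 ^ k) ⟩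
        16 * B ^ (Λ ∸ suc k) * (2 ^ k) ^ 3
          ≤⟨ ℕₚ.*-monoˡ-≤ ((2 ^ k) ^ 3) (ℕₚ.*-monoˡ-≤ (B ^ (Λ ∸ suc k)) 16≤B) ⟩
        B ^ suc (Λ ∸ suc k) * (2 ^ k) ^ 3
          ≡⟨ cong (λ z → B ^ z * (2 ^ k) ^ 3) (sym (ℕₚ.+-∸-assoc 1 k<Λ)) ⟩
        B ^ (Λ ∸ k) * (2 ^ k) ^ 3 ∎
        where
        open ℕₚ.≤-Reasoning
        open Data.Nat.Solver.+-*-Solver

      -- The costs of the levels form two geometric sums, dominated by opposite ends.
      chunks-cost : ∀ k → k ≤ Λ → k ≤ J →
        n * length (chunks H u (suc k)) + A * x k ≤ 2 * A * B ^ Λ + C * (2 ^ suc k * n)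
      chunks-cost k k≤Λ k≤J = ℕₚ.≤-trans (ℕₚ.+-monoˡ-≤ (A * x k) (ℕₚ.≤-trans
          (ℕₚ.≤-reflexive (trans (cong (n *_) (length-++ (chunk H u (Λ ∸ k)))) (ℕₚ.*-distribˡ-+ n (length (chunk H u (Λ ∸ k))) _)))
          (ℕₚ.+-monoˡ-≤ (n * length (chunks H u k)) first))) (rest k k≤Λ k≤J)
        where
        open ℕₚ.≤-Reasoning
        open Data.Nat.Solver.+-*-Solver
        first : n * length (chunk H u (Λ ∸ k)) ≤ A * x k + C * (2 ^ k * n)
        first = subst (λ j → n * length (chunk H u (Λ ∸ k)) ≤ A * (B ^ (Λ ∸ k) * (2 ^ j) ^ 3) + C * (2 ^ j * n)) (ℕₚ.m∸[m∸n]≡n k≤Λ)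
          (chunk-cost (Λ ∸ k) (ℕₚ.m∸n≤m Λ k) (subst (_≤ J) (sym (ℕₚ.m∸[m∸n]≡n k≤Λ)) k≤J))
        rest : ∀ k → k ≤ Λ → k ≤ J → A * x k + C * (2 ^ k * n) + n * length (chunks H u k) + A * x k ≤ 2 * A * B ^ Λ + C * (2 ^ suc k * n)
        rest zero _ _ = begin
          A * (B ^ Λ * 1) + C * (1 * n) + n * 0 + A * (B ^ Λ * 1)
            ≡⟨ solve 4 (λ A b C n → A :* (b :* con 1) :+ C :* (con 1 :* n) :+ n :* con 0 :+ A :* (b :* con 1) := con 2 :* A :* b :+ C :* n) refl A (B ^ Λ) C n ⟩
          2 * A * B ^ Λ + C * n
            ≤⟨ ℕₚ.+-monoʳ-≤ (2 * A * B ^ Λ) (ℕₚ.*-monoʳ-≤ C (ℕₚ.m≤m+n n (n + 0))) ⟩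
          2 * A * B ^ Λ + C * (2 * n) ∎
        rest (suc k) k<Λ k<J = begin
          A * x (suc k) + C * (2 ^ suc k * n) + n * length (chunks H u (suc k)) + A * x (suc k)
            ≡⟨ solve 3 (λ a c l → a :+ c :+ l :+ a := l :+ (con 2 :* a) :+ c) refl (A * x (suc k)) (C * (2 ^ suc k * n)) (n * length (chunks H u (suc k))) ⟩
          n * length (chunks H u (suc k)) + 2 * (A * x (suc k)) + C * (2 ^ suc k * n)
            ≤⟨ ℕₚ.+-monoˡ-≤ (C * (2 ^ suc k * n)) (ℕₚ.+-monoʳ-≤ (n * length (chunks H u (suc k))) (ℕₚ.≤-trans
                 (ℕₚ.≤-reflexive (solve 2 (λ A y → con 2 :* (A :* y) := A :* (con 2 :* y)) refl A (x (suc k)))) (ℕₚ.*-monoʳ-≤ A (x-halves k k<Λ)))) ⟩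
          n * length (chunks H u (suc k)) + A * x k + C * (2 ^ suc k * n)
            ≤⟨ ℕₚ.+-monoˡ-≤ (C * (2 ^ suc k * n)) (chunks-cost k (ℕₚ.<⇒≤ k<Λ) (ℕₚ.<⇒≤ k<J)) ⟩
          2 * A * B ^ Λ + C * (2 ^ suc k * n) + C * (2 ^ suc k * n)
            ≡⟨ solve 4 (λ a C w n → a :+ C :* (w :* n) :+ C :* (w :* n) := a :+ C :* (con 2 :* w :* n)) refl (2 * A * B ^ Λ) C (2 ^ suc k) n ⟩
          2 * A * B ^ Λ + C * (2 ^ suc (suc k) * n) ∎

      all-chunks-cost : n * length (chunks H u (suc (J ⊓ Λ))) ≤ 2 * A * B ^ Λ + 2 * C * (2 ^ Λ * n)
      all-chunks-cost = begin
        n * length (chunks H u (suc (J ⊓ Λ)))                      ≤⟨ ℕₚ.m≤m+n _ _ ⟩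
        n * length (chunks H u (suc (J ⊓ Λ))) + A * x (J ⊓ Λ)      ≤⟨ chunks-cost (J ⊓ Λ) (ℕₚ.m⊓n≤n J Λ) (ℕₚ.m⊓n≤m J Λ) ⟩
        2 * A * B ^ Λ + C * (2 ^ suc (J ⊓ Λ) * n)
          ≤⟨ ℕₚ.+-monoʳ-≤ (2 * A * B ^ Λ) (ℕₚ.*-monoʳ-≤ C (ℕₚ.*-monoˡ-≤ n (ℕₚ.^-monoʳ-≤ 2 (s≤s (ℕₚ.m⊓n≤n J Λ))))) ⟩
        2 * A * B ^ Λ + C * (2 * 2 ^ Λ * n)
          ≡⟨ solve 4 (λ a C w n → a :+ C :* (con 2 :* w :* n) := a :+ con 2 :* C :* (w :* n)) refl (2 * A * B ^ Λ) C (2 ^ Λ) n ⟩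
        2 * A * B ^ Λ + 2 * C * (2 ^ Λ * n) ∎
        where
        open ℕₚ.≤-Reasoning
        open Data.Nat.Solver.+-*-Solver

      -- The window has at most 2 B ^ (Λ + 1 - J) turns, so the left side is at most that number
      -- times n³. As n is at most E 2 ^ J, n³ ≤ E³ 8 ^ J ≤ E³ B ^ J, and the powers of B combine to
      -- B · B ^ Λ.
      pairs-cost : n * length (pairs H u) ≤ 2 * E ^ 3 * B * B ^ Λ
      pairs-cost with J ≤? Λ
      ... | no _ = ℕₚ.≤-trans (ℕₚ.≤-reflexive (ℕₚ.*-zeroʳ n)) z≤n
      ... | yes J≤Λ = begin
        n * length (filter (λ (y , x) → ¬? (y ≟ₚ x)) (cartesianProduct P (H u)))
          ≤⟨ ℕₚ.*-monoʳ-≤ n (ℕₚ.≤-trans (length-filter (λ (y , x) → ¬? (y ≟ₚ x)) (cartesianProduct P (H u))) (ℕₚ.≤-reflexive (length-cartesianProduct P (H u)))) ⟩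
        n * (length P * length (H u))
          ≤⟨ ℕₚ.*-monoʳ-≤ n (ℕₚ.*-mono-≤ (ℕₚ.≤-trans lenP (ℕₚ.*-monoˡ-≤ n size≤)) (len u ℕₚ.≤-refl)) ⟩
        n * (2 * B ^ D * n * n)
          ≡⟨ solve 2 (λ n d → n :* (con 2 :* d :* n :* n) := con 2 :* d :* (n :* n :* n)) refl n (B ^ D) ⟩
        2 * B ^ D * (n * n * n)
          ≤⟨ ℕₚ.*-monoʳ-≤ (2 * B ^ D) (ℕₚ.*-mono-≤ (ℕₚ.*-mono-≤ n≤′ n≤′) n≤′) ⟩
        2 * B ^ D * (E * 2 ^ J * (E * 2 ^ J) * (E * 2 ^ J))
          ≡⟨ solve 3 (λ d E w → con 2 :* d :* (E :* w :* (E :* w) :* (E :* w)) := con 2 :* E :^ 3 :* (w :^ 3 :* d)) refl (B ^ D) E (2 ^ J) ⟩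
        2 * E ^ 3 * ((2 ^ J) ^ 3 * B ^ D)
          ≤⟨ ℕₚ.*-monoʳ-≤ (2 * E ^ 3) (ℕₚ.*-monoˡ-≤ (B ^ D) cube≤) ⟩
        2 * E ^ 3 * (B ^ J * B ^ D)
          ≡⟨ cong (2 * E ^ 3 *_) (trans (sym (ℕₚ.^-distribˡ-+-* B J D)) (cong (B ^_) (ℕₚ.m+[n∸m]≡n (ℕₚ.m≤n⇒m≤1+n J≤Λ)))) ⟩
        2 * E ^ 3 * (B * B ^ Λ)
          ≡⟨ ℕₚ.*-assoc (2 * E ^ 3) B (B ^ Λ) ⟨
        2 * E ^ 3 * B * B ^ Λ ∎
        where
        open ℕₚ.≤-Reasoning
        open Data.Nat.Solver.+-*-Solver
        D : ℕ
        D = suc Λ ∸ J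
        P : List Point
        P = played H (window u) (suc u ∸ window u)
        lenP : length P ≤ (suc u ∸ window u) * n
        lenP = length-played H (window u) (suc u ∸ window u) n λ v _ v< →
          len v (s≤s⁻¹ (ℕₚ.<-≤-trans v< (ℕₚ.≤-reflexive (ℕₚ.m+[n∸m]≡n (window≤ u)))))
        size≤ : suc u ∸ window u ≤ 2 * B ^ D
        size≤ = ℕₚ.m≤n+o⇒m∸n≤o (suc u) (window u) (ℕₚ.≤-trans (ℕₚ.m≤n+m∸n (suc u) (2 * B ^ D)) (ℕₚ.≤-reflexive (ℕₚ.+-comm (2 * B ^ D) (window u))))
        cube≤ : (2 ^ J) ^ 3 ≤ B ^ J
        cube≤ = ℕₚ.≤-trans (ℕₚ.≤-reflexive (trans (ℕₚ.^-*-assoc 2 J 3) (trans (cong (2 ^_) (ℕₚ.*-comm J 3)) (sym (ℕₚ.^-*-assoc 2 3 J)))))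
          (ℕₚ.^-monoˡ-≤ J (ℕₚ.≤-trans (ℕₚ.m≤m+n 8 8) 16≤B))

    -- The linear bound on b pays for the terms with B ^ Λ ≤ 2u, the exponential one for the terms
    -- with 2 ^ Λ; each claims half of the budget. The outer factor 2 in the conclusion is there
    -- because each request costs two points.
    affordable : ∀ K b → 1 ≤ n → 1 ≤ u → 32 * A + 16 * E ^ 3 * B + 32 * C ≤ K →
      K * u ≤ b * n → K * 2 ^ Λ ≤ 2 * b → 2 * length (requests H u) ≤ b
    affordable K b 1≤n 1≤u K≥ Ku≤ K2≤ = ℕₚ.*-cancelˡ-≤ n {{>-nonZero 1≤n}} (ℕₚ.*-cancelˡ-≤ 2 (begin
      2 * (n * (2 * length (requests H u)))
        ≡⟨ cong (λ z → 2 * (n * (2 * z))) (trans (length-++ (bothEnds cs)) (cong (_+ length (pairs H u)) (length-bothEnds cs))) ⟩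
      2 * (n * (2 * (2 * length cs + length (pairs H u))))
        ≡⟨ solve 3 (λ n c p → con 2 :* (n :* (con 2 :* (con 2 :* c :+ p))) := con 8 :* (n :* c) :+ con 4 :* (n :* p)) refl n (length cs) (length (pairs H u)) ⟩
      8 * (n * length cs) + 4 * (n * length (pairs H u))
        ≤⟨ ℕₚ.+-mono-≤ (ℕₚ.*-monoʳ-≤ 8 all-chunks-cost) (ℕₚ.*-monoʳ-≤ 4 pairs-cost) ⟩
      8 * (2 * A * B ^ Λ + 2 * C * (2 ^ Λ * n)) + 4 * (2 * E ^ 3 * B * B ^ Λ)
        ≡⟨ solve 7 (λ A b C w n e B → con 8 :* (con 2 :* A :* b :+ con 2 :* C :* (w :* n)) :+ con 4 :* (con 2 :* e :* B :* b)
             := (con 16 :* A :+ con 8 :* e :* B) :* b :+ con 16 :* C :* (w :* n)) refl A (B ^ Λ) C (2 ^ Λ) n (E ^ 3) B ⟩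
      (16 * A + 8 * E ^ 3 * B) * B ^ Λ + 16 * C * (2 ^ Λ * n)
        ≤⟨ ℕₚ.+-mono-≤ (ℕₚ.*-monoʳ-≤ (16 * A + 8 * E ^ 3 * B) B^Λ≤2u) ℕₚ.≤-refl ⟩
      (16 * A + 8 * E ^ 3 * B) * (2 * u) + 16 * C * (2 ^ Λ * n)
        ≡⟨ solve 7 (λ A e B u C w n → (con 16 :* A :+ con 8 :* e :* B) :* (con 2 :* u) :+ con 16 :* C :* (w :* n)
             := (con 32 :* A :+ con 16 :* e :* B) :* u :+ con 16 :* C :* w :* n) refl A (E ^ 3) B u C (2 ^ Λ) n ⟩
      (32 * A + 16 * E ^ 3 * B) * u + 16 * C * 2 ^ Λ * n
        ≤⟨ ℕₚ.+-mono-≤ linear (ℕₚ.*-monoˡ-≤ n exponential) ⟩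
      b * n + b * n
        ≡⟨ solve 2 (λ b n → b :* n :+ b :* n := con 2 :* (n :* b)) refl b n ⟩
      2 * (n * b) ∎))
      where
      open ℕₚ.≤-Reasoning
      open Data.Nat.Solver.+-*-Solver
      cs : List (Point × Point)
      cs = chunks H u (suc (J ⊓ Λ))
      linear : (32 * A + 16 * E ^ 3 * B) * u ≤ b * n
      linear = ℕₚ.≤-trans (ℕₚ.*-monoˡ-≤ u (ℕₚ.≤-trans (ℕₚ.m≤m+n (32 * A + 16 * E ^ 3 * B) (32 * C)) K≥)) Ku≤
      exponential : 16 * C * 2 ^ Λ ≤ b
      exponential = ℕₚ.*-cancelˡ-≤ 2 (begin
        2 * (16 * C * 2 ^ Λ)     ≡⟨ solve 2 (λ C w → con 2 :* (con 16 :* C :* w) := con 32 :* C :* w) refl C (2 ^ Λ) ⟩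
        32 * C * 2 ^ Λ           ≤⟨ ℕₚ.*-monoˡ-≤ (2 ^ Λ) (ℕₚ.≤-trans (ℕₚ.m≤n+m (32 * C) (32 * A + 16 * E ^ 3 * B)) K≥) ⟩
        K * 2 ^ Λ                ≤⟨ K2≤ ⟩
        2 * b                    ∎)
      B^Λ≤2u : B ^ Λ ≤ 2 * u
      B^Λ≤2u = ℕₚ.≤-trans (log-lower (s≤s z≤n)) (ℕₚ.≤-trans (ℕₚ.+-monoˡ-≤ u 1≤u) (ℕₚ.≤-reflexive (cong (u +_) (sym (ℕₚ.+-identityʳ u)))))

  -- For the early turns: all points played so far do not exceed a single allowance, so no block
  -- carries a rich segment, and with Λ < J no pairs are due.
  no-requests : ∀ {H} u k → (∀ v → v ≤ u → length (H v) ≤ k) → log (suc u) < J →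
    suc u * k ≤ allowance (log (suc u)) → length (requests H u) ≡ 0
  no-requests {H} u k len Λ<J small = none (requests H u) λ {(z , x)} r∈ →
      [ [ not-chunk , not-chunk ]′ ∘ ∈-bothEnds⁻ _ , not-pair ]′ (∈-++⁻ (bothEnds (chunks H u (suc (J ⊓ Λ)))) r∈)
    where
    open ℕₚ.≤-Reasoning
    Λ : ℕ
    Λ = log (suc u)
    none : ∀ {A : Set} (xs : List A) → (∀ {x} → x ∈ xs → ⊥) → length xs ≡ 0
    none [] _ = refl
    none (x ∷ xs) empty = ⊥-elim (empty (here refl))
    not-pair : ∀ {r} → r ∈ pairs H u → ⊥
    not-pair r∈ with J ≤? log (suc u)
    ... | yes J≤Λ = ℕₚ.<⇒≱ Λ<J J≤Λ
    not-chunk : ∀ {z x} → (z , x) ∈ chunks H u (suc (J ⊓ Λ)) → ⊥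
    not-chunk {z} {x} j∈ =
      let l , l≤ , j∈c = chunks⁻ H u (suc (J ⊓ Λ)) j∈
          P = block H l (suc u /ᴮ l ∸ 1)
          _ , _ , _ , rich = richSegments⁻ P (allowance (Λ ∸ l)) (chunk⊆jobs H u l j∈c)
      in ℕₚ.1+n≰n (begin
        suc (allowance (Λ ∸ l))                               ≡⟨ rich ⟨
        length (segment P (allowance (Λ ∸ l)) z x)            ≤⟨ length-filter (inSegment? P (allowance (Λ ∸ l)) z x) P ⟩
        length P                                              ≤⟨ length-played H ((suc u /ᴮ l ∸ 1) * B ^ l) (B ^ l) k (λ v _ v< → len v (s≤s⁻¹ (ℕₚ.<-≤-trans v< (block-past u l l≤)))) ⟩
        B ^ l * k                                             ≤⟨ ℕₚ.*-monoˡ-≤ k (ℕₚ.≤-trans (ℕₚ.^-monoʳ-≤ B l≤) (log-lower (s≤s z≤n))) ⟩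
        suc u * k                                             ≤⟨ small ⟩
        allowance Λ                                           ≤⟨ /-monoʳ-≤ n′ {{ℕₚ.m^n≢0 2 Λ}} {{ℕₚ.m^n≢0 2 (Λ ∸ l)}} (ℕₚ.^-monoʳ-≤ 2 (ℕₚ.m∸n≤m Λ l)) ⟩
        allowance (Λ ∸ l)                                     ∎)

-- Growth of m and b from the hypotheses on rational exponents

module Growth where
  open import Data.Integer using (+_)

  ^-cancelˡ-< : ∀ y {a c} → a ^ y < c ^ y → a < c
  ^-cancelˡ-< y lt = ℕₚ.≰⇒> λ c≤a → ℕₚ.<⇒≱ lt (ℕₚ.^-monoˡ-≤ y c≤a)

  ^-cancelˡ-≤ : ∀ y {a c} → 1 ≤ y → a ^ y ≤ c ^ y → a ≤ c
  ^-cancelˡ-≤ y 1≤y le = ℕₚ.≮⇒≥ λ c<a → ℕₚ.<⇒≱ (ℕₚ.^-monoˡ-< y {{>-nonZero 1≤y}} c<a) le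

  ^-distribʳ-* : ∀ n a b → (a * b) ^ n ≡ a ^ n * b ^ n
  ^-distribʳ-* zero a b = refl
  ^-distribʳ-* (suc n) a b = trans (cong (a * b *_) (^-distribʳ-* n a b))
    (solve 4 (λ a b c d → a :* b :* (c :* d) := a :* c :* (b :* d)) refl a b (a ^ n) (b ^ n))
    where open Data.Nat.Solver.+-*-Solver

  num<den : ∀ {r} → 0ℚ ℚ.< r → r ℚ.< 1ℚ → num r < ↧ₙ r
  num<den {r} 0<r r<1 = ℤₚ.drop‿+<+ (subst₂ ℤ._<_ +num (ℤₚ.*-identityˡ (↧ r)) (subst (ℤ._< ℤ.1ℤ ℤ.* ↧ r) (ℤₚ.*-identityʳ (↥ r)) (ℚₚ.drop-*<* r<1)))
    where
    0<↥ : 0ℤ ℤ.< ↥ r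
    0<↥ = subst₂ ℤ._<_ (ℤₚ.*-zeroˡ (↧ r)) (ℤₚ.*-identityʳ (↥ r)) (ℚₚ.drop-*<* 0<r)
    +num : ↥ r ≡ + num r
    +num = sym (ℤₚ.0≤i⇒+∣i∣≡i (ℤₚ.<⇒≤ 0<↥))

  1≤den : ∀ r → 1 ≤ ↧ₙ r
  1≤den r = s≤s z≤n

  module _ (α : NonNegReal) (α<1 : α <1) (m : ℕ → ℕ) (floor : IsFloorPow α m) where

    m≤t : ∀ {t} → 1 ≤ t → m t ≤ t
    m≤t {t} 1≤t = subst₂ _≤_ (ℕₚ.*-identityʳ (m t)) (ℕₚ.*-identityʳ t) (proj₁ (floor t 1≤t) 1ℚ α<1)

    m-mono : ∀ {s t} → 1 ≤ s → s ≤ t → m s ≤ m t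
    m-mono {s} {t} 1≤s s≤t =
      let q , up , lt = proj₂ (floor t (ℕₚ.≤-trans 1≤s s≤t))
      in s≤s⁻¹ (^-cancelˡ-< (↧ₙ q) (ℕₚ.≤-<-trans (proj₁ (floor s 1≤s) q up) (ℕₚ.≤-<-trans (ℕₚ.^-monoˡ-≤ (num q) s≤t) lt)))

    -- Concavity of t ↦ t ^ (x / y): if a ≤ t then (t + 1) / t ≤ (a + 1) / a.
    private
      concave : ∀ {t a x y} → 1 ≤ a → a ≤ t → x ≤ y → t ^ x < a ^ y → suc t ^ x < suc a ^ y
      concave {t} {a} {x} {y} 1≤a a≤t x≤y lt = ℕₚ.*-cancelʳ-< (a ^ x) _ _ (begin-strict
        suc t ^ x * a ^ x                     ≡⟨ ^-distribʳ-* x (suc t) a ⟨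
        (suc t * a) ^ x                       ≤⟨ ℕₚ.^-monoˡ-≤ x (ℕₚ.≤-trans (ℕₚ.+-monoˡ-≤ (t * a) a≤t) (ℕₚ.≤-reflexive (cong (λ z → t + z) (ℕₚ.*-comm t a)))) ⟩
        (suc a * t) ^ x                       ≡⟨ ^-distribʳ-* x (suc a) t ⟩
        suc a ^ x * t ^ x                     <⟨ ℕₚ.*-monoʳ-< (suc a ^ x) {{ℕₚ.m^n≢0 (suc a) x}} lt ⟩
        suc a ^ x * a ^ y                     ≡⟨ cong (λ z → suc a ^ x * a ^ z) (ℕₚ.m∸n+n≡m x≤y) ⟨
        suc a ^ x * a ^ (y ∸ x + x)           ≡⟨ cong (suc a ^ x *_) (ℕₚ.^-distribˡ-+-* a (y ∸ x) x) ⟩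
        suc a ^ x * (a ^ (y ∸ x) * a ^ x)     ≤⟨ ℕₚ.*-monoʳ-≤ (suc a ^ x) (ℕₚ.*-monoˡ-≤ (a ^ x) (ℕₚ.^-monoˡ-≤ (y ∸ x) (ℕₚ.n≤1+n a))) ⟩
        suc a ^ x * (suc a ^ (y ∸ x) * a ^ x) ≡⟨ ℕₚ.*-assoc (suc a ^ x) (suc a ^ (y ∸ x)) (a ^ x) ⟨
        suc a ^ x * suc a ^ (y ∸ x) * a ^ x   ≡⟨ cong (_* a ^ x) (trans (sym (ℕₚ.^-distribˡ-+-* (suc a) x (y ∸ x))) (cong (suc a ^_) (ℕₚ.m+[n∸m]≡n x≤y))) ⟩
        suc a ^ y * a ^ x                     ∎)
        where open ℕₚ.≤-Reasoning

    m-step : ∀ {t} → 1 ≤ t → m (suc t) ≤ suc (m t)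
    m-step {t} 1≤t with suc (m t) ≤? t
    ... | no m≮t = ℕₚ.≤-trans (m≤t (s≤s z≤n)) (ℕₚ.≰⇒> m≮t)
    ... | yes m<t with proj₂ (floor t 1≤t)
    ...   | q , up , lt with num q ≤? ↧ₙ q
    ...     | yes x≤y = s≤s⁻¹ (^-cancelˡ-< (↧ₙ q) (ℕₚ.≤-<-trans (proj₁ (floor (suc t) (s≤s z≤n)) q up) (concave (s≤s z≤n) m<t x≤y lt)))
    -- An exponent q > 1 with t ^ q < suc (m t) would give t < suc (m t), against the case at hand.
    ...     | no x≰y = contradiction m<t (ℕₚ.<⇒≱ (^-cancelˡ-< (num q)
                (ℕₚ.<-≤-trans lt (ℕₚ.^-monoʳ-≤ (suc (m t)) (ℕₚ.<⇒≤ (ℕₚ.≰⇒> x≰y))))))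

    -- The rational exponent that certifies t ^ α < suc (m t) is also admissible in the scaled
    -- bound, so t ^ α may be replaced by suc (m t).
    scaled⇒linear : ∀ {K t c} → 1 ≤ t → ScaledLe K t c α → K * t ≤ c * suc (m t)
    scaled⇒linear {K} {t} {c} 1≤t scaled =
      let q , up , lt = proj₂ (floor t 1≤t)
          y = ↧ₙ q
      in ^-cancelˡ-≤ y (1≤den q) (begin
        (K * t) ^ y                   ≤⟨ scaled q up ⟩
        c ^ y * t ^ num q             ≤⟨ ℕₚ.*-monoʳ-≤ (c ^ y) (ℕₚ.<⇒≤ lt) ⟩
        c ^ y * suc (m t) ^ y         ≡⟨ ^-distribʳ-* y c (suc (m t)) ⟨
        (c * suc (m t)) ^ y           ∎)
      where
      open ℕₚ.≤-Reasoning

    -- The cut is open, so there is a rational r with α < r < 1. With y its denominator, 1 - r ≥ 1 /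
    -- y, hence c ≥ K t ^ (1 - r) ≥ K t ^ (1 / y).
    scaled⇒power : ∃[ y ] (1 ≤ y × (∀ {K t c} → 1 ≤ t → ScaledLe K t c α → K ^ y * t ≤ c ^ y))
    scaled⇒power =
      let r , r<1 , up = rounded α α<1
          x = num r
          y = ↧ₙ r
          x<y = num<den (positive α up) r<1
      in y , 1≤den r , λ {K} {t} {c} 1≤t scaled → ℕₚ.*-cancelʳ-≤ _ _ (t ^ x) {{ℕₚ.m^n≢0 t x {{>-nonZero 1≤t}}}} (begin
        K ^ y * t * t ^ x                 ≡⟨ ℕₚ.*-assoc (K ^ y) t (t ^ x) ⟩
        K ^ y * t ^ suc x                 ≤⟨ ℕₚ.*-monoʳ-≤ (K ^ y) (ℕₚ.^-monoʳ-≤ t {{>-nonZero 1≤t}} x<y) ⟩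
        K ^ y * t ^ y                     ≡⟨ ^-distribʳ-* y K t ⟨
        (K * t) ^ y                       ≤⟨ scaled r up ⟩
        c ^ y * t ^ x                     ∎)
      where
      open ℕₚ.≤-Reasoning

open Growth

-- Maker completes a segment on an untouched line

module MakerLine where
  open import Data.Integer using (+_)
  open import Data.Integer using (_-_; _≟_) renaming (_+_ to _+ᶻ_; _*_ to _*ᶻ_; _≤_ to _≤ᶻ_; _<_ to _<ᶻ_)

  height : ℤ → ℕ → Point
  height Y i = + i , Y

  not-on-line : ∀ i j Y p → proj₂ p ≢ Y → ¬ OnSegment p (height Y i) (height Y j)
  not-on-line i j Y (px , py) py≢Y (collinear , opposite) = ℤₚ.<⇒≱ positive-dot opposite
    where
    open Data.Integer.Solver.+-*-Solver
    -- A point off the line is collinear with both ends only if these coincide; then `dot` is a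
    -- squared distance and positive.
    i≡j : + j ≡ + i
    i≡j = [ i-j≡0⇒i≡j (+ j) (+ i) , (λ eq → contradiction (i-j≡0⇒i≡j py Y eq) py≢Y) ]′
      (ℤₚ.i*j≡0⇒i≡0∨j≡0 (+ j - + i) (trans (solve 5 (λ i j y px py → (j :- i) :* (py :- y) := (j :- i) :* (py :- y) :- (y :- y) :* (px :- i)) refl (+ i) (+ j) Y px py) collinear))
    positive-dot : 0ℤ <ᶻ dot (px , py) (height Y i) (height Y j)
    positive-dot = subst (λ z → 0ℤ <ᶻ ((+ i - px) *ᶻ (z - px)) +ᶻ ((Y - py) *ᶻ (Y - py))) (sym i≡j)
      (sum-of-squares>0 (+ i - px) (Y - py) λ _ eq → py≢Y (sym (i-j≡0⇒i≡j Y py eq)))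

  above : ∀ {p} C → p ∈ C → proj₂ p ≢ + suc (heightBound C)
  above {px , _} C p∈ refl = ℕₚ.1+n≰n (height≤ C p∈)

  line-wins : ∀ n k M B → n ≤ k → ∃[ L ] (LegalMove k (M ++ B) L × HasWinningSegment n (L ++ M) B)
  line-wins n k M B n≤k = applyUpTo (height Y) k ,
    (length-applyUpTo (height Y) k , distinct k , All.tabulate λ p∈ p∈C →
      let i , _ , eq = ∈-applyUpTo⁻ (height Y) p∈ in above (M ++ B) p∈C (cong proj₂ eq)) ,
    applyUpTo (height Y) n , length-applyUpTo (height Y) n , distinct n ,
    All.tabulate (λ p∈ → let i , i<n , eq = ∈-applyUpTo⁻ (height Y) p∈ in
      ∈-++⁺ˡ (subst (_∈ applyUpTo (height Y) k) (sym eq) (∈-applyUpTo⁺ (height Y) (ℕₚ.<-≤-trans i<n n≤k)))) ,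
    collinear ,
    λ { {p} p∈B (a , c , a∈ , c∈ , onSeg) →
      let i , _ , a≡ = ∈-applyUpTo⁻ (height Y) a∈
          j , _ , c≡ = ∈-applyUpTo⁻ (height Y) c∈
      in not-on-line i j Y p (above (M ++ B) (∈-++⁺ʳ M p∈B)) (subst₂ (OnSegment p) a≡ c≡ onSeg) }
    where
    Y : ℤ
    Y = + suc (heightBound (M ++ B))
    distinct : ∀ n → Unique (applyUpTo (height Y) n)
    distinct n = Uniqueₚ.applyUpTo⁺₁ (height Y) n λ { i<j _ eq → ℕₚ.<⇒≢ i<j (ℤₚ.+-injective (cong proj₁ eq)) }
    collinear : Collinear (applyUpTo (height Y) n)
    collinear a∈ b∈ c∈ with ∈-applyUpTo⁻ (height Y) a∈ | ∈-applyUpTo⁻ (height Y) b∈ | ∈-applyUpTo⁻ (height Y) c∈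
    ... | i , _ , refl | j , _ , refl | k , _ , refl =
      solve 4 (λ i j k y → (j :- i) :* (y :- y) :- (y :- y) :* (k :- i) := con 0ℤ) refl (+ i) (+ j) (+ k) Y
      where open Data.Integer.Solver.+-*-Solver

  maker-wins : ∀ n m b r t M B → n ≤ m (t + r) → MakerWinsWithin n m b r t M B
  maker-wins n m b zero t M B n≤m = line-wins n (m t) M B (subst (λ z → n ≤ m z) (ℕₚ.+-identityʳ t) n≤m)
  maker-wins n m b (suc r) t M B n≤m =
    let L , legal = fresh-points (m t) (M ++ B)
    in L , legal , inj₂ λ L′ _ → maker-wins n m b r (suc t) (L ++ M) (L′ ++ B) (subst (λ z → n ≤ m z) (ℕₚ.+-suc t r) n≤m)

open MakerLine

-- Turning requests into legal moves of Breaker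

module Replies where
  open Count _≟ₚ_

  collect : ∀ M B W → All (_∉ M) W → ∃[ L ] (length L ≤ length W × Unique L × All (_∉ M) L × All (_∉ B) L × All (_∈ (L ++ B)) W)
  collect M B [] [] = [] , z≤n , [] , [] , [] , []
  collect M B (w ∷ W) (w∉M ∷ W∉M) with collect M B W W∉M
  ... | L , len , uniq , L∉M , L∉B , W∈ with w ∈? (L ++ B)
  ...   | yes w∈ = L , ℕₚ.m≤n⇒m≤1+n len , uniq , L∉M , L∉B , w∈ ∷ W∈
  ...   | no w∉ = w ∷ L , s≤s len , All.tabulate (λ { x∈ refl → w∉ (∈-++⁺ˡ x∈) }) ∷ uniq , w∉M ∷ L∉M ,
            w∉ ∘ ∈-++⁺ʳ L ∷ L∉B , here refl ∷ All.map there W∈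

  -- A move has exactly k new points: the wanted points that Breaker does not hold yet, padded with
  -- arbitrary unclaimed ones.
  reply : ∀ M B W k → All (_∉ M) W → length W ≤ k → ∃[ L ] (LegalMove k (M ++ B) L × All (_∈ (L ++ B)) W)
  reply M B W k W∉M len with collect M B W W∉M
  ... | L , lenL , uniq , L∉M , L∉B , W∈ with fresh-points (k ∸ length L) (L ++ M ++ B)
  ...   | F , lenF , uniqF , F∉ = F ++ L ,
    (trans (length-++ F) (trans (cong (_+ length L) lenF) (ℕₚ.m∸n+n≡m (ℕₚ.≤-trans lenL len))) ,
     Uniqueₚ.++⁺ uniqF uniq (λ (x∈F , x∈L) → All.lookup F∉ x∈F (∈-++⁺ˡ x∈L)) ,
     Allₚ.++⁺ (All.map (λ x∉ → x∉ ∘ ∈-++⁺ʳ L) F∉)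
       (All.tabulate λ x∈ → [ All.lookup L∉M x∈ , All.lookup L∉B x∈ ]′ ∘ ∈-++⁻ M)) ,
    All.map (λ {x} x∈ → subst (x ∈_) (sym (++-assoc F L B)) (∈-++⁺ʳ F x∈)) W∈

  kill-all : ∀ M R → (∀ {z x} → (z , x) ∈ R → z ≢ x × x ∈ M) →
    ∃[ W ] (length W ≡ 2 * length R × All (_∉ M) W × (∀ {B} → All (_∈ B) W → ∀ {z x} → (z , x) ∈ R → Dead M B z x))
  kill-all M [] ok = [] , refl , [] , λ _ ()
  kill-all M ((z , x) ∷ R) ok =
    let K , lenK , K∉ , K-dead = kill M z x (proj₂ (ok (here refl))) (proj₁ (ok (here refl)))
        W , lenW , W∉ , W-dead = kill-all M R (ok ∘ there)
    in K ++ W , trans (length-++ K {W}) (trans (cong₂ _+_ lenK lenW) (sym (ℕₚ.*-suc 2 (length R)))) , Allₚ.++⁺ K∉ W∉ ,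
       λ all∈ → λ { (here refl) → K-dead (Allₚ.++⁻ˡ K all∈) ; (there r∈) → W-dead (Allₚ.++⁻ʳ K all∈) r∈ }

open Replies

-- The invariant that Breaker maintains

module Game (B n′ J n T : ℕ) (m b : ℕ → ℕ) (2≤B : 2 ≤ B) (1≤J : 1 ≤ J) (2^J≤n′ : 2 ^ J ≤ n′)
  (m≤mT : ∀ {t} → 1 ≤ t → t ≤ T → m t ≤ m T) (short : m T + (8 * B * n′ + 1) < n)
  (budget : ∀ {H} → Proper H → ∀ u → 1 ≤ u → u < T → (∀ v → v ≤ u → length (H v) ≤ m u) →
    2 * length (Strategy.requests B n′ J 2≤B H u) ≤ b u) where

  open Strategy B n′ J 2≤B
  open Cover B n′ J 2≤B 1≤J 2^J≤n′
  open Count _≟ₚ_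

  record Invariant (t : ℕ) (M Br : List Point) : Set where
    field
      H      : History
      proper : Proper H
      -- Blocks of turns start at 0 but play starts at turn 1; the empty turn 0 fills the gap, as
      -- nothing is assumed about m 0.
      H0     : H 0 ≡ []
      size   : ∀ v → 1 ≤ v → v < t → length (H v) ≤ m v
      H⊆M    : ∀ {v p} → p ∈ H v → p ∈ M
      M⊆H    : ∀ {p} → p ∈ M → ∃[ v ] (v < t × p ∈ H v)
      done   : ∀ v → v < t → ∀ {z x} → (z , x) ∈ requests H v → Dead M Br z x
      no-win : ¬ HasWinningSegment n M Br

  initially : Invariant 1 [] []
  initially = record
    { H = λ _ → []
    ; proper = record { unique = λ _ → [] ; disjoint = λ () }
    ; H0 = refl
    ; size = λ _ _ _ → z≤n
    ; H⊆M = λ ()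
    ; M⊆H = λ ()
    ; done = λ v _ r∈ → contradiction (proj₂ (proj₂ (proj₂ (requests⁻ (λ _ → []) v r∈)))) λ ()
    ; no-win = λ { ([] , len , _) → contradiction (subst (_ <_) (sym len) short) (λ ()) ; (x ∷ S , _ , _ , () ∷ _ , _) }
    }

  module Turn {t M Br} (inv : Invariant t M Br) (1≤t : 1 ≤ t) (t≤T : t ≤ T)
    {L : List Point} (legal : LegalMove (m t) (M ++ Br) L) where
    open Invariant inv

    -- A winning segment inside M would have existed before this move. One with a new point u has at
    -- most m T points from L, and since it has gained u past all blockings, `count-past` limits its
    -- points in M; by `short` the sum is below n.
    no-win-now : ¬ HasWinningSegment n (L ++ M) Br
    no-win-now (S , len , uniq , S⊆ , col , open-S) = by (All.all? (_∈? M) S)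
      where
      open ℕₚ.≤-Reasoning
      new : count S L ≤ m T
      new = ℕₚ.≤-trans (count≤length L uniq) (ℕₚ.≤-trans (ℕₚ.≤-reflexive (proj₁ legal)) (m≤mT 1≤t t≤T))
      located : ∀ {p} → p ∈ S → p ∈ L ++ played H 0 t
      located p∈ = [ ∈-++⁺ˡ , (λ p∈M → let v , v<t , p∈v = M⊆H p∈M in ∈-++⁺ʳ L (∈-played⁺ H 0 t z≤n v<t p∈v)) ]′ (∈-++⁻ L (All.lookup S⊆ p∈))
      too-few : ∃[ u ] (u ∈ S × u ∉ M) → n < n
      too-few (u , u∈ , u∉M) = begin-strict
        n                                                ≡⟨ len ⟨
        length S                                         ≤⟨ length≤count (L ++ played H 0 t) uniq located ⟩
        count S (L ++ played H 0 t)                      ≤⟨ count-++ L (played H 0 t) uniq ⟩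
        count S L + count S (played H 0 t)               ≤⟨ ℕₚ.+-mono-≤ new (count-past proper uniq col open-S u∈ u∉M t done) ⟩
        m T + (8 * B * n′ + 1)                           <⟨ short ⟩
        n                                                ∎
      by : Dec (All (_∈ M) S) → ⊥
      by (yes S⊆M) = no-win (S , len , uniq , S⊆M , col , open-S)
      by (no S⊈M) = ℕₚ.<-irrefl refl (too-few (find (Allₚ.¬All⇒Any¬ (_∈? M) S S⊈M)))

    private
      H′ : History
      H′ v with v ℕₚ.≟ t
      ... | yes _ = L
      ... | no _ = H v

      H′-t : H′ t ≡ L
      H′-t with t ℕₚ.≟ t
      ... | yes _ = refl
      ... | no t≢t = contradiction refl t≢t

      H′-old : ∀ {v} → v ≢ t → H′ v ≡ H v
      H′-old {v} v≢t with v ℕₚ.≟ t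
      ... | yes v≡t = contradiction v≡t v≢t
      ... | no _ = refl

      H′⁻ : ∀ v {p} → p ∈ H′ v → (v ≡ t × p ∈ L) ⊎ p ∈ H v
      H′⁻ v p∈ with v ℕₚ.≟ t
      ... | yes v≡t = inj₁ (v≡t , p∈)
      ... | no _ = inj₂ p∈

      fresh : ∀ {p} → p ∈ L → p ∉ M
      fresh p∈L p∈M = All.lookup (proj₂ (proj₂ legal)) p∈L (∈-++⁺ˡ p∈M)

      proper′ : Proper H′
      proper′ = record { unique = unique′ ; disjoint = disjoint′ }
        where
        unique′ : ∀ v → Unique (H′ v)
        unique′ v with v ℕₚ.≟ t
        ... | yes _ = proj₁ (proj₂ legal)
        ... | no _ = Proper.unique proper v
        disjoint′ : ∀ {v w p} → p ∈ H′ v → p ∈ H′ w → v ≡ w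
        disjoint′ {v} {w} p∈v p∈w with H′⁻ v p∈v | H′⁻ w p∈w
        ... | inj₁ (v≡t , _) | inj₁ (w≡t , _) = trans v≡t (sym w≡t)
        ... | inj₁ (_ , p∈L) | inj₂ p∈H = contradiction (H⊆M p∈H) (fresh p∈L)
        ... | inj₂ p∈H | inj₁ (_ , p∈L) = contradiction (H⊆M p∈H) (fresh p∈L)
        ... | inj₂ p∈v′ | inj₂ p∈w′ = Proper.disjoint proper p∈v′ p∈w′

      H′⊆ : ∀ v {p} → p ∈ H′ v → p ∈ L ++ M
      H′⊆ v p∈ = [ (λ (_ , p∈L) → ∈-++⁺ˡ p∈L) , (λ p∈H → ∈-++⁺ʳ L (H⊆M p∈H)) ]′ (H′⁻ v p∈)

      size′ : ∀ v → 1 ≤ v → v < suc t → length (H′ v) ≤ m v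
      size′ v 1≤v v≤t with v ℕₚ.≟ t
      ... | yes refl = ℕₚ.≤-reflexive (proj₁ legal)
      ... | no v≢t = size v 1≤v (ℕₚ.≤∧≢⇒< (s≤s⁻¹ v≤t) v≢t)

      H′0 : H′ 0 ≡ []
      H′0 = trans (H′-old (λ { refl → ℕₚ.n≮0 1≤t })) H0

    module _ (t<T : t < T) (mono : ∀ {v} → 1 ≤ v → v ≤ t → m v ≤ m t) where

      private
        sizes : ∀ v → v ≤ t → length (H′ v) ≤ m t
        sizes zero _ = ℕₚ.≤-trans (ℕₚ.≤-reflexive (cong length H′0)) z≤n
        sizes (suc v) v≤t = ℕₚ.≤-trans (size′ (suc v) (s≤s z≤n) (s≤s v≤t)) (mono (s≤s z≤n) v≤t)

        R : List (Point × Point)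
        R = requests H′ t

      breaker-reply : ∃[ L′ ] (LegalMove (b t) (L ++ M ++ Br) L′ × Invariant (suc t) (L ++ M) (L′ ++ Br))
      breaker-reply = answer (kill-all (L ++ M) R (λ r∈ → let z≢x , v , _ , x∈ = requests⁻ H′ t r∈ in z≢x , H′⊆ v x∈))
        where
        finish : ∀ W → (∀ {B} → All (_∈ B) W → ∀ {z x} → (z , x) ∈ R → Dead (L ++ M) B z x) →
          ∃[ L′ ] (LegalMove (b t) ((L ++ M) ++ Br) L′ × All (_∈ (L′ ++ Br)) W) →
          ∃[ L′ ] (LegalMove (b t) (L ++ M ++ Br) L′ × Invariant (suc t) (L ++ M) (L′ ++ Br))
        finish W W-dead (L′ , legal′ , W∈) = L′ , subst (λ C → LegalMove (b t) C L′) (++-assoc L M Br) legal′ , record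
          { H = H′
          ; proper = proper′
          ; H0 = H′0
          ; size = size′
          ; H⊆M = λ {v} → H′⊆ v
          ; M⊆H = located′
          ; done = done′
          ; no-win = λ (S , len , uniq , S⊆ , col , open-S) → no-win-now (S , len , uniq , S⊆ , col , open-S ∘ ∈-++⁺ʳ L′)
          }
          where
          located′ : ∀ {p} → p ∈ L ++ M → ∃[ v ] (v < suc t × p ∈ H′ v)
          located′ {p} p∈ = [ (λ p∈L → t , ℕₚ.≤-refl , subst (p ∈_) (sym H′-t) p∈L)
                            , (λ p∈M → let v , v<t , p∈v = M⊆H p∈M in
                                v , ℕₚ.m≤n⇒m≤1+n v<t , subst (p ∈_) (sym (H′-old (ℕₚ.<⇒≢ v<t))) p∈v) ]′ (∈-++⁻ L p∈)
          done′ : ∀ v → v < suc t → ∀ {z x} → (z , x) ∈ requests H′ v → Dead (L ++ M) (L′ ++ Br) z x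
          done′ v v≤t {z} {x} r∈ = [ old , (λ { refl → W-dead W∈ r∈ }) ]′ (ℕₚ.m≤n⇒m<n∨m≡n (s≤s⁻¹ v≤t))
            where
            old : v < t → Dead (L ++ M) (L′ ++ Br) z x
            old v<t = Dead-mono {z = z} {x = x} (∈-++⁺ʳ L) (∈-++⁺ʳ L′) (done v v<t
              (subst ((z , x) ∈_) (requests-cong v λ w w≤v → H′-old (ℕₚ.<⇒≢ (ℕₚ.≤-<-trans w≤v v<t))) r∈))
        answer : ∃[ W ] (length W ≡ 2 * length R × All (_∉ (L ++ M)) W ×
            (∀ {B} → All (_∈ B) W → ∀ {z x} → (z , x) ∈ R → Dead (L ++ M) B z x)) →
          ∃[ L′ ] (LegalMove (b t) (L ++ M ++ Br) L′ × Invariant (suc t) (L ++ M) (L′ ++ Br))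
        answer (W , lenW , W∉ , W-dead) = finish W W-dead (reply (L ++ M) Br W (b t) W∉
          (ℕₚ.≤-trans (ℕₚ.≤-reflexive lenW) (budget proper′ t 1≤t t<T sizes)))

  breaker-survives : (∀ {v t} → 1 ≤ v → v ≤ t → m v ≤ m t) → ∀ r t {M Br} → 1 ≤ t → t + r ≤ T → Invariant t M Br → ¬ MakerWinsWithin n m b r t M Br
  breaker-survives mono zero t 1≤t t≤T inv (L , legal , win) =
    Turn.no-win-now inv 1≤t (ℕₚ.≤-trans (ℕₚ.m≤m+n t 0) t≤T) legal win
  breaker-survives mono (suc r) t 1≤t t≤T inv (L , legal , inj₁ win) =
    Turn.no-win-now inv 1≤t (ℕₚ.≤-trans (ℕₚ.m≤m+n t (suc r)) t≤T) legal win
  breaker-survives mono (suc r) t 1≤t t+r≤T inv (L , legal , inj₂ continue) =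
    let L′ , legal′ , inv′ = Turn.breaker-reply inv 1≤t (ℕₚ.<⇒≤ t<T) legal t<T mono
    in breaker-survives mono r (suc t) (s≤s z≤n) t+r≤T′ inv′ (continue L′ legal′)
    where
    t+r≤T′ : suc t + r ≤ T
    t+r≤T′ = ℕₚ.≤-trans (ℕₚ.≤-reflexive (sym (ℕₚ.+-suc t r))) t+r≤T
    t<T : t < T
    t<T = ℕₚ.≤-trans (ℕₚ.m≤m+n (suc t) r) t+r≤T′

-- Choice of the parameters for given n and T

module BreakerStrategy (m b : ℕ → ℕ) (m-mono : ∀ {s t} → 1 ≤ s → s ≤ t → m s ≤ m t) (m≤ : ∀ {t} → 1 ≤ t → m t ≤ t)
  (k y B D E K T₀ : ℕ) (1≤k : 1 ≤ k) (1≤y : 1 ≤ y) (16≤B : 16 ≤ B) (2^y≤B : 2 ^ y ≤ B) (D≡ : D ≡ 16 * B * k) (E≡ : E ≡ 4 * D)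
  (K≥ : 32 * (288 * E ^ 3) + 16 * E ^ 3 * B + 32 * (7 * E) ≤ K)
  (linear : ∀ {t} → T₀ ≤ t → 1 ≤ t → K * t ≤ b t * suc (m t)) (power : ∀ {t} → T₀ ≤ t → 1 ≤ t → K ^ y * t ≤ b t ^ y)
  (n T : ℕ) (n-large : D * (2 ^ suc T₀ * suc (T₀ * T₀)) + 2 * k ≤ n) (few : k * m T + n < k * n) where

  private
    1≤D : 1 ≤ D
    1≤D = subst (1 ≤_) (sym D≡) (ℕₚ.*-mono-≤ {1} {16 * B} (ℕₚ.*-mono-≤ {1} {16} (s≤s z≤n) (ℕₚ.≤-trans (s≤s z≤n) 16≤B)) 1≤k)

    instance
      D≢0 : NonZero D
      D≢0 = >-nonZero 1≤D

    n′ : ℕ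
    n′ = n / D

    n′-large : 2 ^ suc T₀ * suc (T₀ * T₀) ≤ n′
    n′-large = ℕₚ.≤-trans (ℕₚ.≤-reflexive (sym (m*n/n≡m _ D))) (/-monoˡ-≤ D
      (ℕₚ.≤-trans (ℕₚ.≤-reflexive (ℕₚ.*-comm _ D)) (ℕₚ.≤-trans (ℕₚ.m≤m+n _ (2 * k)) n-large)))

    1≤n′ : 1 ≤ n′
    1≤n′ = ℕₚ.≤-trans (ℕₚ.*-mono-≤ {1} {2 ^ suc T₀} (ℕₚ.m^n>0 2 (suc T₀)) (s≤s z≤n)) n′-large

    n≤2Dn′ : n ≤ 2 * D * n′
    n≤2Dn′ = begin
      n                              ≡⟨ m≡m%n+[m/n]*n n D ⟩
      n % D + n′ * D        ≤⟨ ℕₚ.+-monoˡ-≤ (n′ * D) (ℕₚ.≤-trans (ℕₚ.<⇒≤ (m%n<n n D)) (ℕₚ.m≤n*m D n′ {{>-nonZero 1≤n′}})) ⟩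
      n′ * D + n′ * D                ≡⟨ solve 2 (λ a d → a :* d :+ a :* d := con 2 :* d :* a) refl n′ D ⟩
      2 * D * n′                     ∎
      where
      open ℕₚ.≤-Reasoning
      open Data.Nat.Solver.+-*-Solver

    n′≤n : n′ ≤ n
    n′≤n = ℕₚ.≤-trans (ℕₚ.m≤m*n n′ D) (m/n*n≤m n D)

    1≤n : 1 ≤ n
    1≤n = ℕₚ.≤-trans 1≤n′ n′≤n

    module Log₂ = Logarithm 2 ℕₚ.≤-refl

    J : ℕ
    J = Log₂.log n′

    2^J≤n′ : 2 ^ J ≤ n′
    2^J≤n′ = Log₂.log-lower 1≤n′

    T₀<J : T₀ < J
    T₀<J = Log₂.≤log (ℕₚ.≤-trans (ℕₚ.m≤m*n (2 ^ suc T₀) (suc (T₀ * T₀))) n′-large)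

    open Cost B n′ J 16≤B 2^J≤n′
    open Strategy B n′ J 2≤B

    -- The origin of E = 4D: rounding n / D costs a factor 2, and rounding n′ to w, by a logarithm
    -- or a quotient, another factor 2.
    double : ∀ w → n′ ≤ 2 * w → n ≤ E * w
    double w n′≤ = begin
      n                     ≤⟨ n≤2Dn′ ⟩
      2 * D * n′            ≤⟨ ℕₚ.*-monoʳ-≤ (2 * D) n′≤ ⟩
      2 * D * (2 * w)       ≡⟨ solve 2 (λ d w → con 2 :* d :* (con 2 :* w) := con 4 :* d :* w) refl D w ⟩
      4 * D * w             ≡⟨ cong (_* w) E≡ ⟨
      E * w                 ∎
      where
      open ℕₚ.≤-Reasoning
      open Data.Nat.Solver.+-*-Solver

    n≤allowance : ∀ j → j ≤ J → n ≤ E * 2 ^ j * allowance j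
    n≤allowance j j≤J = ℕₚ.≤-trans (double (2 ^ j * a) (begin
      n′                     ≤⟨ ℕₚ.<⇒≤ (n′<allowance j) ⟩
      suc a * 2 ^ j          ≤⟨ ℕₚ.*-monoˡ-≤ (2 ^ j) (ℕₚ.+-monoˡ-≤ a (1≤allowance j (ℕₚ.≤-trans (ℕₚ.^-monoʳ-≤ 2 j≤J) 2^J≤n′))) ⟩
      (a + a) * 2 ^ j        ≡⟨ solve 2 (λ a w → (a :+ a) :* w := con 2 :* (w :* a)) refl a (2 ^ j) ⟩
      2 * (2 ^ j * a)        ∎)) (ℕₚ.≤-reflexive (sym (ℕₚ.*-assoc E (2 ^ j) a)))
      where
      open ℕₚ.≤-Reasoning
      open Data.Nat.Solver.+-*-Solver
      a : ℕ
      a = allowance j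

    n≤E2^J : n ≤ E * 2 ^ J
    n≤E2^J = double (2 ^ J) (ℕₚ.<⇒≤ (Log₂.log-upper n′))

    mT<n : m T < n
    mT<n = ℕₚ.*-cancelˡ-< k (m T) n (ℕₚ.≤-<-trans (ℕₚ.m≤m+n (k * m T) n) few)

    -- `few` says m T < (1 - 1 / k) n. As D = 16Bk, the term 8Bn′ is at most n / 2k, and 2k ≤ n
    -- gives the same bound for the added 1.
    short : m T + (8 * B * n′ + 1) < n
    short = ℕₚ.*-cancelˡ-< (2 * k) _ _ (begin-strict
      2 * k * (m T + (8 * B * n′ + 1))
        ≡⟨ solve 4 (λ k m b n → con 2 :* k :* (m :+ (con 8 :* b :* n :+ con 1)) := con 2 :* (k :* m) :+ (n :* (con 16 :* b :* k) :+ con 2 :* k)) refl k (m T) B n′ ⟩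
      2 * (k * m T) + (n′ * (16 * B * k) + 2 * k)
        ≡⟨ cong (λ z → 2 * (k * m T) + (n′ * z + 2 * k)) D≡ ⟨
      2 * (k * m T) + (n′ * D + 2 * k)
        ≤⟨ ℕₚ.+-monoʳ-≤ (2 * (k * m T)) (ℕₚ.+-mono-≤ (m/n*n≤m n D) (ℕₚ.≤-trans (ℕₚ.m≤n+m (2 * k) (D * (2 ^ suc T₀ * suc (T₀ * T₀)))) n-large)) ⟩
      2 * (k * m T) + (n + n)
        ≡⟨ solve 2 (λ a n → con 2 :* a :+ (n :+ n) := con 2 :* (a :+ n)) refl (k * m T) n ⟩
      2 * (k * m T + n)
        <⟨ ℕₚ.*-monoʳ-< 2 few ⟩
      2 * (k * n)
        ≡⟨ ℕₚ.*-assoc 2 k n ⟨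
      2 * k * n ∎)
      where
      open ℕₚ.≤-Reasoning
      open Data.Nat.Solver.+-*-Solver

    -- As 2 ^ y ≤ B, the y-th power of 2 ^ Λ is at most B ^ Λ ≤ 2u, which `power` compares with b u.
    -- The factor 2 of 2u is absorbed by the 2 in front of b u.
    exponential : ∀ {u} → T₀ ≤ u → 1 ≤ u → K * 2 ^ log (suc u) ≤ 2 * b u
    exponential {u} T₀≤u 1≤u = ^-cancelˡ-≤ y 1≤y (begin
      (K * 2 ^ Λ) ^ y          ≡⟨ ^-distribʳ-* y K (2 ^ Λ) ⟩
      K ^ y * (2 ^ Λ) ^ y      ≤⟨ ℕₚ.*-monoʳ-≤ (K ^ y) 2^Λ^y≤ ⟩
      K ^ y * (2 * u)          ≡⟨ solve 2 (λ a u → a :* (con 2 :* u) := con 2 :* (a :* u)) refl (K ^ y) u ⟩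
      2 * (K ^ y * u)          ≤⟨ ℕₚ.*-mono-≤ 2≤2^y (power T₀≤u 1≤u) ⟩
      2 ^ y * b u ^ y          ≡⟨ ^-distribʳ-* y 2 (b u) ⟨
      (2 * b u) ^ y            ∎)
      where
      open ℕₚ.≤-Reasoning
      open Data.Nat.Solver.+-*-Solver
      Λ : ℕ
      Λ = log (suc u)
      2≤2^y : 2 ≤ 2 ^ y
      2≤2^y = ℕₚ.^-monoʳ-≤ 2 1≤y
      2^Λ^y≤ : (2 ^ Λ) ^ y ≤ 2 * u
      2^Λ^y≤ = begin
        (2 ^ Λ) ^ y      ≡⟨ trans (ℕₚ.^-*-assoc 2 Λ y) (trans (cong (2 ^_) (ℕₚ.*-comm Λ y)) (sym (ℕₚ.^-*-assoc 2 y Λ))) ⟩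
        (2 ^ y) ^ Λ      ≤⟨ ℕₚ.^-monoˡ-≤ Λ 2^y≤B ⟩
        B ^ Λ            ≤⟨ log-lower (s≤s z≤n) ⟩
        suc u            ≤⟨ ℕₚ.+-monoˡ-≤ u 1≤u ⟩
        u + u            ≡⟨ cong (u +_) (ℕₚ.+-identityʳ u) ⟨
        2 * u            ∎

    -- From T₀ on the growth of b pays, with m u < n turning suc (m u) into n. Before T₀ at most T₀
    -- · T₀ points have been played, which n′ exceeds by enough that nothing is requested.
    budget : ∀ {H} → Proper H → ∀ u → 1 ≤ u → u < T → (∀ v → v ≤ u → length (H v) ≤ m u) → 2 * length (requests H u) ≤ b u
    budget {H} proper u 1≤u u<T sizes = [ late , early ]′ (ℕₚ.≤-<-connex T₀ u)
      where
      mu<n : m u < n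
      mu<n = ℕₚ.≤-<-trans (m-mono 1≤u (ℕₚ.<⇒≤ u<T)) mT<n
      late : T₀ ≤ u → 2 * length (requests H u) ≤ b u
      late T₀≤u = affordable proper u n E (λ v v≤u → ℕₚ.≤-trans (sizes v v≤u) (ℕₚ.<⇒≤ mu<n)) n′≤n n≤allowance n≤E2^J K (b u) 1≤n 1≤u K≥
        (ℕₚ.≤-trans (linear T₀≤u 1≤u) (ℕₚ.*-monoʳ-≤ (b u) mu<n)) (exponential T₀≤u 1≤u)
      early : u < T₀ → 2 * length (requests H u) ≤ b u
      early u<T₀ = ℕₚ.≤-trans (ℕₚ.≤-reflexive (cong (2 *_) (no-requests u (m u) sizes Λ<J (≤allowance Λ (begin
          suc u * m u * 2 ^ Λ                  ≤⟨ ℕₚ.*-mono-≤ (ℕₚ.*-mono-≤ u<T₀ (ℕₚ.≤-trans (m≤ 1≤u) (ℕₚ.<⇒≤ u<T₀))) (ℕₚ.^-monoʳ-≤ 2 (ℕₚ.m≤n⇒m≤1+n Λ≤T₀)) ⟩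
          T₀ * T₀ * 2 ^ suc T₀                 ≤⟨ ℕₚ.*-monoˡ-≤ (2 ^ suc T₀) (ℕₚ.n≤1+n (T₀ * T₀)) ⟩
          suc (T₀ * T₀) * 2 ^ suc T₀           ≡⟨ ℕₚ.*-comm (suc (T₀ * T₀)) (2 ^ suc T₀) ⟩
          2 ^ suc T₀ * suc (T₀ * T₀)           ≤⟨ n′-large ⟩
          n′                                   ∎))))) z≤n
        where
        open ℕₚ.≤-Reasoning
        Λ : ℕ
        Λ = log (suc u)
        Λ≤T₀ : Λ ≤ T₀
        Λ≤T₀ = ℕₚ.≤-trans (log≤self (suc u) (s≤s z≤n)) u<T₀
        Λ<J : Λ < J
        Λ<J = ℕₚ.≤-<-trans Λ≤T₀ T₀<J

  maker-loses : ¬ MakerWinsBy n m b T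
  maker-loses = by T refl
    where
    open Game B n′ J n T m b 2≤B (ℕₚ.≤-trans (s≤s z≤n) T₀<J) 2^J≤n′ m-mono short budget
    by : ∀ T′ → T′ ≡ T → ¬ MakerWinsBy n m b T′
    by (suc r) eq wins = breaker-survives m-mono r 1 (s≤s z≤n) (ℕₚ.≤-reflexive eq) initially wins

-- The upper bound on m τ, and the conclusion

module Maker (m b : ℕ → ℕ) (m≤ : ∀ {t} → 1 ≤ t → m t ≤ t) (m-step : ∀ {t} → 1 ≤ t → m (suc t) ≤ suc (m t)) where

  mτ≤n : ∀ {n T} → 1 ≤ n → IsTau n m b T → m T ≤ n
  mτ≤n {T = suc zero} 1≤n _ = ℕₚ.≤-trans (m≤ ℕₚ.≤-refl) 1≤n
  mτ≤n {n} {suc (suc r)} 1≤n (_ , minimal) = ℕₚ.≮⇒≥ λ n<m →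
    minimal (suc r) ℕₚ.≤-refl (maker-wins n m b r 1 [] [] (s≤s⁻¹ (ℕₚ.≤-trans n<m (m-step (s≤s z≤n)))))

theorem3 : (α : NonNegReal) → α <1 → (m b : ℕ → ℕ) → IsFloorPow α m →
    Monotone b → IsOmegaPow1- α b → BreakerWin m b
theorem3 α α<1 m b floor _ ω k 1≤k = N , λ n N≤n T τ → upper n N≤n T τ , lower n N≤n T τ
  where
  y B D E K T₀ N : ℕ
  y = proj₁ (scaled⇒power α α<1 m floor)
  -- The 4 gives 16 ≤ B for the first geometric sum, the y gives 2 ^ y ≤ B for the second.
  B = 2 ^ (y + 4)
  D = 16 * B * k
  E = 4 * D
  -- Exactly what `affordable` demands. K depends on k and α but not on n, so T₀ is available when N
  -- is chosen.
  K = 32 * (288 * E ^ 3) + 16 * E ^ 3 * B + 32 * (7 * E)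
  T₀ = proj₁ (ω K)
  N = D * (2 ^ suc T₀ * suc (T₀ * T₀)) + 2 * k

  1≤N : 1 ≤ N
  1≤N = ℕₚ.≤-trans 1≤k (ℕₚ.≤-trans (ℕₚ.m≤m+n k (k + 0)) (ℕₚ.m≤n+m (2 * k) (D * (2 ^ suc T₀ * suc (T₀ * T₀)))))

  upper : ∀ n → N ≤ n → ∀ T → IsTau n m b T → k * m T ≤ k * n + n
  upper n N≤n T τ = ℕₚ.≤-trans (ℕₚ.*-monoʳ-≤ k (Maker.mτ≤n m b (m≤t α α<1 m floor) (m-step α α<1 m floor) (ℕₚ.≤-trans 1≤N N≤n) τ)) (ℕₚ.m≤m+n (k * n) n)

  lower : ∀ n → N ≤ n → ∀ T → IsTau n m b T → k * n ≤ k * m T + n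
  lower n N≤n T (wins , _) = ℕₚ.≮⇒≥ λ few → BreakerStrategy.maker-loses m b (m-mono α α<1 m floor) (m≤t α α<1 m floor)
    k y B D E K T₀ 1≤k (proj₁ (proj₂ (scaled⇒power α α<1 m floor)))
    (ℕₚ.^-monoʳ-≤ 2 (ℕₚ.m≤n+m 4 y)) (ℕₚ.^-monoʳ-≤ 2 (ℕₚ.m≤m+n y 4)) refl refl ℕₚ.≤-refl
    (λ {t} T₀≤t 1≤t → scaled⇒linear α α<1 m floor {K} {t} {b t} 1≤t (proj₂ (ω K) t T₀≤t 1≤t))
    (λ {t} T₀≤t 1≤t → proj₂ (proj₂ (scaled⇒power α α<1 m floor)) {K} {t} {b t} 1≤t (proj₂ (ω K) t T₀≤t 1≤t))
    n T N≤n few wins
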